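{- Let $\mathbb V$ be a Schubert representation of $\widehat H_n$ with evaluation map $\operatorname{ev}$. For $\mu,\nu\subseteq(n-k)^k$, $\operatorname{ev}(\overline T_\mu\cdot\mathcal Y_\nu)=\operatorname{ev}(\mathcal Y_{\mathrm{id}})$ if $\mu=\nu$ and $=0$ otherwise. Moreover, for every $\mathbb F$-linear combination $f$ of the $\mathcal Y_\lambda$ ($\lambda\subseteq(n-k)^k$), $$f=\frac1{\operatorname{ev}(\mathcal Y_{\mathrm{id}})}\sum_{\lambda\subseteq(n-k)^k}\operatorname{ev}(\overline T_\lambda\cdot f)\,\mathcal Y_\lambda.$$
   Context: $\mathcal A_\hbar=\mathbb Q[p,q,\hbar]$; $\widehat H_n$ is generated over $\mathcal A_\hbar$ by $T_1,\dots,T_{n-1},x_1,\dots,x_n$ with relations $(T_i+p)(T_i-q)=0$, braid relations, $x_ix_j=x_jx_i$, $T_ix_j=x_jT_i$ ($j\ne i,i+1$), $T_ix_i=x_{i+1}T_i+(\hbar-(p-q)x_i)$, $T_ix_{i+1}=x_iT_i-(\hbar-(p-q)x_i)$; $T_w,\overline T_w$ via reduced words with $\overline T_i=T_i+p-q$. Schubert representation: field $\mathbb F$ with $t_1,\dots,t_n$, ring map $\mathcal A_\hbar\to\mathbb F$, $\mathbb F$-space $\mathbb V$ with $\widehat H_n$-action, basis $\mathcal Y_w=T_{w^{ -1}w_0}\mathcal Y_{w_0}$, $\mathbb F$-linear $\operatorname{ev}$ with $\operatorname{ev}(\mathcal Y_w)\ne0\iff w=\mathrm{id}$ and $\operatorname{ev}(x_i\mathcal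 Y_w)=t_i\operatorname{ev}(\mathcal Y_w)$. For $\lambda\subseteq(n-k)^k$, $w_\lambda$ is the Grassmannian permutation with $w_\lambda(k+1-i)=\lambda_i+k+1-i$ ($1\le i\le k$), increasing on $\{k+1,\dots,n\}$. $[m]=(p^m-q^m)/(p-q)$, $[m]!=\prod_{j\le m}[j]$, $d=\binom k2+\binom{n-k}2$, $\Sigma^n_k=\frac1{[k]![n-k]!}\sum_{v\in S_k\times S_{n-k}}q^{d-\ell(v)}\overline T_v$, $\overline T_\lambda=\overline T_{w_\lambda}\Sigma^n_k$, $\mathcal Y_\lambda=\sum_{v\in S_k\times S_{n-k}}p^{\ell(v)}\mathcal Y_{w_\lambda v}$ (the quantities $[k]![n-k]!$ are assumed invertible in $\mathbb F$). -}

module Defs where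

open import Algebra.Apartness.Bundles using (HeytingField; HeytingCommutativeRing)
open import Algebra.Bundles using (CommutativeRing; Ring)
open import Algebra.Definitions using (Invertible)
open import Algebra.Module.Bundles using (Module)
open import Algebra.Module.Structures using (IsLeftModule)
open import Algebra.Morphism.Structures using (IsRingHomomorphism)
open import Data.Bool.Base using (Bool; true; false; if_then_else_; _∧_)
open import Data.Empty using (⊥-elim)
open import Data.Fin.Base using (Fin; zero; suc; toℕ; fromℕ<; inject₁; opposite; _↑ˡ_; _↑ʳ_; splitAt; punchOut)
open import Data.Fin.Permutation using (Permutation′; permutation; _⟨$⟩ʳ_; _⟨$⟩ˡ_; id; flip; _∘ₚ_; transpose; reverse; insert; remove; insert-remove; inverseˡ; inverseʳ) renaming (_≈_ to _≈ₚ_)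
open import Data.List.Base using (List; []; _∷_; _∷ʳ_; map; foldr; length; allFin; concatMap; cartesianProductWith)
open import Data.List.Relation.Binary.Disjoint.Propositional using (Disjoint)
open import Data.Nat.Base using (ℕ; zero; suc; pred; _+_; _∸_; _≤_; _<_; z≤n; s≤s; z<s; s<s; s≤s⁻¹)
open import Data.Nat.Combinatorics using (_C_)
open import Data.Product.Base using (∃; _×_; _,_; proj₁; proj₂)
open import Data.Rational.Properties using () renaming (+-*-commutativeRing to ℚ-commutativeRing)
open import Data.Sum.Base using (_⊎_; inj₁; inj₂)
open import Data.Sum.Function.Propositional using (_⊎-↔_)
open import Function.Base using (_∘_)
open import Function.Bundles using (_⇔_; module Equivalence)
open import Function.Construct.Composition using (_↔-∘_)
open import Function.Construct.Symmetry using (↔-sym)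
open import Function.Definitions using (Injective)
open import Level using (Level; 0ℓ; _⊔_) renaming (suc to lsuc)
open import Relation.Binary.Bundles using (Setoid)
open import Relation.Binary.Core using (Rel)
open import Relation.Binary.Definitions using (tri<; tri≈; tri>)
open import Relation.Binary.PropositionalEquality.Core using (_≡_; _≢_; refl; sym; trans; cong; cong₂; subst; subst₂)
open import Relation.Nullary.Decidable.Core using (Dec; yes; no; does)
open import Relation.Nullary.Negation.Core using (¬_; contradiction)

import Algebra.Module.Construct.TensorUnit as TensorUnit
import Algebra.Module.Morphism.Structures as ModuleMorphism
import Algebra.Properties.CommutativeMonoid.Sum as MonoidSum
import Algebra.Properties.Ring as RingProperties
import Algebra.Properties.Semiring.Exp as Exp
import Data.Fin.Base as Fin
import Data.Fin.Properties as Fin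
import Data.List.Membership.Propositional as Membership
import Data.List.Membership.Propositional.Properties as Membership
import Data.List.Membership.Setoid as SetoidMembership
import Data.List.Membership.Setoid.Properties as SetoidMembership
import Data.List.Properties as List
import Data.List.Relation.Unary.Unique.Setoid as SetoidUnique
import Data.List.Relation.Unary.Unique.Setoid.Properties as SetoidUnique
import Data.List.Relation.Unary.Unique.Propositional as Unique
import Data.List.Relation.Unary.Unique.Propositional.Properties as Unique
import Data.List.Relation.Unary.AllPairs as AllPairs
import Data.List.Relation.Unary.AllPairs.Properties as AllPairs
import Data.List.Relation.Unary.All as All
import Data.List.Relation.Unary.All.Properties as All
import Data.List.Relation.Unary.Any as Any
import Data.Nat.Properties as ℕ
import Relation.Binary.PropositionalEquality.Properties as ≡
import Relation.Binary.Reasoning.Setoid as SetoidReasoning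

-- The associative unital K-algebra K⟨X⟩/(s - t : s ∼ t), as the setoid of
-- noncommutative K-polynomial expressions modulo the least congruence that
-- satisfies the K-algebra axioms and contains _∼_.
module Presentation {c ℓ x : Level} (K : CommutativeRing c ℓ) (X : Set x) where
  private module K = CommutativeRing K

  infixl 6 _⊕_ _⊖_
  infixl 7 _⊗_

  data Term : Set (c ⊔ x) where
    con : K.Carrier → Term
    gen : X → Term
    _⊕_ : Term → Term → Term
    _⊗_ : Term → Term → Term
    neg : Term → Term

  _⊖_ : Term → Term → Term
  s ⊖ t = s ⊕ neg t

  module Quotient {r : Level} (_∼_ : Rel Term r) where
    infix 4 _≋_

    data _≋_ : Rel Term (c ⊔ ℓ ⊔ x ⊔ r) where
      relation : ∀ {s t} → s ∼ t → s ≋ t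
      ≋-refl  : ∀ {s} → s ≋ s
      ≋-sym   : ∀ {s t} → s ≋ t → t ≋ s
      ≋-trans : ∀ {s t u} → s ≋ t → t ≋ u → s ≋ u
      ⊕-cong  : ∀ {s s′ t t′} → s ≋ s′ → t ≋ t′ → s ⊕ t ≋ s′ ⊕ t′
      ⊗-cong  : ∀ {s s′ t t′} → s ≋ s′ → t ≋ t′ → s ⊗ t ≋ s′ ⊗ t′
      neg-cong : ∀ {s t} → s ≋ t → neg s ≋ neg t
      ⊕-assoc : ∀ s t u → (s ⊕ t) ⊕ u ≋ s ⊕ (t ⊕ u)
      ⊕-comm  : ∀ s t → s ⊕ t ≋ t ⊕ s
      ⊕-identityˡ : ∀ s → con K.0# ⊕ s ≋ s
      neg-inverseˡ : ∀ s → neg s ⊕ s ≋ con K.0#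
      ⊗-assoc : ∀ s t u → (s ⊗ t) ⊗ u ≋ s ⊗ (t ⊗ u)
      ⊗-identityˡ : ∀ s → con K.1# ⊗ s ≋ s
      distribˡ : ∀ s t u → s ⊗ (t ⊕ u) ≋ (s ⊗ t) ⊕ (s ⊗ u)
      distribʳ : ∀ s t u → (t ⊕ u) ⊗ s ≋ (t ⊗ s) ⊕ (u ⊗ s)
      con-cong : ∀ {a b} → a K.≈ b → con a ≋ con b
      con-+ : ∀ a b → con (a K.+ b) ≋ con a ⊕ con b
      con-* : ∀ a b → con (a K.* b) ≋ con a ⊗ con b
      con-central : ∀ a s → con a ⊗ s ≋ s ⊗ con a

    ring : Ring (c ⊔ x) (c ⊔ ℓ ⊔ x ⊔ r)
    ring = record
      { Carrier = Term
      ; _≈_ = _≋_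
      ; _+_ = _⊕_
      ; _*_ = _⊗_
      ; -_ = neg
      ; 0# = con K.0#
      ; 1# = con K.1#
      ; isRing = record
        { +-isAbelianGroup = record
          { isGroup = record
            { isMonoid = record
              { isSemigroup = record
                { isMagma = record
                  { isEquivalence = record { refl = ≋-refl ; sym = ≋-sym ; trans = ≋-trans }
                  ; ∙-cong = ⊕-cong
                  }
                ; assoc = ⊕-assoc
                }
              ; identity = ⊕-identityˡ , λ s → ≋-trans (⊕-comm s _) (⊕-identityˡ s)
              }
            ; inverse = neg-inverseˡ , λ s → ≋-trans (⊕-comm s _) (neg-inverseˡ s)
            ; ⁻¹-cong = neg-cong
            }
          ; comm = ⊕-comm
          }
        ; *-cong = ⊗-cong
        ; *-assoc = ⊗-assoc
        ; *-identity = ⊗-identityˡ , λ s → ≋-trans (≋-sym (con-central _ s)) (⊗-identityˡ s)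
        ; distrib = distribˡ , distribʳ
        }
      }

data Parameter : Set where
  p̂ q̂ ħ̂ : Parameter

private module ℚ⟨pqħ⟩ = Presentation ℚ-commutativeRing Parameter

data Commutator : Rel ℚ⟨pqħ⟩.Term 0ℓ where
  commutator : ∀ s t → Commutator (s ℚ⟨pqħ⟩.⊗ t) (t ℚ⟨pqħ⟩.⊗ s)

-- The polynomial ring as the free commutative ℚ-algebra on p, q, ħ: the free
-- algebra modulo all commutators.
𝒜ħ : CommutativeRing 0ℓ 0ℓ
𝒜ħ = record
  { isCommutativeRing = record
    { isRing = Ring.isRing (ℚ⟨pqħ⟩.Quotient.ring Commutator)
    ; *-comm = λ s t → ℚ⟨pqħ⟩.Quotient.relation (commutator s t)
    }
  }

module 𝒜ħ where
  open CommutativeRing 𝒜ħ public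
  open Exp semiring public using (_^_)

p q ħ : 𝒜ħ.Carrier
p = ℚ⟨pqħ⟩.gen p̂
q = ℚ⟨pqħ⟩.gen q̂
ħ = ℚ⟨pqħ⟩.gen ħ̂

-- [m] = (pᵐ - qᵐ)/(p - q) = Σ_{a+b=m-1} pᵃ qᵇ, see [m]-quotient.
[_] : ℕ → 𝒜ħ.Carrier
[ zero ]  = 𝒜ħ.0#
[ suc m ] = p 𝒜ħ.* [ m ] 𝒜ħ.+ q 𝒜ħ.^ m

[_]! : ℕ → 𝒜ħ.Carrier
[ zero ]!  = 𝒜ħ.1#
[ suc m ]! = [ suc m ] 𝒜ħ.* [ m ]!

[m]-quotient : ∀ m → (p 𝒜ħ.- q) 𝒜ħ.* [ m ] 𝒜ħ.≈ p 𝒜ħ.^ m 𝒜ħ.- q 𝒜ħ.^ m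
[m]-quotient zero = 𝒜ħ.trans (𝒜ħ.zeroʳ _) (𝒜ħ.sym (𝒜ħ.-‿inverseʳ _))
[m]-quotient (suc m) = begin
  (p - q) * (p * [ m ] ⊹ q ^ m)                 ≈⟨ 𝒜ħ.distribˡ _ _ _ ⟩
  (p - q) * (p * [ m ]) ⊹ (p - q) * q ^ m       ≈⟨ 𝒜ħ.+-congʳ (x∙yz≈y∙xz _ _ _) ⟩
  p * ((p - q) * [ m ]) ⊹ (p - q) * q ^ m       ≈⟨ 𝒜ħ.+-cong (𝒜ħ.*-congˡ ([m]-quotient m)) ([y-z]x≈yx-zx _ _ _) ⟩
  p * (p ^ m - q ^ m) ⊹ (p * q ^ m - q * q ^ m) ≈⟨ 𝒜ħ.+-congʳ (x[y-z]≈xy-xz _ _ _) ⟩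
  (p * p ^ m - p * q ^ m) ⊹ (p * q ^ m - q * q ^ m) ≈⟨ 𝒜ħ.+-assoc _ _ _ ⟩
  p * p ^ m ⊹ (- (p * q ^ m) ⊹ (p * q ^ m - q * q ^ m)) ≈⟨ 𝒜ħ.+-congˡ (𝒜ħ.sym (𝒜ħ.+-assoc _ _ _)) ⟩
  p * p ^ m ⊹ ((- (p * q ^ m) ⊹ p * q ^ m) - q * q ^ m) ≈⟨ 𝒜ħ.+-congˡ (𝒜ħ.+-congʳ (𝒜ħ.-‿inverseˡ _)) ⟩
  p * p ^ m ⊹ (0# - q * q ^ m) ≈⟨ 𝒜ħ.+-congˡ (𝒜ħ.+-identityˡ _) ⟩
  p * p ^ m - q * q ^ m ∎
  where
  open 𝒜ħ using (_*_; -_; _-_; _^_; 0#) renaming (_+_ to infixl 6 _⊹_)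
  open SetoidReasoning 𝒜ħ.setoid
  open RingProperties 𝒜ħ.ring using (x[y-z]≈xy-xz; [y-z]x≈yx-zx)
  open import Algebra.Properties.CommutativeSemigroup 𝒜ħ.*-commutativeSemigroup using (x∙yz≈y∙xz)

-- Composition of functions, (u · v)(i) = u(v(i)); the library's _∘ₚ_ is
-- diagrammatic.
infixl 7 _·_
_·_ : ∀ {n} → Permutation′ n → Permutation′ n → Permutation′ n
u · v = v ∘ₚ u

infix 8 _⁻¹
_⁻¹ : ∀ {n} → Permutation′ n → Permutation′ n
_⁻¹ = flip

w₀ : ∀ {n} → Permutation′ n
w₀ = reverse

-- The index i ∈ {1,…,n-1} as the elements i and i+1 of {1,…,n}.
lo hi : ∀ {n} → Fin (pred n) → Fin n
lo {suc n} = inject₁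
hi {suc n} = suc

s : ∀ {n} → Fin (pred n) → Permutation′ n
s i = transpose (lo i) (hi i)

open MonoidSum ℕ.+-0-commutativeMonoid using (sum)

inversion : ∀ {n} → Permutation′ n → Fin n → Fin n → ℕ
inversion w i j =
  if does (i Fin.<? j) ∧ does (w ⟨$⟩ʳ j Fin.<? w ⟨$⟩ʳ i) then 1 else 0

ℓ : ∀ {n} → Permutation′ n → ℕ
ℓ w = sum λ i → sum λ j → inversion w i j

Descent : ∀ {n} → Permutation′ n → Fin (pred n) → Set
Descent w i = w ⟨$⟩ʳ hi i Fin.< w ⟨$⟩ʳ lo i

descent? : ∀ {n} (w : Permutation′ n) → Dec (∃ (Descent w))
descent? w = Fin.any? λ i → w ⟨$⟩ʳ hi i Fin.<? w ⟨$⟩ʳ lo i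

Word : ℕ → Set
Word n = List (Fin (pred n))

evaluate : ∀ {n} → Word n → Permutation′ n
evaluate = foldr (λ i w → s i · w) id

record IsReducedWord {n : ℕ} (w : Permutation′ n) (u : Word n) : Set where
  field
    evaluates : evaluate u ≈ₚ w
    minimal   : length u ≡ ℓ w

stripDescents : ∀ {n} → ℕ → Permutation′ n → Word n
stripDescents zero       w = []
stripDescents (suc fuel) w with descent? w
... | yes (i , _) = stripDescents fuel (w · s i) ∷ʳ i
... | no _        = []

-- A reduced word of w, see reducedWord-isReduced.
reducedWord : ∀ {n} → Permutation′ n → Word n
reducedWord w = stripDescents (ℓ w) w

-- All of S_n, each element once, see permutations-complete and
-- permutations-unique.
permutations : ∀ n → List (Permutation′ n)
permutations zero    = id ∷ []
permutations (suc n) = cartesianProductWith (insert zero) (allFin (suc n)) (permutations n)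

infixr 6 _⊞_
_⊞_ : ∀ {k m} → Permutation′ k → Permutation′ m → Permutation′ (k + m)
u ⊞ v = ↔-sym Fin.+↔⊎ ↔-∘ ((u ⊎-↔ v) ↔-∘ Fin.+↔⊎)

youngSubgroup : ∀ k m → List (Permutation′ (k + m))
youngSubgroup k m = cartesianProductWith _⊞_ (permutations k) (permutations m)

module SymmetricGroupFacts where
  open MonoidSum ℕ.+-0-commutativeMonoid using (sum-permute; ∑-distrib-+)

  sum-cong : ∀ {n} {f g : Fin n → ℕ} → (∀ i → f i ≡ g i) → sum f ≡ sum g
  sum-cong {zero}  f≗g = refl
  sum-cong {suc n} f≗g = cong₂ _+_ (f≗g zero) (sum-cong (f≗g ∘ suc))

  sum-zero : ∀ {n} {f : Fin n → ℕ} → (∀ i → f i ≡ 0) → sum f ≡ 0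
  sum-zero {zero}  f≗0 = refl
  sum-zero {suc n} f≗0 = cong₂ _+_ (f≗0 zero) (sum-zero (f≗0 ∘ suc))

  sum-zero⁻¹ : ∀ {n} (f : Fin n → ℕ) → sum f ≡ 0 → ∀ i → f i ≡ 0
  sum-zero⁻¹ {suc n} f eq zero    = ℕ.m+n≡0⇒m≡0 (f zero) eq
  sum-zero⁻¹ {suc n} f eq (suc i) = sum-zero⁻¹ (f ∘ suc) (ℕ.m+n≡0⇒n≡0 (f zero) eq) i

  sum-δ : ∀ {n} (i : Fin n) c → sum (λ x → if does (x Fin.≟ i) then c else 0) ≡ c
  sum-δ {suc n} zero    c = trans (cong (c +_) (sum-zero {n} {λ _ → 0} λ _ → refl)) (ℕ.+-identityʳ c)
  sum-δ (suc i) c = sum-δ i c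

  ⟨$⟩ʳ-injective : ∀ {n} (w : Permutation′ n) {i j} → w ⟨$⟩ʳ i ≡ w ⟨$⟩ʳ j → i ≡ j
  ⟨$⟩ʳ-injective w eq = trans (sym (inverseˡ w)) (trans (cong (w ⟨$⟩ˡ_) eq) (inverseˡ w))

  toℕ-hi : ∀ {n} (i : Fin (pred n)) → toℕ (hi {n} i) ≡ suc (toℕ (lo {n} i))
  toℕ-hi {suc n} i = cong suc (sym (Fin.toℕ-inject₁ i))

  data View {n : ℕ} (a b x : Fin n) : Fin n → Set where
    isFst : x ≡ a → View a b x b
    isSnd : x ≡ b → View a b x a
    other : x ≢ a → x ≢ b → View a b x x

  view : ∀ {n} (a b x : Fin n) → View a b x (transpose a b ⟨$⟩ʳ x)
  view a b x with x Fin.≟ a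
  ... | yes x≡a = isFst x≡a
  ... | no x≢a with x Fin.≟ b
  ...   | yes x≡b = isSnd x≡b
  ...   | no x≢b = other x≢a x≢b

  does-⇔ : ∀ {A B : Set} (A? : Dec A) (B? : Dec B) → (A → B) → (B → A) → does A? ≡ does B?
  does-⇔ (yes a) (yes b) f g = refl
  does-⇔ (yes a) (no ¬b) f g = contradiction (f a) ¬b
  does-⇔ (no ¬a) (yes b) f g = contradiction (g b) ¬a
  does-⇔ (no ¬a) (no ¬b) f g = refl

  does-no : ∀ {A : Set} (A? : Dec A) → ¬ A → does A? ≡ false
  does-no (yes a) ¬a = contradiction a ¬a
  does-no (no _)  ¬a = refl

  does-yes : ∀ {A : Set} (A? : Dec A) → A → does A? ≡ true
  does-yes (yes _) a = refl
  does-yes (no ¬a) a = contradiction a ¬a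

  module _ {n : ℕ} (w : Permutation′ n) where

    mono⇒inversion≡0 : (∀ {i j} → i Fin.< j → w ⟨$⟩ʳ i Fin.< w ⟨$⟩ʳ j) → ∀ i j → inversion w i j ≡ 0
    mono⇒inversion≡0 mono i j = if-∧ (i Fin.<? j) λ i<j → does-no (w ⟨$⟩ʳ j Fin.<? w ⟨$⟩ʳ i) (ℕ.<-asym (mono i<j))
      where
      if-∧ : ∀ {A : Set} (A? : Dec A) {b : Bool} → (A → b ≡ false) → (if does A? ∧ b then 1 else 0) ≡ 0
      if-∧ (no _)  f = refl
      if-∧ (yes a) f rewrite f a = refl

    inversion≡1 : ∀ {i j} → i Fin.< j → w ⟨$⟩ʳ j Fin.< w ⟨$⟩ʳ i → inversion w i j ≡ 1
    inversion≡1 {i} {j} i<j wj<wi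
      rewrite does-yes (i Fin.<? j) i<j | does-yes (w ⟨$⟩ʳ j Fin.<? w ⟨$⟩ʳ i) wj<wi = refl

    ℓ≡0⇒mono : ℓ w ≡ 0 → ∀ {i j} → i Fin.< j → w ⟨$⟩ʳ i Fin.< w ⟨$⟩ʳ j
    ℓ≡0⇒mono ℓ≡0 {i} {j} i<j with w ⟨$⟩ʳ i Fin.<? w ⟨$⟩ʳ j
    ... | yes wi<wj = wi<wj
    ... | no wi≮wj = contradiction (trans (sym (inversion≡1 i<j wj<wi)) inversion≡0) λ ()
      where
      wj<wi : w ⟨$⟩ʳ j Fin.< w ⟨$⟩ʳ i
      wj<wi = ℕ.≤∧≢⇒< (ℕ.≮⇒≥ wi≮wj) λ eq →
        ℕ.<-irrefl (cong toℕ (sym (⟨$⟩ʳ-injective w (Fin.toℕ-injective eq)))) i<j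
      inversion≡0 : inversion w i j ≡ 0
      inversion≡0 = sum-zero⁻¹ (inversion w i) (sum-zero⁻¹ (λ x → sum (inversion w x)) ℓ≡0 i) j

    module _ (i : Fin (pred n)) (d : Descent w i) where
      private
        a b : Fin n
        a = lo i
        b = hi i

        δ : Fin n → Fin n → ℕ
        δ x y = if does (x Fin.≟ b) then (if does (y Fin.≟ a) then 1 else 0) else 0

        a<b : a Fin.< b
        a<b = ℕ.≤-reflexive (sym (toℕ-hi {n} i))

        a≢b : a ≢ b
        a≢b a≡b = ℕ.<-irrefl (cong toℕ a≡b) a<b

        <a⇒<b : ∀ {x : Fin n} → x Fin.< a → x Fin.< b
        <a⇒<b x<a = ℕ.<-trans x<a a<b

        <b⇒<a : ∀ {x : Fin n} → x ≢ a → x Fin.< b → x Fin.< a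
        <b⇒<a x≢a x<b = ℕ.≤∧≢⇒< (s≤s⁻¹ (subst (_ <_) (toℕ-hi {n} i) x<b)) (x≢a ∘ Fin.toℕ-injective)

        b<⇒a< : ∀ {x : Fin n} → b Fin.< x → a Fin.< x
        b<⇒a< = ℕ.<-trans a<b

        a<⇒b< : ∀ {x : Fin n} → x ≢ b → a Fin.< x → b Fin.< x
        a<⇒b< x≢b a<x = ℕ.≤∧≢⇒< (subst (_≤ _) (sym (toℕ-hi {n} i)) a<x) (x≢b ∘ sym ∘ Fin.toℕ-injective)

        δ-fst : ∀ {x} y → x ≢ b → δ x y ≡ 0
        δ-fst {x} y x≢b rewrite does-no (x Fin.≟ b) x≢b = refl

        δ-snd : ∀ x {y} → y ≢ a → δ x y ≡ 0
        δ-snd x {y} y≢a with does (x Fin.≟ b)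
        ... | false = refl
        ... | true rewrite does-no (y Fin.≟ a) y≢a = refl

        δ≡1 : δ b a ≡ 1
        δ≡1 rewrite does-yes (b Fin.≟ b) refl | does-yes (a Fin.≟ a) refl = refl

        ∑∑δ : sum (λ x → sum λ y → δ x y) ≡ 1
        ∑∑δ = trans (sum-cong row) (sum-δ b 1)
          where
          row : ∀ x → sum (δ x) ≡ (if does (x Fin.≟ b) then 1 else 0)
          row x with does (x Fin.≟ b)
          ... | true  = sum-δ a 1
          ... | false = sum-zero {n} {λ _ → 0} λ _ → refl

        inv : Fin n → Fin n → Fin n → Fin n → ℕ
        inv x y x′ y′ = if does (x Fin.<? y) ∧ does (w ⟨$⟩ʳ y′ Fin.<? w ⟨$⟩ʳ x′) then 1 else 0

        same : ∀ x y x′ y′ → (x′ Fin.< y′ → x Fin.< y) → (x Fin.< y → x′ Fin.< y′) → δ x y ≡ 0 →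
               inv x′ y′ x′ y′ ≡ inv x y x′ y′ + δ x y
        same x y x′ y′ f g δ≡0 rewrite does-⇔ (x′ Fin.<? y′) (x Fin.<? y) f g | δ≡0 = sym (ℕ.+-identityʳ _)

        pointwise : ∀ x y {x′ y′} → View a b x x′ → View a b y y′ → inv x′ y′ x′ y′ ≡ inv x y x′ y′ + δ x y
        pointwise x y (isFst refl) (isFst refl) =
          same a a b b (λ b<b → ⊥-elim (ℕ.<-irrefl refl b<b)) (λ a<a → ⊥-elim (ℕ.<-irrefl refl a<a)) (δ-fst a a≢b)
        pointwise x y (isFst refl) (isSnd refl)
          rewrite does-no (b Fin.<? a) (ℕ.<-asym a<b) | does-yes (a Fin.<? b) a<b
                | does-no (w ⟨$⟩ʳ a Fin.<? w ⟨$⟩ʳ b) (ℕ.<-asym d) | δ-fst b a≢b = refl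
        pointwise x y (isFst refl) (other y≢a y≢b) = same a y b y b<⇒a< (a<⇒b< y≢b) (δ-fst y a≢b)
        pointwise x y (isSnd refl) (isFst refl)
          rewrite does-no (b Fin.<? a) (ℕ.<-asym a<b) | does-yes (a Fin.<? b) a<b
                | does-yes (w ⟨$⟩ʳ b Fin.<? w ⟨$⟩ʳ a) d | δ≡1 = refl
        pointwise x y (isSnd refl) (isSnd refl) =
          same b b a a (λ a<a → ⊥-elim (ℕ.<-irrefl refl a<a)) (λ b<b → ⊥-elim (ℕ.<-irrefl refl b<b)) (δ-snd b (a≢b ∘ sym))
        pointwise x y (isSnd refl) (other y≢a y≢b) = same b y a y (a<⇒b< y≢b) b<⇒a< (δ-snd b y≢a)
        pointwise x y (other x≢a x≢b) (isFst refl) = same x a x b (<b⇒<a x≢a) <a⇒<b (δ-fst a x≢b)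
        pointwise x y (other x≢a x≢b) (isSnd refl) = same x b x a <a⇒<b (<b⇒<a x≢a) (δ-fst b x≢b)
        pointwise x y (other x≢a x≢b) (other y≢a y≢b) = same x y x y (λ r → r) (λ r → r) (δ-fst y x≢b)

      ℓ-descent : ℓ w ≡ suc (ℓ (w · s i))
      ℓ-descent = begin
        ℓ w ≡⟨ sum-permute (λ x → sum λ y → inversion w x y) (s i) ⟩
        sum (λ x → sum λ y → inversion w (s i ⟨$⟩ʳ x) y)
          ≡⟨ sum-cong (λ x → sum-permute (inversion w (s i ⟨$⟩ʳ x)) (s i)) ⟩
        sum (λ x → sum λ y → inversion w (s i ⟨$⟩ʳ x) (s i ⟨$⟩ʳ y))
          ≡⟨ sum-cong (λ x → sum-cong λ y → pointwise x y (view a b x) (view a b y)) ⟩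
        sum (λ x → sum λ y → inversion (w · s i) x y + δ x y)
          ≡⟨ sum-cong (λ x → ∑-distrib-+ (inversion (w · s i) x) (δ x)) ⟩
        sum (λ x → sum (inversion (w · s i) x) + sum (δ x))
          ≡⟨ ∑-distrib-+ (λ x → sum (inversion (w · s i) x)) (λ x → sum (δ x)) ⟩
        ℓ (w · s i) + sum (λ x → sum (δ x)) ≡⟨ cong (ℓ (w · s i) +_) ∑∑δ ⟩
        ℓ (w · s i) + 1 ≡⟨ ℕ.+-comm _ 1 ⟩
        suc (ℓ (w · s i)) ∎
        where open ≡.≡-Reasoning

  adjacent⇒mono : ∀ {n} (f : Fin n → ℕ) → (∀ i → f (lo i) < f (hi i)) → ∀ {i j} → i Fin.< j → f i < f j
  adjacent⇒mono {suc (suc n)} f f< {zero} {suc zero} _ = f< zero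
  adjacent⇒mono {suc (suc n)} f f< {zero} {suc (suc j)} _ =
    ℕ.<-trans (f< zero) (adjacent⇒mono (f ∘ suc) (f< ∘ suc) {zero} {suc j} z<s)
  adjacent⇒mono {suc (suc n)} f f< {suc i} {suc j} (s<s i<j) = adjacent⇒mono (f ∘ suc) (f< ∘ suc) i<j

  mono⇒≥ : ∀ {n} (f : Fin n → ℕ) → (∀ {i j} → i Fin.< j → f i < f j) →
           ∀ c → (∀ i → c ≤ f i) → ∀ i → c + toℕ i ≤ f i
  mono⇒≥ f mono c c≤ zero    = subst (_≤ _) (sym (ℕ.+-identityʳ c)) (c≤ zero)
  mono⇒≥ f mono c c≤ (suc i) = subst (_≤ f (suc i)) (sym (ℕ.+-suc c (toℕ i)))
    (mono⇒≥ (f ∘ suc) (λ i<j → mono (s<s i<j)) (suc c) (λ j → ℕ.≤-trans (s≤s (c≤ zero)) (mono z<s)) i)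

  mono⇒id : ∀ {n} (w : Permutation′ n) → (∀ {i j} → i Fin.< j → w ⟨$⟩ʳ i Fin.< w ⟨$⟩ʳ j) → id ≈ₚ w
  mono⇒id w mono i = Fin.toℕ-injective (ℕ.≤-antisym
    (mono⇒≥ (toℕ ∘ (w ⟨$⟩ʳ_)) mono 0 (λ _ → z≤n) i)
    (subst (toℕ (w ⟨$⟩ʳ i) ≤_) (cong toℕ (inverseˡ w))
      (mono⇒≥ (toℕ ∘ (w ⟨$⟩ˡ_)) mono⁻¹ 0 (λ _ → z≤n) (w ⟨$⟩ʳ i))))
    where
    mono⁻¹ : ∀ {j k} → j Fin.< k → w ⟨$⟩ˡ j Fin.< w ⟨$⟩ˡ k
    mono⁻¹ {j} {k} j<k with Fin.<-cmp (w ⟨$⟩ˡ j) (w ⟨$⟩ˡ k)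
    ... | tri< lt _ _ = lt
    ... | tri≈ _ eq _ = ⊥-elim (ℕ.<-irrefl (cong toℕ (trans (sym (inverseʳ w)) (trans (cong (w ⟨$⟩ʳ_) eq) (inverseʳ w)))) j<k)
    ... | tri> _ _ gt = ⊥-elim (ℕ.<-asym j<k (subst₂ Fin._<_ (inverseʳ w) (inverseʳ w) (mono gt)))

  no-descent⇒ℓ≡0 : ∀ {n} (w : Permutation′ n) → ¬ ∃ (Descent w) → ℓ w ≡ 0
  no-descent⇒ℓ≡0 {n} w ¬d = sum-zero λ i → sum-zero (mono⇒inversion≡0 w (adjacent⇒mono (toℕ ∘ (w ⟨$⟩ʳ_)) ascent) i)
    where
    ascent : ∀ i → w ⟨$⟩ʳ lo i Fin.< w ⟨$⟩ʳ hi i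
    ascent i = ℕ.≤∧≢⇒< (ℕ.≮⇒≥ λ d → ¬d (i , d)) λ eq →
      ℕ.1+n≢n (sym (trans (cong toℕ (⟨$⟩ʳ-injective w (Fin.toℕ-injective eq))) (toℕ-hi {n} i)))

  s-involutive : ∀ {n} (i : Fin (pred n)) → s {n} i · s i ≈ₚ id
  s-involutive {n} i x with s {n} i ⟨$⟩ʳ x | view (lo {n} i) (hi i) x
  ... | _ | isFst refl = lemma (view (lo {n} i) (hi i) (hi i))
    where
    lemma : ∀ {y} → View (lo {n} i) (hi i) (hi i) y → y ≡ lo i
    lemma (isFst eq)  = eq
    lemma (isSnd _)   = refl
    lemma (other _ ne) = contradiction refl ne
  ... | _ | isSnd refl = lemma (view (lo {n} i) (hi i) (lo i))
    where
    lemma : ∀ {y} → View (lo {n} i) (hi i) (lo i) y → y ≡ hi i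
    lemma (isFst _)   = refl
    lemma (isSnd eq)  = eq
    lemma (other ne _) = contradiction refl ne
  ... | _ | other x≢a x≢b = lemma (view (lo {n} i) (hi i) x)
    where
    lemma : ∀ {y} → View (lo {n} i) (hi i) x y → y ≡ x
    lemma (isFst eq)  = contradiction eq x≢a
    lemma (isSnd eq)  = contradiction eq x≢b
    lemma (other _ _) = refl

  evaluate-∷ʳ : ∀ {n} (u : Word n) i → evaluate {n} (u ∷ʳ i) ≈ₚ evaluate u · s i
  evaluate-∷ʳ []      i x = refl
  evaluate-∷ʳ {n} (j ∷ u) i x = cong (s {n} j ⟨$⟩ʳ_) (evaluate-∷ʳ {n} u i x)

  stripDescents-isReduced : ∀ {n} fuel (w : Permutation′ n) → ℓ w ≡ fuel → IsReducedWord w (stripDescents fuel w)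
  stripDescents-isReduced zero w ℓ≡0 = record
    { evaluates = mono⇒id w (ℓ≡0⇒mono w ℓ≡0)
    ; minimal   = sym ℓ≡0
    }
  stripDescents-isReduced {n} (suc fuel) w ℓ≡ with descent? w
  ... | no ¬d = contradiction (trans (sym (no-descent⇒ℓ≡0 w ¬d)) ℓ≡) λ ()
  ... | yes (i , d) = record
    { evaluates = λ x → trans (evaluate-∷ʳ {n} u i x)
                        (trans (IsReducedWord.evaluates rec (s i ⟨$⟩ʳ x)) (cong (w ⟨$⟩ʳ_) (s-involutive i x)))
    ; minimal   = trans (List.length-++ u) (trans (ℕ.+-comm _ 1)
                        (trans (cong suc (IsReducedWord.minimal rec)) (sym (ℓ-descent w i d))))
    }
    where
    u = stripDescents fuel (w · s i)
    rec : IsReducedWord (w · s i) u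
    rec = stripDescents-isReduced fuel (w · s i) (ℕ.suc-injective (trans (sym (ℓ-descent w i d)) ℓ≡))

  reducedWord-isReduced : ∀ {n} (w : Permutation′ n) → IsReducedWord w (reducedWord w)
  reducedWord-isReduced w = stripDescents-isReduced (ℓ w) w refl

  permutationSetoid : ℕ → Setoid 0ℓ 0ℓ
  permutationSetoid n = record
    { Carrier = Permutation′ n
    ; _≈_ = _≈ₚ_
    ; isEquivalence = record
      { refl  = λ _ → refl
      ; sym   = λ u≈v i → sym (u≈v i)
      ; trans = λ u≈v v≈w i → trans (u≈v i) (v≈w i)
      }
    }

  insert-cong : ∀ {n} (j : Fin (suc n)) {u v : Permutation′ n} → u ≈ₚ v → insert zero j u ≈ₚ insert zero j v
  insert-cong j u≈v zero    = refl
  insert-cong j u≈v (suc i) = cong (Fin.punchIn j) (u≈v _)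

  insert-injective : ∀ {n} {j k : Fin (suc n)} {u v : Permutation′ n} →
                     insert zero j u ≈ₚ insert zero k v → j ≡ k × u ≈ₚ v
  insert-injective eq with eq zero
  ... | refl = refl , λ i → Fin.punchIn-injective _ _ _ (eq (suc i))

  permutations-complete : ∀ {n} (w : Permutation′ n) → SetoidMembership._∈_ (permutationSetoid n) w (permutations n)
  permutations-complete {zero}  w = Any.here λ ()
  permutations-complete {suc n} w =
    SetoidMembership.∈-resp-≈ (permutationSetoid (suc n)) {x = insert zero (w ⟨$⟩ʳ zero) (remove zero w)} {y = w} (insert-remove zero w)
      (SetoidMembership.∈-cartesianProductWith⁺ (≡.setoid _) (permutationSetoid n) (permutationSetoid (suc n))
        (λ { {x = j} refl u≈v → insert-cong j u≈v })
        (Membership.∈-allFin (w ⟨$⟩ʳ zero)) (permutations-complete (remove zero w)))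

  permutations-unique : ∀ n → SetoidUnique.Unique (permutationSetoid n) (permutations n)
  permutations-unique zero    = All.[] AllPairs.∷ AllPairs.[]
  permutations-unique (suc n) =
    SetoidUnique.cartesianProductWith⁺ (≡.setoid _) (permutationSetoid n) (permutationSetoid (suc n)) (insert zero)
      insert-injective (Unique.allFin⁺ (suc n)) (permutations-unique n)

data Generator (n : ℕ) : Set where
  T̂ : Fin (pred n) → Generator n
  x̂ : Fin n → Generator n

module Ĥ (n : ℕ) where
  open Presentation 𝒜ħ (Generator n) public using (Term; con; _⊕_; _⊖_; _⊗_; neg)
  open Presentation 𝒜ħ (Generator n) using (gen)

  T : Fin (pred n) → Term
  T i = gen (T̂ i)

  x : Fin n → Term
  x j = gen (x̂ j)

  infix 4 _∼_
  data _∼_ : Rel Term 0ℓ where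
    quadratic : ∀ i → (T i ⊕ con p) ⊗ (T i ⊖ con q) ∼ con 𝒜ħ.0#
    braid     : ∀ i j → toℕ j ≡ suc (toℕ i) → T i ⊗ T j ⊗ T i ∼ T j ⊗ T i ⊗ T j
    T-far     : ∀ i j → suc (toℕ i) < toℕ j → T i ⊗ T j ∼ T j ⊗ T i
    x-comm    : ∀ i j → x i ⊗ x j ∼ x j ⊗ x i
    Tx-far    : ∀ i j → j ≢ lo i → j ≢ hi i → T i ⊗ x j ∼ x j ⊗ T i
    Tx-lo     : ∀ i → T i ⊗ x (lo i) ∼ x (hi i) ⊗ T i ⊕ (con ħ ⊖ con (p 𝒜ħ.- q) ⊗ x (lo i))
    Tx-hi     : ∀ i → T i ⊗ x (hi i) ∼ x (lo i) ⊗ T i ⊖ (con ħ ⊖ con (p 𝒜ħ.- q) ⊗ x (lo i))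

  open Presentation.Quotient 𝒜ħ (Generator n) _∼_ public using (ring)

  T̅ : Fin (pred n) → Term
  T̅ i = T i ⊕ con (p 𝒜ħ.- q)

  T[_] : Permutation′ n → Term
  T[ w ] = foldr (λ i h → T i ⊗ h) (con 𝒜ħ.1#) (reducedWord w)

  T̅[_] : Permutation′ n → Term
  T̅[ w ] = foldr (λ i h → T̅ i ⊗ h) (con 𝒜ħ.1#) (reducedWord w)

  ∑ : ∀ {a} {A : Set a} → List A → (A → Term) → Term
  ∑ as f = foldr (λ a h → f a ⊕ h) (con 𝒜ħ.0#) as

-- Classically a Heyting field is an ordinary field with x # y ⇔ x ≠ y;
-- constructively every discrete field is one. x ≠ 0 is rendered as x # 0#.
module Field {c ℓ₁ ℓ₂ : Level} (F : HeytingField c ℓ₁ ℓ₂) where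
  open HeytingField F public
  open HeytingCommutativeRing heytingCommutativeRing public using (commutativeRing)

  Unit : Carrier → Set (c ⊔ ℓ₁)
  Unit = Invertible _≈_ 1# _*_

  infix 9 1/_
  1/_ : ∀ {a} → Unit a → Carrier
  1/_ = proj₁

  #0⇒unit : ∀ {a} → a # 0# → Unit a
  #0⇒unit {a} a#0 with b , ba≈1 , ab≈1 ← #⇒invertible a#0 =
    b , ≈.trans (*-congˡ (≈.sym a-0≈a)) ba≈1 , ≈.trans (*-congʳ (≈.sym a-0≈a)) ab≈1
    where
    module ≈ = Setoid (CommutativeRing.setoid commutativeRing)
    a-0≈a : (a - 0#) ≈ a
    a-0≈a = ≈.trans (+-congˡ (RingProperties.-0#≈0# (CommutativeRing.ring commutativeRing))) (+-identityʳ a)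

module LinearCombination {c ℓ m ℓm : Level} {K : CommutativeRing c ℓ} (M : Module K m ℓm) where
  private module K = CommutativeRing K
  open Module M

  ∑ᴹ : ∀ {a} {A : Set a} → List A → (A → Carrierᴹ) → Carrierᴹ
  ∑ᴹ as f = foldr (λ a v → f a +ᴹ v) 0ᴹ as

  -- Bases indexed by S_n; since permutations are compared by _≈ₚ_,
  -- coefficient families have to respect it.
  record IsBasis {n : ℕ} (y : Permutation′ n → Carrierᴹ) : Set (c ⊔ ℓ ⊔ m ⊔ ℓm) where
    field
      spanning    : ∀ v → ∃ λ (a : Permutation′ n → K.Carrier) →
                    v ≈ᴹ ∑ᴹ (permutations n) λ w → a w *ₗ y w
      independent : ∀ (a : Permutation′ n → K.Carrier) → (∀ {u w} → u ≈ₚ w → a u K.≈ a w) →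
                    ∑ᴹ (permutations n) (λ w → a w *ₗ y w) ≈ᴹ 0ᴹ → ∀ w → a w K.≈ K.0#

record SchubertRepresentation (n : ℕ) (c ℓ₁ ℓ₂ m ℓm : Level) : Set (lsuc (c ⊔ ℓ₁ ⊔ ℓ₂ ⊔ m ⊔ ℓm)) where
  open Ĥ n using (Term; con; x; T[_]; ring)

  field
    𝔽 : HeytingField c ℓ₁ ℓ₂

  module 𝔽 = Field 𝔽

  field
    t : Fin n → 𝔽.Carrier
    φ : 𝒜ħ.Carrier → 𝔽.Carrier
    φ-isRingHomomorphism : IsRingHomomorphism 𝒜ħ.rawRing (CommutativeRing.rawRing 𝔽.commutativeRing) φ
    𝕍 : Module 𝔽.commutativeRing m ℓm

  open Module 𝕍 public using (Carrierᴹ; _≈ᴹ_; _+ᴹ_; 0ᴹ; -ᴹ_; _*ₗ_)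
  open LinearCombination 𝕍 public

  infixr 7 _▷_
  field
    _▷_            : Term → Carrierᴹ → Carrierᴹ
    ▷-isLeftModule : IsLeftModule ring _≈ᴹ_ _+ᴹ_ 0ᴹ -ᴹ_ _▷_
    ▷-scalar       : ∀ a v → con a ▷ v ≈ᴹ φ a *ₗ v
    ▷-linear       : ∀ h a v → h ▷ (a *ₗ v) ≈ᴹ a *ₗ (h ▷ v)
    𝒴              : Permutation′ n → Carrierᴹ
    𝒴-T            : ∀ w → 𝒴 w ≈ᴹ T[ w ⁻¹ · w₀ ] ▷ 𝒴 w₀
    𝒴-isBasis      : IsBasis 𝒴
    ev             : Carrierᴹ → 𝔽.Carrier
    ev-linear      : ModuleMorphism.IsModuleHomomorphism (Module.rawModule 𝕍) (Module.rawModule (TensorUnit.⟨module⟩ {R = 𝔽.commutativeRing})) ev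
    ev-nonzero     : ∀ w → (ev (𝒴 w) 𝔽.# 𝔽.0#) ⇔ (w ≈ₚ id)
    ev-x           : ∀ i w → ev (x i ▷ 𝒴 w) 𝔽.≈ t i 𝔽.* ev (𝒴 w)

  ev𝒴id-unit : 𝔽.Unit (ev (𝒴 id))
  ev𝒴id-unit = 𝔽.#0⇒unit (Equivalence.from (ev-nonzero id) (λ _ → refl))

-- Weakly decreasing sequences of length k with entries in {0,…,m}.
data Partition : ℕ → ℕ → Set where
  []  : ∀ {m} → Partition 0 m
  _∷_ : ∀ {k m} (a : Fin (suc m)) → Partition k (toℕ a) → Partition (suc k) m

part : ∀ {k m} → Partition k m → Fin k → ℕ
part (a ∷ κ) zero    = toℕ a
part (a ∷ κ) (suc i) = part κ i

-- All partitions λ ⊆ mᵏ, each once, see partitions-complete and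
-- partitions-unique.
partitions : ∀ k m → List (Partition k m)
partitions zero    m = [] ∷ []
partitions (suc k) m = concatMap (λ a → map (a ∷_) (partitions k (toℕ a))) (allFin (suc m))

#parts≤ : ∀ {k m} → ℕ → Partition k m → ℕ
#parts≤ r []      = 0
#parts≤ r (a ∷ κ) with toℕ a ℕ.≤? r
... | yes _ = suc (#parts≤ r κ)
... | no _  = #parts≤ r κ

module PartitionFacts where
  part≤ : ∀ {k m} (κ : Partition k m) i → part κ i ≤ m
  part≤ (a ∷ κ) zero    = s≤s⁻¹ (Fin.toℕ<n a)
  part≤ (a ∷ κ) (suc i) = ℕ.≤-trans (part≤ κ i) (s≤s⁻¹ (Fin.toℕ<n a))

  part-antitone : ∀ {k m} (κ : Partition k m) {i j} → i Fin.≤ j → part κ j ≤ part κ i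
  part-antitone (a ∷ κ) {zero}  {zero}  _         = ℕ.≤-refl
  part-antitone (a ∷ κ) {zero}  {suc j} _         = part≤ κ j
  part-antitone (a ∷ κ) {suc i} {suc j} (s≤s i≤j) = part-antitone κ i≤j

  #parts≤-bound : ∀ {k m} r (κ : Partition k m) → #parts≤ r κ ≤ k
  #parts≤-bound r [] = z≤n
  #parts≤-bound r (a ∷ κ) with toℕ a ℕ.≤? r
  ... | yes _ = s≤s (#parts≤-bound r κ)
  ... | no _  = ℕ.m≤n⇒m≤1+n (#parts≤-bound r κ)

  #parts≤-mono : ∀ {k m} {r r′} → r ≤ r′ → (κ : Partition k m) → #parts≤ r κ ≤ #parts≤ r′ κ
  #parts≤-mono r≤r′ [] = z≤n
  #parts≤-mono {r = r} {r′} r≤r′ (a ∷ κ) with toℕ a ℕ.≤? r | toℕ a ℕ.≤? r′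
  ... | yes _   | yes _    = s≤s (#parts≤-mono r≤r′ κ)
  ... | yes a≤r | no  a≰r′ = contradiction (ℕ.≤-trans a≤r r≤r′) a≰r′
  ... | no _    | yes _    = ℕ.m≤n⇒m≤1+n (#parts≤-mono r≤r′ κ)
  ... | no _    | no _     = #parts≤-mono r≤r′ κ

  #parts≤-all : ∀ {k m} {r} → m ≤ r → (κ : Partition k m) → #parts≤ r κ ≡ k
  #parts≤-all m≤r [] = refl
  #parts≤-all {r = r} m≤r (a ∷ κ) with toℕ a ℕ.≤? r
  ... | yes a≤r = cong suc (#parts≤-all a≤r κ)
  ... | no  a≰r = contradiction (ℕ.≤-trans (s≤s⁻¹ (Fin.toℕ<n a)) m≤r) a≰r

  small-part : ∀ {k m} r (κ : Partition k m) i → part κ i ≤ r → k ≤ toℕ i + #parts≤ r κ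
  small-part r (a ∷ κ) zero a≤r with toℕ a ℕ.≤? r
  ... | yes _  = s≤s (ℕ.≤-reflexive (sym (#parts≤-all a≤r κ)))
  ... | no a≰r = contradiction a≤r a≰r
  small-part r (a ∷ κ) (suc i) κi≤r with toℕ a ℕ.≤? r
  ... | yes _ = s≤s (ℕ.≤-trans (small-part r κ i κi≤r) (ℕ.+-monoʳ-≤ (toℕ i) (ℕ.n≤1+n _)))
  ... | no _  = s≤s (small-part r κ i κi≤r)

  large-part : ∀ {k m} r (κ : Partition k m) i → r < part κ i → toℕ i + #parts≤ r κ < k
  large-part r (a ∷ κ) zero r<a with toℕ a ℕ.≤? r
  ... | yes a≤r = contradiction a≤r (ℕ.<⇒≱ r<a)
  ... | no _    = s≤s (#parts≤-bound r κ)
  large-part r (a ∷ κ) (suc i) r<κi with toℕ a ℕ.≤? r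
  ... | yes a≤r = contradiction (ℕ.≤-trans (part≤ κ i) a≤r) (ℕ.<⇒≱ r<κi)
  ... | no _    = s≤s (large-part r κ i r<κi)

  partitions-complete : ∀ {k m} (κ : Partition k m) → κ Membership.∈ partitions k m
  partitions-complete []      = Any.here refl
  partitions-complete (a ∷ κ) = Membership.∈-concatMap⁺ (λ a → map (a ∷_) (partitions _ (toℕ a)))
    (Any.map (λ { refl → Membership.∈-map⁺ (a ∷_) (partitions-complete κ) }) (Membership.∈-allFin a))

  partitions-unique : ∀ k m → Unique.Unique (partitions k m)
  partitions-unique zero    m = All.[] AllPairs.∷ AllPairs.[]
  partitions-unique (suc k) m = Unique.concat⁺
    (All.map⁺ (All.universal (λ a → Unique.map⁺ ∷-injective (partitions-unique k (toℕ a))) (allFin (suc m))))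
    (AllPairs.map⁺ (AllPairs.map disjoint (Unique.allFin⁺ (suc m))))
    where
    ∷-injective : ∀ {a : Fin (suc m)} {κ κ′ : Partition k (toℕ a)} → _≡_ {A = Partition (suc k) m} (a ∷ κ) (a ∷ κ′) → κ ≡ κ′
    ∷-injective refl = refl
    disjoint : ∀ {a b} → a ≢ b → Disjoint (map {B = Partition (suc k) m} (a ∷_) (partitions k (toℕ a))) (map (b ∷_) (partitions k (toℕ b)))
    disjoint a≢b (κ∈a , κ∈b) with Membership.∈-map⁻ _ κ∈a | Membership.∈-map⁻ _ κ∈b
    ... | _ , _ , refl | _ , _ , refl = a≢b refl

injection⇒permutation : ∀ {n} (f : Fin n → Fin n) → Injective _≡_ _≡_ f → Permutation′ n
injection⇒permutation {zero}  f f-inj = id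
injection⇒permutation {suc n} f f-inj = permutation f (proj₁ ∘ preimage) (proj₂ ∘ preimage) (λ i → f-inj (proj₂ (preimage (f i))))
  where
  preimage : ∀ j → ∃ λ i → f i ≡ j
  preimage j with Fin.any? (λ i → f i Fin.≟ j)
  ... | yes i = i
  ... | no ∄i = contradiction
    (Fin.injective⇒≤ {f = λ i → punchOut {i = j} {f i} (λ j≡fi → ∄i (i , sym j≡fi))}
      (λ eq → f-inj (Fin.punchOut-injective {i = j} (λ j≡fi → ∄i (_ , sym j≡fi)) (λ j≡fi → ∄i (_ , sym j≡fi)) eq)))
    ℕ.1+n≰n

-- The values of w_λ on the first k positions are λᵢ + k + 1 - i. The remaining
-- values in increasing order are r + #{i : λᵢ < r} for 1 ≤ r ≤ m, because
-- exactly the values λᵢ + k + 1 - i with λᵢ < r lie below the r-th of them.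
-- Positions, values and r are counted from 0 here. See
-- grassmannian-isGrassmannian.
module Grassmannian {k m : ℕ} (κ : Partition k m) where
  open PartitionFacts

  fst : Fin k → ℕ
  fst j = part κ (opposite j) + toℕ j

  snd : Fin m → ℕ
  snd r = toℕ r + #parts≤ (toℕ r) κ

  fst< : ∀ j → fst j < k + m
  fst< j = subst (fst j <_) (ℕ.+-comm m k) (ℕ.+-mono-≤-< (part≤ κ (opposite j)) (Fin.toℕ<n j))

  snd< : ∀ r → snd r < k + m
  snd< r = subst (snd r <_) (ℕ.+-comm m k) (ℕ.+-mono-<-≤ (Fin.toℕ<n r) (#parts≤-bound (toℕ r) κ))

  value : Fin k ⊎ Fin m → Fin (k + m)
  value (inj₁ j) = fromℕ< (fst< j)
  value (inj₂ r) = fromℕ< (snd< r)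

  fst-mono : ∀ {i j} → i Fin.< j → fst i < fst j
  fst-mono {i} {j} i<j = ℕ.+-mono-≤-< (part-antitone κ (opposite-antitone (ℕ.<⇒≤ i<j))) i<j
    where
    opposite-antitone : i Fin.≤ j → opposite j Fin.≤ opposite i
    opposite-antitone i≤j = subst₂ _≤_ (sym (Fin.opposite-prop j)) (sym (Fin.opposite-prop i)) (ℕ.∸-monoʳ-≤ k (s≤s i≤j))

  snd-mono : ∀ {r r′} → r Fin.< r′ → snd r < snd r′
  snd-mono r<r′ = ℕ.+-mono-<-≤ r<r′ (#parts≤-mono (ℕ.<⇒≤ r<r′) κ)

  opposite+suc : ∀ j → toℕ (opposite j) + suc (toℕ j) ≡ k
  opposite+suc j = trans (cong (_+ suc (toℕ j)) (Fin.opposite-prop j)) (ℕ.m∸n+n≡m (Fin.toℕ<n j))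

  fst≢snd : ∀ j r → fst j ≢ snd r
  fst≢snd j r eq with part κ (opposite j) ℕ.≤? toℕ r
  ... | yes κj≤r = ℕ.<-irrefl eq (ℕ.+-mono-≤-< κj≤r
    (ℕ.+-cancelˡ-≤ (toℕ (opposite j)) _ _ (subst (_≤ toℕ (opposite j) + #parts≤ (toℕ r) κ) (sym (opposite+suc j)) (small-part (toℕ r) κ (opposite j) κj≤r))))
  ... | no κj≰r = ℕ.<-irrefl (sym eq) (ℕ.+-mono-<-≤ (ℕ.≰⇒> κj≰r)
    (s≤s⁻¹ (ℕ.+-cancelˡ-≤ (toℕ (opposite j)) _ _
      (subst₂ _≤_ (sym (ℕ.+-suc _ _)) (sym (opposite+suc j)) (large-part (toℕ r) κ (opposite j) (ℕ.≰⇒> κj≰r))))))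

  mono⇒injective : ∀ {n} (f : Fin n → ℕ) → (∀ {i j} → i Fin.< j → f i < f j) → ∀ {i j} → f i ≡ f j → i ≡ j
  mono⇒injective f mono {i} {j} eq with Fin.<-cmp i j
  ... | tri< i<j _ _ = contradiction (mono i<j) (ℕ.<-irrefl eq)
  ... | tri≈ _ i≡j _ = i≡j
  ... | tri> _ _ j<i = contradiction (mono j<i) (ℕ.<-irrefl (sym eq))

  value-injective : ∀ {x y} → value x ≡ value y → x ≡ y
  value-injective {inj₁ i} {inj₁ j} eq = cong inj₁ (mono⇒injective fst fst-mono (Fin.fromℕ<-injective _ _ (fst< i) (fst< j) eq))
  value-injective {inj₁ i} {inj₂ r} eq = contradiction (Fin.fromℕ<-injective _ _ (fst< i) (snd< r) eq) (fst≢snd i r)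
  value-injective {inj₂ r} {inj₁ i} eq = contradiction (sym (Fin.fromℕ<-injective _ _ (snd< r) (fst< i) eq)) (fst≢snd i r)
  value-injective {inj₂ r} {inj₂ t} eq = cong inj₂ (mono⇒injective snd snd-mono (Fin.fromℕ<-injective _ _ (snd< r) (snd< t) eq))

  splitAt-injective : ∀ {x y} → splitAt k {m} x ≡ splitAt k y → x ≡ y
  splitAt-injective {x} {y} eq =
    trans (sym (Fin.join-splitAt k m x)) (trans (cong (Fin.join k m) eq) (Fin.join-splitAt k m y))

  function : Fin (k + m) → Fin (k + m)
  function = value ∘ splitAt k

  function-injective : Injective _≡_ _≡_ function
  function-injective = splitAt-injective ∘ value-injective

grassmannian : ∀ {k m} → Partition k m → Permutation′ (k + m)
grassmannian κ = injection⇒permutation (Grassmannian.function κ) (Grassmannian.function-injective κ)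

record IsGrassmannian {k m : ℕ} (κ : Partition k m) (w : Permutation′ (k + m)) : Set where
  field
    on-first      : ∀ i → toℕ (w ⟨$⟩ʳ (opposite i ↑ˡ m)) ≡ part κ i + toℕ (opposite i)
    increasing-on-last : ∀ {r t} → r Fin.< t → w ⟨$⟩ʳ (k ↑ʳ r) Fin.< w ⟨$⟩ʳ (k ↑ʳ t)

grassmannian-isGrassmannian : ∀ {k m} (κ : Partition k m) → IsGrassmannian κ (grassmannian κ)
grassmannian-isGrassmannian {k} {m} κ = record
  { on-first = λ i → trans (apply (opposite i ↑ˡ m)) (trans (cong (toℕ ∘ value) (Fin.splitAt-↑ˡ k (opposite i) m))
      (trans (Fin.toℕ-fromℕ< (fst< (opposite i))) (cong (λ j → part κ j + toℕ (opposite i)) (Fin.opposite-involutive i))))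
  ; increasing-on-last = λ {r} {t} r<t → subst₂ _<_ (sym (last r)) (sym (last t)) (snd-mono r<t)
  }
  where
  open Grassmannian κ
  apply : ∀ x → toℕ (grassmannian κ ⟨$⟩ʳ x) ≡ toℕ (function x)
  apply x = cong toℕ (injection⇒permutation-apply function function-injective x)
    where
    injection⇒permutation-apply : ∀ {n} (f : Fin n → Fin n) (f-inj : Injective _≡_ _≡_ f) x → injection⇒permutation f f-inj ⟨$⟩ʳ x ≡ f x
    injection⇒permutation-apply {suc n} f f-inj x = refl
  last : ∀ r → toℕ (grassmannian κ ⟨$⟩ʳ (k ↑ʳ r)) ≡ snd r
  last r = trans (apply (k ↑ʳ r)) (trans (cong (toℕ ∘ value) (Fin.splitAt-↑ʳ k m r)) (Fin.toℕ-fromℕ< (snd< r)))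

-- [k]![n-k]! Σⁿ_k ∈ Ĥ_n
Σ-numerator : ∀ k m → Ĥ.Term (k + m)
Σ-numerator k m = ∑ (youngSubgroup k m) λ v → con (q 𝒜ħ.^ (d ∸ ℓ v)) ⊗ T̅[ v ]
  where
  open Ĥ (k + m)
  d = k C 2 + m C 2

module ParabolicSchubert
  (k m : ℕ) {c ℓ₁ ℓ₂ v ℓv : Level} (V : SchubertRepresentation (k + m) c ℓ₁ ℓ₂ v ℓv)
  ([k]![m]!-unit : SchubertRepresentation.𝔽.Unit V (SchubertRepresentation.φ V ([ k ]! 𝒜ħ.* [ m ]!)))
  where
  open SchubertRepresentation V
  open Ĥ (k + m) using (T̅[_])

  -- Since 1/([k]![n-k]!) only exists in 𝔽, Σⁿ_k and T̅_λ are elements of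
  -- 𝔽 ⊗ Ĥ_n; they are given by their action on 𝕍.
  Σ▷_ : Carrierᴹ → Carrierᴹ
  Σ▷ f = 𝔽.1/ [k]![m]!-unit *ₗ (Σ-numerator k m ▷ f)

  T̅ₚ[_]▷_ : Partition k m → Carrierᴹ → Carrierᴹ
  T̅ₚ[ κ ]▷ f = T̅[ grassmannian κ ] ▷ (Σ▷ f)

  𝒴ₚ : Partition k m → Carrierᴹ
  𝒴ₚ κ = ∑ᴹ (youngSubgroup k m) λ u → φ (p 𝒜ħ.^ ℓ u) *ₗ 𝒴 (grassmannian κ · u)

  InSpan : Carrierᴹ → Set (c ⊔ ℓv)
  InSpan f = ∃ λ (a : Partition k m → 𝔽.Carrier) → f ≈ᴹ ∑ᴹ (partitions k m) λ κ → a κ *ₗ 𝒴ₚ κ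

{-# OPTIONS --safe #-}
module Submission where

-- If i is a descent of w, then Tᵢ 𝒴_w = 𝒴_{wsᵢ}, because w⁻¹w₀ gets longer when
-- multiplied by sᵢ on the left; since T̅ᵢ Tᵢ = pq, the operator T̅ᵢ is then known on
-- the whole basis. In particular ev ∘ T̅_u sends 𝒴_w to δ_{u,w} ev(𝒴_id): composing
-- the functional dual to 𝒴_x with T̅ᵢ, where i is an ascent of x, gives the one dual
-- to 𝒴_{xsᵢ}.
--
-- The vector 𝒴_λ is a p-eigenvector of T̅ᵢ for i ≠ k, hence T̅_v 𝒴_λ = p^ℓ(v) 𝒴_λ
-- for v ∈ S_k × S_{n-k}, and Σⁿ_k 𝒴_λ = 𝒴_λ by the Poincaré polynomial
-- ∑_v q^(d-ℓ(v)) p^ℓ(v) = [k]![n-k]!. So ev(T̅_μ 𝒴_ν) is the sum of the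
-- p^ℓ(v) ev(𝒴_id) over all v with w_ν v = w_μ, which forces μ = ν and v = id.

open import Defs
open import Algebra.Bundles using (CommutativeMonoid; CommutativeRing; Monoid; Ring)
open import Algebra.Module.Bundles using (Module)
open import Algebra.Module.Structures using (IsLeftModule)
open import Algebra.Morphism.Structures using (IsRingHomomorphism)
open import Data.Bool.Base using (true; false; if_then_else_; _∧_)
open import Data.Bool.Properties using (∧-comm)
open import Data.Fin.Base using (Fin; zero; suc; toℕ; opposite; _↑ˡ_; _↑ʳ_; splitAt; punchIn)
open import Data.Fin.Permutation using (Permutation′; _⟨$⟩ʳ_; _⟨$⟩ˡ_; id; insert; remove; insert-remove; inverseˡ; inverseʳ) renaming (_≈_ to _≈ₚ_)
open import Data.List.Base using (List; []; _∷_; _∷ʳ_; _++_; foldr; map; cartesianProductWith; allFin; tabulate)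
open import Data.Nat.Base using (ℕ; zero; suc; pred; _+_; _∸_; _≤_; _<_; z≤n; s≤s; s≤s⁻¹)
open import Data.Nat.Combinatorics using (_C_; nC1≡n; nCk+nC[k+1]≡[n+1]C[k+1])
open import Data.Product.Base using (∃; _×_; _,_; proj₁; proj₂)
open import Data.Sum.Base using (_⊎_; inj₁; inj₂)
open import Function.Base using (_∘_)
open import Function.Bundles using (module Equivalence)
open import Level using (Level)
open import Relation.Binary.Bundles using (Setoid)
open import Relation.Binary.Definitions using (Decidable; tri<; tri≈; tri>)
open import Relation.Binary.PropositionalEquality.Core using (_≡_; _≢_; refl; sym; trans; cong; cong₂; subst; subst₂)
open import Relation.Nullary.Decidable.Core using (Dec; yes; no; does)
open import Relation.Nullary.Negation.Core using (¬_; contradiction)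

import Algebra.Module.Morphism.Structures as ModuleMorphism
import Algebra.Properties.AbelianGroup as AbelianGroupProperties
import Algebra.Properties.CommutativeMonoid.Sum as MonoidSum
import Algebra.Properties.CommutativeSemigroup as CommutativeSemigroupProperties
import Algebra.Properties.Group as GroupProperties
import Algebra.Properties.Ring as RingProperties
import Algebra.Properties.Semiring.Exp as Exp
import Data.Fin.Base as Fin
import Data.Fin.Properties as Fin
import Data.List.Membership.Setoid as SetoidMembership
import Data.List.Properties as List
import Data.List.Relation.Unary.All as All
import Data.List.Relation.Unary.AllPairs as AllPairs
import Data.List.Relation.Unary.Any as Any
import Data.List.Relation.Unary.Unique.Setoid as SetoidUnique
import Data.Nat.Properties as ℕ
import Relation.Binary.PropositionalEquality.Properties as ≡
import Relation.Binary.Reasoning.Setoid as SetoidReasoning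

-- Lengths, ascents and descents

open SymmetricGroupFacts
open MonoidSum ℕ.+-0-commutativeMonoid using (sum; sum-permute; ∑-comm)

-- `T[_]` and `T̅[_]` are products along one particular reduced word, and permutations are compared
-- only pointwise, by `_≈ₚ_`. Tᵢ 𝒴_w = 𝒴_{wsᵢ} must hold at every descent i of w, and Tᵢ multiplies
-- from the left while `reducedWord` is built from the right. So T_w has to be freed from its word;
-- this is Matsumoto's theorem, and the place where the braid relations enter. For T̅_w, inductions
-- on length work with any descent, hence with whichever one the word ends in: the last factor T̅ᵢ
-- meets the vector first, which is why a functional ev ∘ h is extended to ev ∘ (h T̅ᵢ).
--
-- The weights p^ℓ(v) in 𝒴_λ come from a computation with two vectors: if i is an ascent of w, then
-- T̅ᵢ sends 𝒴_w to pq 𝒴_{wsᵢ} and 𝒴_{wsᵢ} to 𝒴_w + (p-q) 𝒴_{wsᵢ}, so 𝒴_w + p 𝒴_{wsᵢ} is an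
-- eigenvector for p. For i ≠ k the vector 𝒴_λ is a combination of such pairs.

≈ₚ-sym : ∀ {n} {u w : Permutation′ n} → u ≈ₚ w → w ≈ₚ u
≈ₚ-sym u≈w x = sym (u≈w x)

≈ₚ-trans : ∀ {n} {u v w : Permutation′ n} → u ≈ₚ v → v ≈ₚ w → u ≈ₚ w
≈ₚ-trans u≈v v≈w x = trans (u≈v x) (v≈w x)

·-cancelˡ : ∀ {n} (w : Permutation′ n) {u v} → w · u ≈ₚ w · v → u ≈ₚ v
·-cancelˡ w wu≈wv x = ⟨$⟩ʳ-injective w (wu≈wv x)

ℓ-cong : ∀ {n} {u w : Permutation′ n} → u ≈ₚ w → ℓ u ≡ ℓ w
ℓ-cong {u = u} {w} u≈w = sum-cong λ i → sum-cong λ j → cong (λ b → if does (i Fin.<? j) ∧ b then 1 else 0)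
  (cong₂ (λ a b → does (a Fin.<? b)) (u≈w j) (u≈w i))

-- A pair of positions (i, j) is an inversion of w exactly when (w(j), w(i)) is one of w⁻¹; both
-- sums are reindexed by w⁻¹ and then exchanged.
ℓ-⁻¹ : ∀ {n} (w : Permutation′ n) → ℓ (w ⁻¹) ≡ ℓ w
ℓ-⁻¹ w = sym (begin
  ℓ w ≡⟨ sum-permute (λ x → sum λ y → inversion w x y) (w ⁻¹) ⟩
  sum (λ a → sum λ y → inversion w (w ⟨$⟩ˡ a) y)
    ≡⟨ sum-cong (λ a → sum-permute (inversion w (w ⟨$⟩ˡ a)) (w ⁻¹)) ⟩
  sum (λ a → sum λ b → inversion w (w ⟨$⟩ˡ a) (w ⟨$⟩ˡ b))
    ≡⟨ sum-cong (λ a → sum-cong λ b → pointwise a b) ⟩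
  sum (λ a → sum λ b → inversion (w ⁻¹) b a)
    ≡⟨ ∑-comm (λ a b → inversion (w ⁻¹) b a) ⟩
  ℓ (w ⁻¹) ∎)
  where
  open ≡.≡-Reasoning
  pointwise : ∀ a b → inversion w (w ⟨$⟩ˡ a) (w ⟨$⟩ˡ b) ≡ inversion (w ⁻¹) b a
  pointwise a b = cong (λ c → if c then 1 else 0) (trans (∧-comm (does (w ⟨$⟩ˡ a Fin.<? w ⟨$⟩ˡ b)) _)
    (cong (_∧ does (w ⟨$⟩ˡ a Fin.<? w ⟨$⟩ˡ b)) (cong₂ (λ c d → does (c Fin.<? d)) (inverseʳ w) (inverseʳ w))))

toℕ-lo : ∀ {n} (i : Fin (pred n)) → toℕ (lo {n} i) ≡ toℕ i
toℕ-lo {suc n} i = Fin.toℕ-inject₁ i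

toℕ-hi′ : ∀ {n} (i : Fin (pred n)) → toℕ (hi {n} i) ≡ suc (toℕ i)
toℕ-hi′ {suc n} i = refl

adjacent⇒lo-hi : ∀ {n} (a b : Fin n) → toℕ b ≡ suc (toℕ a) → ∃ λ i → lo i ≡ a × hi i ≡ b
adjacent⇒lo-hi {suc n} a (suc i) eq = i , Fin.toℕ-injective (trans (Fin.toℕ-inject₁ i) (ℕ.suc-injective eq)) , refl

module _ {n : ℕ} (i : Fin (pred n)) where

  s-lo : s {n} i ⟨$⟩ʳ lo i ≡ hi i
  s-lo = lemma (view (lo {n} i) (hi i) (lo i))
    where
    lemma : ∀ {y} → View (lo {n} i) (hi i) (lo i) y → y ≡ hi i
    lemma (isFst _)    = refl
    lemma (isSnd eq)   = eq
    lemma (other ne _) = contradiction refl ne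

  s-hi : s {n} i ⟨$⟩ʳ hi i ≡ lo i
  s-hi = trans (cong (s {n} i ⟨$⟩ʳ_) (sym s-lo)) (s-involutive {n} i (lo i))

  s-fix : ∀ {x} → x ≢ lo i → x ≢ hi i → s {n} i ⟨$⟩ʳ x ≡ x
  s-fix {x} x≢lo x≢hi = lemma (view (lo {n} i) (hi i) x)
    where
    lemma : ∀ {y} → View (lo {n} i) (hi i) x y → y ≡ x
    lemma (isFst eq)  = contradiction eq x≢lo
    lemma (isSnd eq)  = contradiction eq x≢hi
    lemma (other _ _) = refl

  s⁻¹ : ∀ x → s {n} i ⟨$⟩ˡ x ≡ s {n} i ⟨$⟩ʳ x
  s⁻¹ x = trans (cong (s {n} i ⟨$⟩ˡ_) (sym (s-involutive {n} i x))) (inverseˡ (s {n} i))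

  ·s·s : ∀ (w : Permutation′ n) → (w · s i) · s i ≈ₚ w
  ·s·s w x = cong (w ⟨$⟩ʳ_) (s-involutive {n} i x)

  ·s-transpose : ∀ {u w : Permutation′ n} → u · s i ≈ₚ w → u ≈ₚ w · s i
  ·s-transpose {u} {w} us≈w x = trans (sym (·s·s u x)) (us≈w (s {n} i ⟨$⟩ʳ x))

Ascent : ∀ {n} → Permutation′ n → Fin (pred n) → Set
Ascent w i = w ⟨$⟩ʳ lo i Fin.< w ⟨$⟩ʳ hi i

module _ {n : ℕ} (w : Permutation′ n) (i : Fin (pred n)) where

  ascent-or-descent : Ascent w i ⊎ Descent w i
  ascent-or-descent with Fin.<-cmp (w ⟨$⟩ʳ lo i) (w ⟨$⟩ʳ hi i)
  ... | tri< a _ _ = inj₁ a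
  ... | tri≈ _ eq _ = contradiction (trans (sym (toℕ-hi {n} i)) (cong toℕ (sym (⟨$⟩ʳ-injective w eq)))) ℕ.1+n≢n
  ... | tri> _ _ d = inj₂ d

  ascent⇒descent-·s : Ascent w i → Descent (w · s i) i
  ascent⇒descent-·s = subst₂ (λ a b → w ⟨$⟩ʳ a Fin.< w ⟨$⟩ʳ b) (sym (s-hi {n} i)) (sym (s-lo {n} i))

  descent⇒ascent-·s : Descent w i → Ascent (w · s i) i
  descent⇒ascent-·s = subst₂ (λ a b → w ⟨$⟩ʳ a Fin.< w ⟨$⟩ʳ b) (sym (s-lo {n} i)) (sym (s-hi {n} i))

  ℓ-ascent : Ascent w i → ℓ (w · s i) ≡ suc (ℓ w)
  ℓ-ascent a = trans (ℓ-descent (w · s i) i (ascent⇒descent-·s a)) (cong suc (ℓ-cong {u = (w · s i) · s i} {w} (·s·s {n} i w)))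

  ℓ-·s≤ : ℓ (w · s i) ≤ suc (ℓ w)
  ℓ-·s≤ with ascent-or-descent
  ... | inj₁ a = ℕ.≤-reflexive (ℓ-ascent a)
  ... | inj₂ d = subst (ℓ (w · s i) ≤_) (cong suc (sym (ℓ-descent w i d))) (ℕ.m≤n+m _ 2)

  -- Descents govern multiplication on the right; passing to inverses makes them available on the
  -- left.
  ℓ-s· : ℓ (s i · w) ≡ ℓ (w ⁻¹ · s i)
  ℓ-s· = trans (sym (ℓ-⁻¹ (s i · w))) (ℓ-cong {u = (s i · w) ⁻¹} {w ⁻¹ · s i} λ x → cong (w ⟨$⟩ˡ_) (s⁻¹ {n} i x))

ℓ-s·≤ : ∀ {n} (w : Permutation′ n) i → ℓ (s i · w) ≤ suc (ℓ w)
ℓ-s·≤ w i = subst₂ (λ a b → a ≤ suc b) (sym (ℓ-s· w i)) (ℓ-⁻¹ w) (ℓ-·s≤ (w ⁻¹) i)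

Descent-resp-≈ : ∀ {n} {u w : Permutation′ n} {i} → u ≈ₚ w → Descent u i → Descent w i
Descent-resp-≈ u≈w = subst₂ Fin._<_ (u≈w _) (u≈w _)

descent∧ascent⇒≉ : ∀ {n} {u w : Permutation′ n} {i} → Descent u i → Ascent w i → ¬ u ≈ₚ w
descent∧ascent⇒≉ {u = u} {w} {i} d a u≈w = ℕ.<-asym (Descent-resp-≈ {u = u} {w} {i} u≈w d) a

-- Two simple transpositions and their common descents

module _ {n : ℕ} {i j : Fin (pred n)} where

  lo≢lo : i ≢ j → lo {n} i ≢ lo j
  lo≢lo i≢j eq = i≢j (Fin.toℕ-injective (trans (sym (toℕ-lo {n} i)) (trans (cong toℕ eq) (toℕ-lo {n} j))))

  hi≢hi : i ≢ j → hi {n} i ≢ hi j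
  hi≢hi i≢j eq = i≢j (Fin.toℕ-injective (ℕ.suc-injective (trans (sym (toℕ-hi′ {n} i)) (trans (cong toℕ eq) (toℕ-hi′ {n} j)))))

  lo≢hi : toℕ i ≢ suc (toℕ j) → lo {n} i ≢ hi j
  lo≢hi i≢1+j eq = i≢1+j (trans (sym (toℕ-lo {n} i)) (trans (cong toℕ eq) (toℕ-hi′ {n} j)))

  lo≡hi : toℕ i ≡ suc (toℕ j) → lo {n} i ≡ hi j
  lo≡hi i≡1+j = Fin.toℕ-injective (trans (toℕ-lo {n} i) (trans i≡1+j (sym (toℕ-hi′ {n} j))))

module Far {n : ℕ} {i j : Fin (pred n)}
  (i≢j : i ≢ j) (i≢1+j : toℕ i ≢ suc (toℕ j)) (j≢1+i : toℕ j ≢ suc (toℕ i)) where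

  s-fix-lo : s {n} j ⟨$⟩ʳ lo i ≡ lo i
  s-fix-lo = s-fix {n} j (lo≢lo {n} i≢j) (lo≢hi {n} i≢1+j)

  s-fix-hi : s {n} j ⟨$⟩ʳ hi i ≡ hi i
  s-fix-hi = s-fix {n} j (lo≢hi {n} j≢1+i ∘ sym) (hi≢hi {n} i≢j)

  descent-·s : ∀ (w : Permutation′ n) → Descent w i → Descent (w · s j) i
  descent-·s w = subst₂ (λ a b → w ⟨$⟩ʳ a Fin.< w ⟨$⟩ʳ b) (sym s-fix-hi) (sym s-fix-lo)

s-commute : ∀ {n} {i j : Fin (pred n)} → i ≢ j → toℕ i ≢ suc (toℕ j) → toℕ j ≢ suc (toℕ i) →
            s {n} i · s j ≈ₚ s j · s i
s-commute {n} {i} {j} i≢j i≢1+j j≢1+i x = lemma (view (lo {n} i) (hi i) x) (view (lo {n} j) (hi j) x)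
  where
  module ij = Far {n} {i} {j} i≢j i≢1+j j≢1+i
  module ji = Far {n} {j} {i} (i≢j ∘ sym) j≢1+i i≢1+j
  lemma : ∀ {y z} → View (lo {n} i) (hi i) x y → View (lo {n} j) (hi j) x z → s {n} i ⟨$⟩ʳ z ≡ s {n} j ⟨$⟩ʳ y
  lemma (isFst refl) (isFst eq) = contradiction eq (lo≢lo {n} i≢j)
  lemma (isFst refl) (isSnd eq) = contradiction eq (lo≢hi {n} i≢1+j)
  lemma (isFst refl) (other _ _) = trans (s-lo {n} i) (sym ij.s-fix-hi)
  lemma (isSnd refl) (isFst eq) = contradiction (sym eq) (lo≢hi {n} j≢1+i)
  lemma (isSnd refl) (isSnd eq) = contradiction eq (hi≢hi {n} i≢j)
  lemma (isSnd refl) (other _ _) = trans (s-hi {n} i) (sym ij.s-fix-lo)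
  lemma (other _ _) (isFst refl) = trans ji.s-fix-hi (sym (s-lo {n} j))
  lemma (other _ _) (isSnd refl) = trans ji.s-fix-lo (sym (s-hi {n} j))
  lemma (other ≢lo ≢hi) (other ≢lo′ ≢hi′) = trans (s-fix {n} i ≢lo ≢hi) (sym (s-fix {n} j ≢lo′ ≢hi′))

module Adjacent {n : ℕ} {i j : Fin (pred n)} (j≡1+i : toℕ j ≡ suc (toℕ i)) where
  private
    a b c : Fin n
    a = lo i
    b = hi i
    c = hi j

    i≢j : i ≢ j
    i≢j refl = ℕ.1+n≢n (sym j≡1+i)

    loj : lo j ≡ b
    loj = lo≡hi {n} j≡1+i

    sia : s {n} i ⟨$⟩ʳ a ≡ b
    sia = s-lo {n} i

    sib : s {n} i ⟨$⟩ʳ b ≡ a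
    sib = s-hi {n} i

    sic : s {n} i ⟨$⟩ʳ c ≡ c
    sic = s-fix {n} i (lo≢hi {n} (λ i≡1+j → ℕ.<-asym (ℕ.≤-reflexive (sym j≡1+i)) (ℕ.≤-reflexive (sym i≡1+j))) ∘ sym) (hi≢hi {n} (i≢j ∘ sym))

    sja : s {n} j ⟨$⟩ʳ a ≡ a
    sja = s-fix {n} j (lo≢lo {n} i≢j) (lo≢hi {n} λ i≡1+j → ℕ.<-asym (ℕ.≤-reflexive (sym j≡1+i)) (ℕ.≤-reflexive (sym i≡1+j)))

    sjb : s {n} j ⟨$⟩ʳ b ≡ c
    sjb = trans (cong (s {n} j ⟨$⟩ʳ_) (sym loj)) (s-lo {n} j)

    sjc : s {n} j ⟨$⟩ʳ c ≡ b
    sjc = trans (s-hi {n} j) loj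

    sᵢ sⱼ : Fin n → Fin n
    sᵢ = s {n} i ⟨$⟩ʳ_
    sⱼ = s {n} j ⟨$⟩ʳ_

  s-braid : (s {n} i · s j) · s i ≈ₚ (s j · s i) · s j
  s-braid x = pointwise (x Fin.≟ a) (x Fin.≟ b) (x Fin.≟ c)
    where
    pointwise : Dec (x ≡ a) → Dec (x ≡ b) → Dec (x ≡ c) → sᵢ (sⱼ (sᵢ x)) ≡ sⱼ (sᵢ (sⱼ x))
    pointwise (yes refl) _ _ = trans (cong (sᵢ ∘ sⱼ) sia) (trans (cong sᵢ sjb) (trans sic (sym (trans (cong (sⱼ ∘ sᵢ) sja) (trans (cong sⱼ sia) sjb)))))
    pointwise (no _) (yes refl) _ = trans (cong (sᵢ ∘ sⱼ) sib) (trans (cong sᵢ sja) (trans sia (sym (trans (cong (sⱼ ∘ sᵢ) sjb) (trans (cong sⱼ sic) sjc)))))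
    pointwise (no _) (no _) (yes refl) = trans (cong (sᵢ ∘ sⱼ) sic) (trans (cong sᵢ sjc) (trans sib (sym (trans (cong (sⱼ ∘ sᵢ) sjc) (trans (cong sⱼ sib) sja)))))
    pointwise (no x≢a) (no x≢b) (no x≢c) = trans (cong (sᵢ ∘ sⱼ) six) (trans (cong sᵢ sjx) (trans six (sym (trans (cong (sⱼ ∘ sᵢ) sjx) (trans (cong sⱼ six) sjx)))))
      where
      six = s-fix {n} i x≢a x≢b
      sjx = s-fix {n} j (λ eq → x≢b (trans eq loj)) x≢c

  module _ (w : Permutation′ n) (di : Descent w i) (dj : Descent w j) where
    private
      _>_ : Fin n → Fin n → Set
      x > y = w ⟨$⟩ʳ y Fin.< w ⟨$⟩ʳ x

      b>c : b > c
      b>c = subst (_> c) loj dj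

      a>c : a > c
      a>c = ℕ.<-trans b>c di

    -- Since w decreases on the consecutive points a, b, c, every pair stays inverted until it is
    -- swapped. So both words sⱼsᵢsⱼ and sᵢsⱼsᵢ of the longest element can be stripped from w, one
    -- descent at a time.
    descent-j : Descent (w · s j) i
    descent-j = subst₂ _>_ (sym sja) (sym sjb) a>c

    descent-i : Descent (w · s i) j
    descent-i = subst₂ _>_ (sym (trans (cong sᵢ loj) sib)) (sym sic) a>c

    descent-ji : Descent (w · s j · s i) j
    descent-ji = subst₂ _>_ (sym (trans (cong (sⱼ ∘ sᵢ) loj) (trans (cong sⱼ sib) sja))) (sym (trans (cong sⱼ sic) sjc)) di

    descent-ij : Descent (w · s i · s j) i
    descent-ij = subst₂ _>_ (sym (trans (cong sᵢ sja) sia)) (sym (trans (cong sᵢ sjb) sic)) b>c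

-- The subgroup ⟨sᵢ, sⱼ⟩ has type A₁, A₁ × A₁ or A₂.
data RankTwo {n : ℕ} (i j : Fin n) : Set where
  equal    : i ≡ j → RankTwo i j
  far      : i ≢ j → toℕ i ≢ suc (toℕ j) → toℕ j ≢ suc (toℕ i) → RankTwo i j
  adjacent : toℕ j ≡ suc (toℕ i) ⊎ toℕ i ≡ suc (toℕ j) → RankTwo i j

rankTwo : ∀ {n} (i j : Fin n) → RankTwo i j
rankTwo i j with i Fin.≟ j | toℕ i ℕ.≟ suc (toℕ j) | toℕ j ℕ.≟ suc (toℕ i)
... | yes eq | _      | _      = equal eq
... | no _   | yes eq | _      = adjacent (inj₂ eq)
... | no _   | no _   | yes eq = adjacent (inj₁ eq)
... | no i≢j | no ne  | no ne′ = far i≢j ne ne′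

-- Products along reduced words and Matsumoto's theorem

module ReducedProduct {c ℓ′} (M : Monoid c ℓ′) {n : ℕ} (f : Fin (pred n) → Monoid.Carrier M) where
  open Monoid M hiding (refl; sym; trans)
  open SetoidReasoning setoid

  ⟦_⟧ : Word n → Carrier
  ⟦_⟧ = foldr (λ i h → f i ∙ h) ε

  ⟦∷ʳ⟧ : ∀ u i → ⟦ u ∷ʳ i ⟧ ≈ ⟦ u ⟧ ∙ f i
  ⟦∷ʳ⟧ [] i = begin
    f i ∙ ε ≈⟨ identityʳ (f i) ⟩
    f i     ≈⟨ identityˡ (f i) ⟨
    ε ∙ f i ∎
  ⟦∷ʳ⟧ (j ∷ u) i = begin
    f j ∙ ⟦ u ∷ʳ i ⟧    ≈⟨ ∙-congˡ (⟦∷ʳ⟧ u i) ⟩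
    f j ∙ (⟦ u ⟧ ∙ f i) ≈⟨ assoc (f j) ⟦ u ⟧ (f i) ⟨
    f j ∙ ⟦ u ⟧ ∙ f i   ∎

  F : Permutation′ n → Carrier
  F w = ⟦ reducedWord w ⟧

  F-ℓ≡0 : ∀ w → ℓ w ≡ 0 → F w ≡ ε
  F-ℓ≡0 w ℓ≡0 = cong (λ l → ⟦ stripDescents l w ⟧) ℓ≡0

  -- `stripDescents` appends the descent that it finds, hence the factor on the right; the descent
  -- is existential because the choice is left to `descent?`.
  F-some-descent : ∀ w → ℓ w ≢ 0 → ∃ λ i → Descent w i × F w ≈ F (w · s i) ∙ f i
  F-some-descent w = strip (ℓ w) refl
    where
    -- The fuel of `reducedWord w` is ℓ w, which cannot be matched on; it is generalized to l, and
    -- `ℓ-descent` shows that the remaining fuel is the one belonging to w · sᵢ.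
    strip : ∀ l → ℓ w ≡ l → l ≢ 0 → ∃ λ i → Descent w i × ⟦ stripDescents l w ⟧ ≈ F (w · s i) ∙ f i
    strip zero    _  l≢0 = contradiction refl l≢0
    strip (suc l) eq _ with descent? w
    ... | no ¬d       = contradiction (trans (sym eq) (no-descent⇒ℓ≡0 w ¬d)) λ ()
    ... | yes (i , d) = i , d , (begin
      ⟦ stripDescents l (w · s i) ∷ʳ i ⟧   ≈⟨ ⟦∷ʳ⟧ (stripDescents l (w · s i)) i ⟩
      ⟦ stripDescents l (w · s i) ⟧ ∙ f i
        ≡⟨ cong (λ l → ⟦ stripDescents l (w · s i) ⟧ ∙ f i) (ℕ.suc-injective (trans (sym eq) (ℓ-descent w i d))) ⟩
      F (w · s i) ∙ f i ∎)

record BraidRelations {c ℓ′} (M : Monoid c ℓ′) {n : ℕ} (f : Fin (pred n) → Monoid.Carrier M) : Set ℓ′ where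
  open Monoid M using (_≈_; _∙_)
  field
    f-braid : ∀ i j → toℕ j ≡ suc (toℕ i) → f i ∙ f j ∙ f i ≈ f j ∙ f i ∙ f j
    f-far   : ∀ i j → suc (toℕ i) < toℕ j → f i ∙ f j ≈ f j ∙ f i

-- Matsumoto's theorem in the form F w ≈ F (w · s i) ∙ f i for every descent i of
-- w, although reducedWord strips one particular descent: two descents i, j of w
-- are exchanged by stripping the longest element of ⟨sᵢ, sⱼ⟩ from w.
module Matsumoto {c ℓ′} (M : Monoid c ℓ′) {n : ℕ} (f : Fin (pred n) → Monoid.Carrier M)
  (f-relations : BraidRelations M {n} f)
  where

  open Monoid M hiding (refl; sym; trans)
  open BraidRelations f-relations
  open SetoidReasoning setoid
  open ReducedProduct M {n} f public

  private
    -- `F` can be seen to respect `_≈ₚ_` only by stripping the same descent from both permutations,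
    -- and exchanging descents in turn compares `F` at shorter permutations that agree only up to
    -- `_≈ₚ_`. So the two statements go up together, with the length bounded by l.
    Cong Strip : ℕ → Set _
    Cong l = ∀ w → ℓ w ≤ l → ∀ u → u ≈ₚ w → F u ≈ F w
    Strip l = ∀ w → ℓ w ≤ l → ∀ u → u ≈ₚ w → ∀ i → Descent w i → F u ≈ F (w · s i) ∙ f i

    strip⇒cong : ∀ {l} → Strip l → Cong l
    strip⇒cong strip w ℓw≤l u u≈w with ℓ w ℕ.≟ 0
    ... | yes ℓ≡0 = reflexive (trans (F-ℓ≡0 u (trans (ℓ-cong {u = u} {w} u≈w) ℓ≡0)) (sym (F-ℓ≡0 w ℓ≡0)))
    ... | no ℓ≢0 with F-some-descent w ℓ≢0
    ...   | i , d , eq = Monoid.trans M (strip w ℓw≤l u u≈w i d) (Monoid.sym M eq)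

    ℓ-·s≤pred : ∀ {l} (w : Permutation′ n) i → Descent w i → ℓ w ≤ suc l → ℓ (w · s i) ≤ l
    ℓ-·s≤pred w i d ℓw≤ = s≤s⁻¹ (subst (_≤ _) (ℓ-descent w i d) ℓw≤)

    f-commute : ∀ {i j} → i ≢ j → toℕ i ≢ suc (toℕ j) → toℕ j ≢ suc (toℕ i) → f i ∙ f j ≈ f j ∙ f i
    f-commute {i} {j} i≢j i≢1+j j≢1+i with ℕ.<-cmp (toℕ i) (toℕ j)
    ... | tri< i<j _ _ = f-far i j (ℕ.≤∧≢⇒< i<j (j≢1+i ∘ sym))
    ... | tri≈ _ eq _  = contradiction (Fin.toℕ-injective eq) i≢j
    ... | tri> _ _ j<i = Monoid.sym M (f-far j i (ℕ.≤∧≢⇒< j<i (i≢1+j ∘ sym)))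

    module Step {l : ℕ} (strip : Strip l) (w : Permutation′ n) (ℓw≤ : ℓ w ≤ suc l) where

      split : ∀ i → Descent w i → ∀ j → Descent (w · s i) j → F (w · s i) ≈ F (w · s i · s j) ∙ f j
      split i di j dj = strip (w · s i) (ℓ-·s≤pred w i di ℓw≤) (w · s i) (λ _ → refl) j dj

      drop-≤ : ∀ {i} → Descent w i → ∀ (v : Permutation′ n) → suc (ℓ v) ≤ ℓ (w · s i) → ℓ v ≤ l
      drop-≤ {i} di v lt = ℕ.≤-trans (ℕ.n≤1+n _) (ℕ.≤-trans lt (ℓ-·s≤pred w i di ℓw≤))

      split₂ : ∀ i → Descent w i → ∀ j → Descent (w · s i) j → ∀ k → Descent (w · s i · s j) k →
               F (w · s i) ≈ F (w · s i · s j · s k) ∙ f k ∙ f j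
      split₂ i di j dj k dk = begin
        F (w · s i)           ≈⟨ split i di j dj ⟩
        F (w · s i · s j) ∙ f j
          ≈⟨ ∙-congʳ (strip (w · s i · s j) ℓ≤ (w · s i · s j) (λ _ → refl) k dk) ⟩
        F (w · s i · s j · s k) ∙ f k ∙ f j ∎
        where
        ℓ≤ : ℓ (w · s i · s j) ≤ l
        ℓ≤ = drop-≤ di (w · s i · s j) (ℕ.≤-reflexive (sym (ℓ-descent (w · s i) j dj)))

      exchange-far : ∀ {i j} → i ≢ j → toℕ i ≢ suc (toℕ j) → toℕ j ≢ suc (toℕ i) → Descent w i → Descent w j →
                     F (w · s j) ∙ f j ≈ F (w · s i) ∙ f i
      exchange-far {i} {j} i≢j ne ne′ di dj = begin
        F (w · s j) ∙ f j             ≈⟨ ∙-congʳ (split j dj i d-ji) ⟩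
        F (w · s j · s i) ∙ f i ∙ f j ≈⟨ assoc _ _ _ ⟩
        F (w · s j · s i) ∙ (f i ∙ f j)
          ≈⟨ ∙-cong (strip⇒cong strip (w · s i · s j) ℓ≤ (w · s j · s i) (λ x → cong (w ⟨$⟩ʳ_) (sym (s-commute {n} i≢j ne ne′ x))))
                    (f-commute i≢j ne ne′) ⟩
        F (w · s i · s j) ∙ (f j ∙ f i) ≈⟨ assoc _ _ _ ⟨
        F (w · s i · s j) ∙ f j ∙ f i ≈⟨ ∙-congʳ (split i di j d-ij) ⟨
        F (w · s i) ∙ f i             ∎
        where
        d-ji : Descent (w · s j) i
        d-ji = Far.descent-·s {n} i≢j ne ne′ w di
        d-ij : Descent (w · s i) j
        d-ij = Far.descent-·s {n} (i≢j ∘ sym) ne′ ne w dj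
        ℓ≤ : ℓ (w · s i · s j) ≤ l
        ℓ≤ = drop-≤ di (w · s i · s j) (ℕ.≤-reflexive (sym (ℓ-descent (w · s i) j d-ij)))

      exchange-adjacent : ∀ {i j} → toℕ j ≡ suc (toℕ i) → Descent w i → Descent w j →
                          F (w · s j) ∙ f j ≈ F (w · s i) ∙ f i
      exchange-adjacent {i} {j} j≡1+i di dj = begin
        F (w · s j) ∙ f j ≈⟨ ∙-congʳ (split₂ j dj i (descent-j w di dj) j (descent-ji w di dj)) ⟩
        F (w · s j · s i · s j) ∙ f j ∙ f i ∙ f j ≈⟨ assoc₄ _ _ _ _ ⟩
        F (w · s j · s i · s j) ∙ (f j ∙ f i ∙ f j)
          ≈⟨ ∙-cong (strip⇒cong strip (w · s i · s j · s i) ℓ≤ (w · s j · s i · s j) (λ x → cong (w ⟨$⟩ʳ_) (sym (s-braid x))))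
                    (Monoid.sym M (f-braid i j j≡1+i)) ⟩
        F (w · s i · s j · s i) ∙ (f i ∙ f j ∙ f i) ≈⟨ assoc₄ _ _ _ _ ⟨
        F (w · s i · s j · s i) ∙ f i ∙ f j ∙ f i ≈⟨ ∙-congʳ (split₂ i di j (descent-i w di dj) i (descent-ij w di dj)) ⟨
        F (w · s i) ∙ f i ∎
        where
        open Adjacent {n} {i} {j} j≡1+i
        assoc₄ : ∀ a b c d → a ∙ b ∙ c ∙ d ≈ a ∙ (b ∙ c ∙ d)
        assoc₄ a b c d = Monoid.trans M (∙-congʳ (assoc a b c)) (assoc a (b ∙ c) d)
        ℓ≤ : ℓ (w · s i · s j · s i) ≤ l
        ℓ≤ = drop-≤ di (w · s i · s j · s i)
          (subst (_≤ _) (ℓ-descent (w · s i · s j) i (descent-ij w di dj))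
            (ℕ.≤-trans (ℕ.n≤1+n _) (ℕ.≤-reflexive (sym (ℓ-descent (w · s i) j (descent-i w di dj))))))

      exchange : ∀ {i j} → RankTwo i j → Descent w i → Descent w j → F (w · s j) ∙ f j ≈ F (w · s i) ∙ f i
      exchange (equal refl) di dj = Monoid.refl M
      exchange (far i≢j ne ne′) di dj = exchange-far i≢j ne ne′ di dj
      exchange (adjacent (inj₁ eq)) di dj = exchange-adjacent eq di dj
      exchange (adjacent (inj₂ eq)) di dj = Monoid.sym M (exchange-adjacent eq dj di)

    -- The word of u ends in a descent j of its own choice; after passing from u to w, the exchange
    -- trades j for the prescribed i.
    strips : ∀ l → Strip l
    strips zero w ℓw≤0 u u≈w i d = contradiction (subst (_≤ 0) (ℓ-descent w i d) ℓw≤0) λ ()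
    strips (suc l) w ℓw≤ u u≈w i d with F-some-descent u (λ ℓu≡0 → contradiction (trans (sym (ℓ-descent w i d)) (trans (ℓ-cong {u = w} {u} (≈ₚ-sym {u = u} {w} u≈w)) ℓu≡0)) λ ())
    ... | j , dj , eq = begin
      F u               ≈⟨ eq ⟩
      F (u · s j) ∙ f j ≈⟨ ∙-congʳ (strip⇒cong (strips l) (w · s j) (ℓ-·s≤pred w j dj′ ℓw≤) (u · s j) (λ x → u≈w _)) ⟩
      F (w · s j) ∙ f j ≈⟨ Step.exchange (strips l) w ℓw≤ (rankTwo i j) d dj′ ⟩
      F (w · s i) ∙ f i ∎
      where
      dj′ : Descent w j
      dj′ = Descent-resp-≈ {u = u} {w} u≈w dj

  F-cong : ∀ {u w} → u ≈ₚ w → F u ≈ F w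
  F-cong {u} {w} = strip⇒cong (strips (ℓ w)) w ℕ.≤-refl u

  F-descent : ∀ w {i} → Descent w i → F w ≈ F (w · s i) ∙ f i
  F-descent w {i} = strips (ℓ w) w ℕ.≤-refl w (λ _ → refl) i

  -- Descents of w are peeled off on the right from w and sᵢw simultaneously until w is the
  -- identity; the length condition ensures that a descent of w is still one of sᵢw.
  F-s· : ∀ i w → ℓ (s i · w) ≡ suc (ℓ w) → F (s i · w) ≈ f i ∙ F w
  F-s· i w = go (ℓ w) w refl
    where
    go : ∀ l w → ℓ w ≡ l → ℓ (s i · w) ≡ suc (ℓ w) → F (s i · w) ≈ f i ∙ F w
    go zero w ℓ≡0 _ = begin
      F (s i · w)            ≈⟨ F-cong {s i · w} {id · s i} siw≈ ⟩
      F (id · s i)           ≈⟨ F-descent (id · s i) (ascent⇒descent-·s id i (ℕ.≤-reflexive (sym (toℕ-hi {n} i)))) ⟩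
      F (id · s i · s i) ∙ f i ≈⟨ ∙-congʳ (F-cong {id · s i · s i} {w} (≈ₚ-trans {u = id · s i · s i} {id} {w} (·s·s {n} i id) id≈w)) ⟩
      F w ∙ f i              ≡⟨ cong (_∙ f i) (F-ℓ≡0 w ℓ≡0) ⟩
      ε ∙ f i                ≈⟨ identityˡ (f i) ⟩
      f i                    ≈⟨ identityʳ (f i) ⟨
      f i ∙ ε                ≡⟨ cong (f i ∙_) (F-ℓ≡0 w ℓ≡0) ⟨
      f i ∙ F w              ∎
      where
      id≈w : id ≈ₚ w
      id≈w = mono⇒id w (ℓ≡0⇒mono w ℓ≡0)
      siw≈ : s i · w ≈ₚ id · s i
      siw≈ x = cong (s {n} i ⟨$⟩ʳ_) (sym (id≈w x))
    go (suc l) w ℓw≡ ℓsw≡ with F-some-descent w (λ ℓ≡0 → contradiction (trans (sym ℓw≡) ℓ≡0) λ ())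
    ... | j , dj , eq = begin
      F (s i · w)               ≈⟨ F-descent (s i · w) dj′ ⟩
      F (s i · w · s j) ∙ f j   ≈⟨ ∙-congʳ (F-cong {s i · w · s j} {s i · (w · s j)} (λ _ → refl)) ⟩
      F (s i · (w · s j)) ∙ f j ≈⟨ ∙-congʳ (go l (w · s j) (ℕ.suc-injective (trans (sym (ℓ-descent w j dj)) ℓw≡)) ℓsws≡) ⟩
      f i ∙ F (w · s j) ∙ f j   ≈⟨ assoc _ _ _ ⟩
      f i ∙ (F (w · s j) ∙ f j) ≈⟨ ∙-congˡ eq ⟨
      f i ∙ F w                 ∎
      where
      ℓsws≤ : ℓ (s i · w · s j) ≤ ℓ w
      ℓsws≤ = subst (ℓ (s i · (w · s j)) ≤_) (sym (ℓ-descent w j dj)) (ℓ-s·≤ (w · s j) i)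
      -- If j were an ascent of sᵢw, then sᵢwsⱼ would have length ℓ w + 2; but wsⱼ is shorter than
      -- w, and sᵢ adds at most 1 to its length.
      dj′ : Descent (s i · w) j
      dj′ with ascent-or-descent (s i · w) j
      ... | inj₂ d = d
      ... | inj₁ a = contradiction (subst (_≤ ℓ w) (trans (ℓ-ascent (s i · w) j a) (cong suc ℓsw≡)) ℓsws≤)
                       (ℕ.<⇒≱ (ℕ.m≤n+m _ 1))
      ℓsws≡ : ℓ (s i · (w · s j)) ≡ suc (ℓ (w · s j))
      ℓsws≡ = trans (ℕ.suc-injective (trans (sym (ℓ-descent (s i · w) j dj′)) ℓsw≡)) (ℓ-descent w j dj)

-- Finite sums in commutative monoids

module ListSum {c ℓ′} (M : CommutativeMonoid c ℓ′) where
  open CommutativeMonoid M hiding (refl; sym; trans)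
  private module M = CommutativeMonoid M
  open SetoidReasoning setoid
  open CommutativeSemigroupProperties commutativeSemigroup using (interchange)

  ∑ : ∀ {a} {A : Set a} → List A → (A → Carrier) → Carrier
  ∑ as f = foldr (λ a x → f a ∙ x) ε as

  module _ {a} {A : Set a} where

    ∑-cong : ∀ (as : List A) {f g : A → Carrier} → (∀ a → f a ≈ g a) → ∑ as f ≈ ∑ as g
    ∑-cong []       f≈g = M.refl
    ∑-cong (a ∷ as) f≈g = ∙-cong (f≈g a) (∑-cong as f≈g)

    ∑-∙ : ∀ (as : List A) (f g : A → Carrier) → ∑ as (λ a → f a ∙ g a) ≈ ∑ as f ∙ ∑ as g
    ∑-∙ []       f g = M.sym (identityˡ ε)
    ∑-∙ (a ∷ as) f g = M.trans (∙-congˡ (∑-∙ as f g)) (interchange _ _ _ _)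

    ∑-ε : ∀ (as : List A) → ∑ as (λ _ → ε) ≈ ε
    ∑-ε []       = M.refl
    ∑-ε (a ∷ as) = M.trans (identityˡ _) (∑-ε as)

    ∑-++ : ∀ (as bs : List A) f → ∑ (as ++ bs) f ≈ ∑ as f ∙ ∑ bs f
    ∑-++ []       bs f = M.sym (identityˡ _)
    ∑-++ (a ∷ as) bs f = M.trans (∙-congˡ (∑-++ as bs f)) (M.sym (assoc _ _ _))

  ∑-map : ∀ {a b} {A : Set a} {B : Set b} (h : A → B) as f → ∑ (map h as) f ≡ ∑ as (f ∘ h)
  ∑-map h []       f = refl
  ∑-map h (a ∷ as) f = cong (f (h a) ∙_) (∑-map h as f)

  ∑-swap : ∀ {a b} {A : Set a} {B : Set b} (as : List A) (bs : List B) (f : A → B → Carrier) →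
           ∑ as (λ a → ∑ bs (f a)) ≈ ∑ bs (λ b → ∑ as (λ a → f a b))
  ∑-swap []       bs f = M.sym (∑-ε bs)
  ∑-swap (a ∷ as) bs f = M.trans (∙-congˡ (∑-swap as bs f)) (M.sym (∑-∙ bs (f a) _))

  ∑-cartesianProductWith : ∀ {a b c} {A : Set a} {B : Set b} {C : Set c} (h : A → B → C) as bs f →
                           ∑ (cartesianProductWith h as bs) f ≈ ∑ as (λ a → ∑ bs (λ b → f (h a b)))
  ∑-cartesianProductWith h []       bs f = M.refl
  ∑-cartesianProductWith h (a ∷ as) bs f = begin
    ∑ (map (h a) bs ++ cartesianProductWith h as bs) f         ≈⟨ ∑-++ (map (h a) bs) _ f ⟩
    ∑ (map (h a) bs) f ∙ ∑ (cartesianProductWith h as bs) f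
      ≈⟨ ∙-cong (reflexive (∑-map (h a) bs f)) (∑-cartesianProductWith h as bs f) ⟩
    ∑ bs (f ∘ h a) ∙ ∑ as (λ a → ∑ bs (λ b → f (h a b)))       ∎

  module _ {s ℓs} (S : Setoid s ℓs) where
    private module S = Setoid S
    open SetoidMembership S using (_∈_)
    open SetoidUnique S using (Unique)

    -- The value y is given apart from f x because f is not assumed to respect the equality of S.
    -- Uniqueness of the list ensures that y is counted only once.
    ∑-support : ∀ {as x y} → Unique as → x ∈ as → (f : S.Carrier → Carrier) →
                (∀ a → a S.≈ x → f a ≈ y) → (∀ a → ¬ a S.≈ x → f a ≈ ε) → ∑ as f ≈ y
    ∑-support {a ∷ as} {x} {y} (a∉as AllPairs.∷ _) (Any.here x≈a) f f-at f-off = begin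
      f a ∙ ∑ as f ≈⟨ ∙-cong (f-at a (S.sym x≈a)) (vanish as a∉as) ⟩
      y ∙ ε        ≈⟨ identityʳ y ⟩
      y            ∎
      where
      vanish : ∀ bs → All.All (λ b → ¬ a S.≈ b) bs → ∑ bs f ≈ ε
      vanish []       All.[]            = M.refl
      vanish (b ∷ bs) (a≉b All.∷ a∉bs) =
        M.trans (∙-cong (f-off b λ b≈x → a≉b (S.sym (S.trans b≈x x≈a))) (vanish bs a∉bs)) (identityˡ ε)
    ∑-support {a ∷ as} {x} {y} (a∉as AllPairs.∷ as!) (Any.there x∈as) f f-at f-off = begin
      f a ∙ ∑ as f ≈⟨ ∙-cong (f-off a (λ a≈x → absent as a∉as x∈as a≈x)) (∑-support as! x∈as f f-at f-off) ⟩
      ε ∙ y        ≈⟨ identityˡ y ⟩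
      y            ∎
      where
      absent : ∀ bs → All.All (λ b → ¬ a S.≈ b) bs → x ∈ bs → ¬ a S.≈ x
      absent (b ∷ bs) (a≉b All.∷ _)    (Any.here x≈b)    a≈x = a≉b (S.trans a≈x x≈b)
      absent (b ∷ bs) (_   All.∷ a∉bs) (Any.there x∈bs) a≈x = absent bs a∉bs x∈bs a≈x

    -- Double counting: f is spread over the matrix g that has f b at the places (a, b) with b ≈ σ a
    -- and ε elsewhere. Row a sums to f (σ a); column b has its only entry at a ≈ σ b and sums to f
    -- b.
    ∑-involution : Decidable S._≈_ → ∀ {as} → Unique as → (∀ a → a ∈ as) →
                   (σ : S.Carrier → S.Carrier) → (∀ {a b} → a S.≈ b → σ a S.≈ σ b) → (∀ a → σ (σ a) S.≈ a) →
                   (f : S.Carrier → Carrier) → (∀ {a b} → a S.≈ b → f a ≈ f b) →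
                   ∑ as (f ∘ σ) ≈ ∑ as f
    ∑-involution _≟_ {as} as! complete σ σ-cong σσ f f-cong = begin
      ∑ as (f ∘ σ)                 ≈⟨ ∑-cong as (λ a → row a) ⟨
      ∑ as (λ a → ∑ as (g a))      ≈⟨ ∑-swap as as g ⟩
      ∑ as (λ b → ∑ as λ a → g a b) ≈⟨ ∑-cong as column ⟩
      ∑ as f                       ∎
      where
      g : S.Carrier → S.Carrier → Carrier
      g a b = if does (b ≟ σ a) then f b else ε
      g-at : ∀ a b → b S.≈ σ a → g a b ≈ f b
      g-at a b b≈σa with b ≟ σ a
      ... | yes _    = M.refl
      ... | no  b≉σa = contradiction b≈σa b≉σa
      g-off : ∀ a b → ¬ b S.≈ σ a → g a b ≈ ε
      g-off a b b≉σa with b ≟ σ a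
      ... | yes b≈σa = contradiction b≈σa b≉σa
      ... | no  _    = M.refl
      row : ∀ a → ∑ as (g a) ≈ f (σ a)
      row a = ∑-support as! (complete (σ a)) (g a)
        (λ b b≈σa → M.trans (g-at a b b≈σa) (f-cong b≈σa)) (g-off a)
      column : ∀ b → ∑ as (λ a → g a b) ≈ f b
      column b = ∑-support as! (complete (σ b)) (λ a → g a b)
        (λ a a≈σb → g-at a b (S.trans (S.sym (σσ b)) (σ-cong (S.sym a≈σb))))
        (λ a a≉σb → g-off a b λ b≈σa → a≉σb (S.trans (S.sym (σσ a)) (σ-cong (S.sym b≈σa))))

module _ {c₁ ℓ₁ c₂ ℓ₂} (M : CommutativeMonoid c₁ ℓ₁) (N : CommutativeMonoid c₂ ℓ₂) where
  private
    module M = CommutativeMonoid M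
    module N = CommutativeMonoid N

  ∑-homo : (h : M.Carrier → N.Carrier) → h M.ε N.≈ N.ε → (∀ x y → h (x M.∙ y) N.≈ h x N.∙ h y) →
           ∀ {a} {A : Set a} (as : List A) f → h (ListSum.∑ M as f) N.≈ ListSum.∑ N as (h ∘ f)
  ∑-homo h h-ε h-∙ []       f = h-ε
  ∑-homo h h-ε h-∙ (a ∷ as) f = N.trans (h-∙ _ _) (N.∙-congˡ (∑-homo h h-ε h-∙ as f))

≈ₚ-dec : ∀ {n} → Decidable (_≈ₚ_ {n} {n})
≈ₚ-dec u w = Fin.all? λ x → u ⟨$⟩ʳ x Fin.≟ w ⟨$⟩ʳ x

-- Lengths of block sums and of insertions

sum-+ : ∀ k {m} (f : Fin (k + m) → ℕ) → sum f ≡ sum (λ i → f (i ↑ˡ m)) + sum (λ j → f (k ↑ʳ j))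
sum-+ zero    f = refl
sum-+ (suc k) f = trans (cong (f zero +_) (sum-+ k (f ∘ suc))) (sym (ℕ.+-assoc (f zero) _ _))

↑ˡ-mono-< : ∀ {k} m {i j : Fin k} → i Fin.< j → i ↑ˡ m Fin.< j ↑ˡ m
↑ˡ-mono-< m {i} {j} = subst₂ _<_ (sym (Fin.toℕ-↑ˡ i m)) (sym (Fin.toℕ-↑ˡ j m))

↑ˡ-cancel-< : ∀ {k} m {i j : Fin k} → i ↑ˡ m Fin.< j ↑ˡ m → i Fin.< j
↑ˡ-cancel-< m {i} {j} = subst₂ _<_ (Fin.toℕ-↑ˡ i m) (Fin.toℕ-↑ˡ j m)

↑ʳ-mono-< : ∀ k {m} {i j : Fin m} → i Fin.< j → k ↑ʳ i Fin.< k ↑ʳ j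
↑ʳ-mono-< k {m} {i} {j} i<j = subst₂ _<_ (sym (Fin.toℕ-↑ʳ k i)) (sym (Fin.toℕ-↑ʳ k j)) (ℕ.+-monoʳ-< k i<j)

↑ʳ-cancel-< : ∀ k {m} {i j : Fin m} → k ↑ʳ i Fin.< k ↑ʳ j → i Fin.< j
↑ʳ-cancel-< k {m} {i} {j} lt = ℕ.+-cancelˡ-< k _ _ (subst₂ _<_ (Fin.toℕ-↑ʳ k i) (Fin.toℕ-↑ʳ k j) lt)

↑ˡ<↑ʳ : ∀ {k m} (i : Fin k) (j : Fin m) → i ↑ˡ m Fin.< k ↑ʳ j
↑ˡ<↑ʳ {k} {m} i j = subst₂ _<_ (sym (Fin.toℕ-↑ˡ i m)) (sym (Fin.toℕ-↑ʳ k j)) (ℕ.<-≤-trans (Fin.toℕ<n i) (ℕ.m≤m+n k _))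

module _ {k m : ℕ} (u : Permutation′ k) (v : Permutation′ m) where

  ⊞-↑ˡ : ∀ i → (u ⊞ v) ⟨$⟩ʳ (i ↑ˡ m) ≡ (u ⟨$⟩ʳ i) ↑ˡ m
  ⊞-↑ˡ i rewrite Fin.splitAt-↑ˡ k i m = refl

  ⊞-↑ʳ : ∀ j → (u ⊞ v) ⟨$⟩ʳ (k ↑ʳ j) ≡ k ↑ʳ (v ⟨$⟩ʳ j)
  ⊞-↑ʳ j rewrite Fin.splitAt-↑ʳ k m j = refl

  -- A pair of positions from different blocks is never inverted.
  ℓ-⊞ : ℓ (u ⊞ v) ≡ ℓ u + ℓ v
  ℓ-⊞ = trans (sum-+ k _) (cong₂ _+_ (sum-cong first) (sum-cong last))
    where
    w = u ⊞ v
    first : ∀ i → sum (inversion w (i ↑ˡ m)) ≡ sum (inversion u i)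
    first i = trans (sum-+ k _) (trans (cong₂ _+_ (sum-cong same) (sum-zero cross)) (ℕ.+-identityʳ _))
      where
      same : ∀ j → inversion w (i ↑ˡ m) (j ↑ˡ m) ≡ inversion u i j
      same j = cong₂ (λ a b → if a ∧ b then 1 else 0)
        (does-⇔ (i ↑ˡ m Fin.<? j ↑ˡ m) (i Fin.<? j) (↑ˡ-cancel-< m) (↑ˡ-mono-< m))
        (does-⇔ (w ⟨$⟩ʳ (j ↑ˡ m) Fin.<? w ⟨$⟩ʳ (i ↑ˡ m)) (u ⟨$⟩ʳ j Fin.<? u ⟨$⟩ʳ i)
          (↑ˡ-cancel-< m ∘ subst₂ Fin._<_ (⊞-↑ˡ j) (⊞-↑ˡ i)) (subst₂ Fin._<_ (sym (⊞-↑ˡ j)) (sym (⊞-↑ˡ i)) ∘ ↑ˡ-mono-< m))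
      cross : ∀ j → inversion w (i ↑ˡ m) (k ↑ʳ j) ≡ 0
      cross j = trans (cong (λ b → if does (i ↑ˡ m Fin.<? k ↑ʳ j) ∧ b then 1 else 0)
        (does-no (w ⟨$⟩ʳ (k ↑ʳ j) Fin.<? w ⟨$⟩ʳ (i ↑ˡ m))
          (ℕ.<-asym (subst₂ Fin._<_ (sym (⊞-↑ˡ i)) (sym (⊞-↑ʳ j)) (↑ˡ<↑ʳ (u ⟨$⟩ʳ i) (v ⟨$⟩ʳ j))))))
        (if-∧-false (does (i ↑ˡ m Fin.<? k ↑ʳ j)))
        where
        if-∧-false : ∀ b → (if b ∧ false then 1 else 0) ≡ 0
        if-∧-false true  = refl
        if-∧-false false = refl
    last : ∀ i → sum (inversion w (k ↑ʳ i)) ≡ sum (inversion v i)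
    last i = trans (sum-+ k _) (cong₂ _+_ (sum-zero cross) (sum-cong same))
      where
      same : ∀ j → inversion w (k ↑ʳ i) (k ↑ʳ j) ≡ inversion v i j
      same j = cong₂ (λ a b → if a ∧ b then 1 else 0)
        (does-⇔ (k ↑ʳ i Fin.<? k ↑ʳ j) (i Fin.<? j) (↑ʳ-cancel-< k) (↑ʳ-mono-< k))
        (does-⇔ (w ⟨$⟩ʳ (k ↑ʳ j) Fin.<? w ⟨$⟩ʳ (k ↑ʳ i)) (v ⟨$⟩ʳ j Fin.<? v ⟨$⟩ʳ i)
          (↑ʳ-cancel-< k ∘ subst₂ Fin._<_ (⊞-↑ʳ j) (⊞-↑ʳ i)) (subst₂ Fin._<_ (sym (⊞-↑ʳ j)) (sym (⊞-↑ʳ i)) ∘ ↑ʳ-mono-< k))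
      cross : ∀ j → inversion w (k ↑ʳ i) (j ↑ˡ m) ≡ 0
      cross j = cong (λ b → if b ∧ does (w ⟨$⟩ʳ (j ↑ˡ m) Fin.<? w ⟨$⟩ʳ (k ↑ʳ i)) then 1 else 0)
        (does-no (k ↑ʳ i Fin.<? j ↑ˡ m) (ℕ.<-asym (↑ˡ<↑ʳ j i)))

punchIn-< : ∀ {n} (j : Fin (suc n)) x → toℕ x < toℕ j → punchIn j x Fin.< j
punchIn-< (suc j) zero    _         = s≤s z≤n
punchIn-< (suc j) (suc x) (s≤s x<j) = s≤s (punchIn-< j x x<j)

punchIn-<⁻¹ : ∀ {n} (j : Fin (suc n)) x → punchIn j x Fin.< j → toℕ x < toℕ j
punchIn-<⁻¹ (suc j) zero    _        = s≤s z≤n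
punchIn-<⁻¹ (suc j) (suc x) (s≤s lt) = s≤s (punchIn-<⁻¹ j x lt)

#below : ∀ {n} (j : Fin (suc n)) → sum {n} (λ x → if does (toℕ x ℕ.<? toℕ j) then 1 else 0) ≡ toℕ j
#below {zero}  zero    = refl
#below {suc n} zero    = sum-zero {suc n} λ x → refl
#below {suc n} (suc j) = cong suc (trans (sum-cong {n} λ x → cong (λ b → if b then 1 else 0)
  (does-⇔ (suc (toℕ x) ℕ.<? suc (toℕ j)) (toℕ x ℕ.<? toℕ j) s≤s⁻¹ s≤s)) (#below j))

-- Position 0 carries the value j, and exactly the j smaller values make an inversion with it. The
-- other pairs are those of u, as `punchIn j` preserves and reflects the order.
ℓ-insert : ∀ {n} (j : Fin (suc n)) (u : Permutation′ n) → ℓ (insert zero j u) ≡ toℕ j + ℓ u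
ℓ-insert {n} j u = cong₂ _+_ (trans (sum-cong first) (trans (sym (sum-permute (λ x → if does (toℕ x ℕ.<? toℕ j) then 1 else 0) u)) (#below j)))
  (sum-cong λ a → sum-cong λ b → cong₂ (λ c d → if c ∧ d then 1 else 0)
    (does-⇔ (suc a Fin.<? suc b) (a Fin.<? b) s≤s⁻¹ s≤s)
    (does-⇔ (punchIn j (u ⟨$⟩ʳ b) Fin.<? punchIn j (u ⟨$⟩ʳ a)) (u ⟨$⟩ʳ b Fin.<? u ⟨$⟩ʳ a)
      (λ lt → ℕ.≰⇒> λ ge → ℕ.<⇒≱ lt (Fin.punchIn-mono-≤ j _ _ ge))
      (λ lt → ℕ.≰⇒> λ ge → ℕ.<⇒≱ lt (Fin.punchIn-cancel-≤ j _ _ ge))))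
  where
  w = insert zero j u
  first : ∀ b → inversion w zero (suc b) ≡ (if does (toℕ (u ⟨$⟩ʳ b) ℕ.<? toℕ j) then 1 else 0)
  first b = cong (λ c → if c then 1 else 0)
    (does-⇔ (punchIn j (u ⟨$⟩ʳ b) Fin.<? j) (toℕ (u ⟨$⟩ʳ b) ℕ.<? toℕ j) (punchIn-<⁻¹ j _) (punchIn-< j _))

sucC2 : ∀ k → suc k C 2 ≡ k + k C 2
sucC2 k = trans (sym (nCk+nC[k+1]≡[n+1]C[k+1] k 1)) (cong (_+ k C 2) (nC1≡n k))

ℓ≤C2 : ∀ {k} (u : Permutation′ k) → ℓ u ≤ k C 2
ℓ≤C2 {zero}  u = z≤n
ℓ≤C2 {suc k} u = subst₂ _≤_
  (trans (sym (ℓ-insert (u ⟨$⟩ʳ zero) (remove zero u)))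
    (ℓ-cong {u = insert zero (u ⟨$⟩ʳ zero) (remove zero u)} {u} (insert-remove zero u)))
  (sym (sucC2 k))
  (ℕ.+-mono-≤ (s≤s⁻¹ (Fin.toℕ<n (u ⟨$⟩ʳ zero))) (ℓ≤C2 (remove zero u)))

[m+n]∸[o+p] : ∀ {m n o p} → o ≤ m → p ≤ n → (m + n) ∸ (o + p) ≡ (m ∸ o) + (n ∸ p)
[m+n]∸[o+p] {m} {n} {o} {p} o≤m p≤n = trans (sym (ℕ.∸-+-assoc (m + n) o p))
  (trans (cong (_∸ p) (ℕ.+-∸-comm n o≤m)) (ℕ.+-∸-assoc (m ∸ o) p≤n))

-- Poincaré polynomials of symmetric groups and Young subgroups

module Poincaré where
  open 𝒜ħ using (_≈_; _*_; _^_; 1#; 0#) renaming (_+_ to infixl 6 _⊹_)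
  open ListSum 𝒜ħ.+-commutativeMonoid
  open Exp 𝒜ħ.semiring using (^-homo-*)
  open SetoidReasoning 𝒜ħ.setoid
  open CommutativeSemigroupProperties 𝒜ħ.*-commutativeSemigroup using (interchange; x∙yz≈y∙xz)

  *-∑ : ∀ {a} {A : Set a} x (as : List A) f → x * ∑ as f ≈ ∑ as (λ a → x * f a)
  *-∑ x = ∑-homo 𝒜ħ.+-commutativeMonoid 𝒜ħ.+-commutativeMonoid (x *_) (𝒜ħ.zeroʳ x) (𝒜ħ.distribˡ x)

  ∑-* : ∀ {a} {A : Set a} x (as : List A) f → ∑ as f * x ≈ ∑ as (λ a → f a * x)
  ∑-* x = ∑-homo 𝒜ħ.+-commutativeMonoid 𝒜ħ.+-commutativeMonoid (_* x) (𝒜ħ.zeroˡ x) (𝒜ħ.distribʳ x)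

  ∑*∑ : ∀ {a b} {A : Set a} {B : Set b} (as : List A) (bs : List B) f g →
        ∑ as (λ a → ∑ bs λ b → f a * g b) ≈ ∑ as f * ∑ bs g
  ∑*∑ as bs f g = begin
    ∑ as (λ a → ∑ bs λ b → f a * g b) ≈⟨ ∑-cong as (λ a → *-∑ (f a) bs g) ⟨
    ∑ as (λ a → f a * ∑ bs g)         ≈⟨ ∑-* (∑ bs g) as f ⟨
    ∑ as f * ∑ bs g                   ∎

  -- Homogeneous of degree d as long as l ≤ d. Beyond that the subtraction truncates and `weight-+`
  -- can fail, so the bound `ℓ≤C2` has to accompany every factorization of a sum over S_k.
  weight : ℕ → ℕ → 𝒜ħ.Carrier
  weight d l = q ^ (d ∸ l) * p ^ l

  weight-+ : ∀ {d e l r} → l ≤ d → r ≤ e → weight (d + e) (l + r) ≈ weight d l * weight e r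
  weight-+ {d} {e} {l} {r} l≤d r≤e = begin
    q ^ ((d + e) ∸ (l + r)) * p ^ (l + r)             ≡⟨ cong (λ x → q ^ x * p ^ (l + r)) ([m+n]∸[o+p] l≤d r≤e) ⟩
    q ^ ((d ∸ l) + (e ∸ r)) * p ^ (l + r)             ≈⟨ 𝒜ħ.*-cong (^-homo-* q (d ∸ l) (e ∸ r)) (^-homo-* p l r) ⟩
    q ^ (d ∸ l) * q ^ (e ∸ r) * (p ^ l * p ^ r)       ≈⟨ interchange _ _ _ _ ⟩
    weight d l * weight e r                           ∎

  -- The recursion for `[_]` adds a pure power of q, which is the summand j = 0; the remaining
  -- summands have a common factor p.
  bracket-∑ : ∀ d → ∑ (allFin (suc d)) (λ j → weight d (toℕ j)) ≈ [ suc d ]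
  bracket-∑ zero = begin
    1# * 1# ⊹ 0#  ≈⟨ 𝒜ħ.+-congʳ (𝒜ħ.*-identityˡ 1#) ⟩
    1# ⊹ 0#       ≈⟨ 𝒜ħ.+-comm 1# 0# ⟩
    0# ⊹ 1#       ≈⟨ 𝒜ħ.+-congʳ (𝒜ħ.zeroʳ p) ⟨
    p * 0# ⊹ 1#   ∎
  bracket-∑ (suc d) = begin
    weight (suc d) 0 ⊹ ∑ (tabulate {n = suc d} suc) (λ j → weight (suc d) (toℕ j))
      ≡⟨ cong (λ (as : List (Fin (suc (suc d)))) → weight (suc d) 0 ⊹ ∑ as (λ j → weight (suc d) (toℕ j))) (List.map-tabulate {n = suc d} (λ j → j) suc) ⟨
    weight (suc d) 0 ⊹ ∑ (map suc (allFin (suc d))) (λ j → weight (suc d) (toℕ j))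
      ≡⟨ cong (weight (suc d) 0 ⊹_) (∑-map suc (allFin (suc d)) (λ j → weight (suc d) (toℕ j))) ⟩
    weight (suc d) 0 ⊹ ∑ (allFin (suc d)) (λ j → weight (suc d) (suc (toℕ j)))
      ≈⟨ 𝒜ħ.+-cong (𝒜ħ.*-identityʳ (q ^ suc d)) (∑-cong (allFin (suc d)) λ j → x∙yz≈y∙xz (q ^ (d ∸ toℕ j)) p (p ^ toℕ j)) ⟩
    q ^ suc d ⊹ ∑ (allFin (suc d)) (λ j → p * weight d (toℕ j))
      ≈⟨ 𝒜ħ.+-congˡ (*-∑ p (allFin (suc d)) (λ j → weight d (toℕ j))) ⟨
    q ^ suc d ⊹ p * ∑ (allFin (suc d)) (λ j → weight d (toℕ j))
      ≈⟨ 𝒜ħ.+-congˡ (𝒜ħ.*-congˡ (bracket-∑ d)) ⟩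
    q ^ suc d ⊹ p * [ suc d ]
      ≈⟨ 𝒜ħ.+-comm _ _ ⟩
    [ suc (suc d) ] ∎

  -- A permutation in S_{k+1} is given by its first value j and by some u in S_k, and its length is
  -- j + ℓ u; so the sum is the product of [k+1] and the sum over S_k.
  poincaré : ∀ k → ∑ (permutations k) (λ u → weight (k C 2) (ℓ u)) ≈ [ k ]!
  poincaré zero = 𝒜ħ.trans (𝒜ħ.+-identityʳ _) (𝒜ħ.*-identityˡ 1#)
  poincaré (suc k) = begin
    ∑ (permutations (suc k)) (λ u → weight (suc k C 2) (ℓ u))
      ≈⟨ ∑-cartesianProductWith (insert zero) (allFin (suc k)) (permutations k) _ ⟩
    ∑ (allFin (suc k)) (λ j → ∑ (permutations k) λ u → weight (suc k C 2) (ℓ (insert zero j u)))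
      ≈⟨ ∑-cong (allFin (suc k)) (λ j → ∑-cong (permutations k) (λ u → factor j u)) ⟩
    ∑ (allFin (suc k)) (λ j → ∑ (permutations k) λ u → weight k (toℕ j) * weight (k C 2) (ℓ u))
      ≈⟨ ∑*∑ (allFin (suc k)) (permutations k) _ _ ⟩
    ∑ (allFin (suc k)) (λ j → weight k (toℕ j)) * ∑ (permutations k) (λ u → weight (k C 2) (ℓ u))
      ≈⟨ 𝒜ħ.*-cong (bracket-∑ k) (poincaré k) ⟩
    [ suc k ]! ∎
    where
    factor : ∀ j u → weight (suc k C 2) (ℓ (insert zero j u)) ≈ weight k (toℕ j) * weight (k C 2) (ℓ u)
    factor j u = 𝒜ħ.trans (𝒜ħ.reflexive (cong₂ weight (sucC2 k) (ℓ-insert j u)))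
      (weight-+ (s≤s⁻¹ (Fin.toℕ<n j)) (ℓ≤C2 u))

  young-poincaré : ∀ k m → ∑ (youngSubgroup k m) (λ v → weight (k C 2 + m C 2) (ℓ v)) ≈ [ k ]! * [ m ]!
  young-poincaré k m = begin
    ∑ (youngSubgroup k m) (λ v → weight (k C 2 + m C 2) (ℓ v))
      ≈⟨ ∑-cartesianProductWith _⊞_ (permutations k) (permutations m) _ ⟩
    ∑ (permutations k) (λ u → ∑ (permutations m) λ v → weight (k C 2 + m C 2) (ℓ (u ⊞ v)))
      ≈⟨ ∑-cong (permutations k) (λ u → ∑-cong (permutations m) (λ v → factor u v)) ⟩
    ∑ (permutations k) (λ u → ∑ (permutations m) λ v → weight (k C 2) (ℓ u) * weight (m C 2) (ℓ v))
      ≈⟨ ∑*∑ (permutations k) (permutations m) _ _ ⟩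
    ∑ (permutations k) (λ u → weight (k C 2) (ℓ u)) * ∑ (permutations m) (λ v → weight (m C 2) (ℓ v))
      ≈⟨ 𝒜ħ.*-cong (poincaré k) (poincaré m) ⟩
    [ k ]! * [ m ]! ∎
    where
    factor : ∀ u v → weight (k C 2 + m C 2) (ℓ (u ⊞ v)) ≈ weight (k C 2) (ℓ u) * weight (m C 2) (ℓ v)
    factor u v = 𝒜ħ.trans (𝒜ħ.reflexive (cong (weight _) (ℓ-⊞ u v))) (weight-+ (ℓ≤C2 u) (ℓ≤C2 v))

opposite-antitone-< : ∀ {n} {i j : Fin n} → i Fin.< j → opposite j Fin.< opposite i
opposite-antitone-< {n} {i} {j} i<j = subst₂ _<_ (sym (Fin.opposite-prop j)) (sym (Fin.opposite-prop i))
  (ℕ.∸-monoʳ-< (s≤s i<j) (Fin.toℕ<n j))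

-- The action of T̅ᵢ on the basis and the dual functionals

module _ {c ℓ′} (R : Ring c ℓ′) where
  open Ring R hiding (refl; sym; trans) renaming (_+_ to infixl 6 _⊹_)
  private module R = Ring R
  open SetoidReasoning setoid
  open RingProperties R using (x[y-z]≈xy-xz; [y-z]x≈yx-zx)
  open GroupProperties +-group using (x∙y⁻¹≈ε⇒x≈y)
  open AbelianGroupProperties +-abelianGroup using (xyx⁻¹≈y)

  -- The quadratic relation says that (t + a)t = (t + a)b = tb + ab, and subtracting bt = tb leaves
  -- ab.
  quadratic⇒inverse : ∀ t a b → b * t ≈ t * b → (t ⊹ a) * (t - b) ≈ 0# → (t ⊹ (a - b)) * t ≈ a * b
  quadratic⇒inverse t a b bt≈tb quad = begin
    (t ⊹ (a - b)) * t         ≈⟨ *-congʳ (+-assoc t a (- b)) ⟨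
    ((t ⊹ a) - b) * t         ≈⟨ [y-z]x≈yx-zx t (t ⊹ a) b ⟩
    (t ⊹ a) * t - b * t       ≈⟨ +-cong lemma (-‿cong bt≈tb) ⟩
    (t * b ⊹ a * b) - t * b   ≈⟨ xyx⁻¹≈y (t * b) (a * b) ⟩
    a * b                     ∎
    where
    lemma : (t ⊹ a) * t ≈ t * b ⊹ a * b
    lemma = R.trans (x∙y⁻¹≈ε⇒x≈y _ _ (R.trans (R.sym (x[y-z]≈xy-xz (t ⊹ a) t b)) quad)) (distribʳ b t a)

module Action {n : ℕ} {c ℓ₁ ℓ₂ m ℓm : Level} (V : SchubertRepresentation n c ℓ₁ ℓ₂ m ℓm) where
  open SchubertRepresentation V
  open Ĥ n hiding (∑)
  open Presentation.Quotient 𝒜ħ (Generator n) _∼_ using (relation; con-+; con-*; con-cong; con-central)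
  module H = Ring ring
  module K = CommutativeRing 𝔽.commutativeRing
  module V = Module 𝕍
  module ▷ = IsLeftModule ▷-isLeftModule
  module φ = IsRingHomomorphism φ-isRingHomomorphism
  module ev = ModuleMorphism.IsModuleHomomorphism ev-linear
  open SetoidReasoning V.≈ᴹ-setoid

  T-relations : BraidRelations H.*-monoid {n} T
  T-relations = record { f-braid = λ i j eq → relation (braid i j eq) ; f-far = λ i j lt → relation (T-far i j lt) }

  open Matsumoto H.*-monoid {n} T T-relations public
    using () renaming (F-cong to T-cong; F-s· to T-s·)
  open ReducedProduct H.*-monoid {n} T̅ public
    using () renaming (F-ℓ≡0 to T̅-ℓ≡0; F-some-descent to T̅-some-descent)

  φ-*ₗ-* : ∀ a b v → φ (a 𝒜ħ.* b) *ₗ v ≈ᴹ φ a *ₗ (φ b *ₗ v)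
  φ-*ₗ-* a b v = V.≈ᴹ-trans (V.*ₗ-congʳ (φ.*-homo a b)) (V.*ₗ-assoc _ _ _)

  φ-*ₗ-+ : ∀ a b v → φ (a 𝒜ħ.+ b) *ₗ v ≈ᴹ φ a *ₗ v +ᴹ φ b *ₗ v
  φ-*ₗ-+ a b v = V.≈ᴹ-trans (V.*ₗ-congʳ (φ.+-homo a b)) (V.*ₗ-distribʳ _ _ _)

  φ-*ₗ-cong : ∀ {a b} v → a 𝒜ħ.≈ b → φ a *ₗ v ≈ᴹ φ b *ₗ v
  φ-*ₗ-cong v a≈b = V.*ₗ-congʳ (φ.⟦⟧-cong a≈b)

  *ₗ-comm : ∀ a b v → a *ₗ (b *ₗ v) ≈ᴹ b *ₗ (a *ₗ v)
  *ₗ-comm a b v = V.≈ᴹ-trans (V.≈ᴹ-sym (V.*ₗ-assoc a b v)) (V.≈ᴹ-trans (V.*ₗ-congʳ (K.*-comm a b)) (V.*ₗ-assoc b a v))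

  -- The presentation makes `con` additive and multiplicative; compatibility with negation follows
  -- since con (- b) is an additive inverse of con b.
  con-- : ∀ a b → con (a 𝒜ħ.- b) H.≈ con a ⊖ con b
  con-- a b = H.trans (con-+ a (𝒜ħ.- b)) (H.+-congˡ (H.trans (H.sym (H.+-identityʳ _))
    (H.trans (H.+-congˡ (H.sym (H.-‿inverseʳ (con b)))) (H.trans (H.sym (H.+-assoc _ _ _))
      (H.trans (H.+-congʳ (H.trans (H.sym (con-+ (𝒜ħ.- b) b)) (con-cong (𝒜ħ.-‿inverseˡ b)))) (H.+-identityˡ _))))))

  T̅⊗T : ∀ i → T̅ i ⊗ T i H.≈ con (p 𝒜ħ.* q)
  T̅⊗T i = H.trans (H.*-congʳ (H.+-congˡ (con-- p q))) (H.trans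
    (quadratic⇒inverse ring (T i) (con p) (con q) (con-central q (T i)) (relation (quadratic i)))
    (H.sym (con-* p q)))

  𝒴-cong : ∀ {u w} → u ≈ₚ w → 𝒴 u ≈ᴹ 𝒴 w
  𝒴-cong {u} {w} u≈w = begin
    𝒴 u                     ≈⟨ 𝒴-T u ⟩
    T[ u ⁻¹ · w₀ ] ▷ 𝒴 w₀   ≈⟨ ▷.*ₗ-congʳ (T-cong {u ⁻¹ · w₀} {w ⁻¹ · w₀} u⁻¹w₀≈w⁻¹w₀) ⟩
    T[ w ⁻¹ · w₀ ] ▷ 𝒴 w₀   ≈⟨ 𝒴-T w ⟨
    𝒴 w                     ∎
    where
    u⁻¹w₀≈w⁻¹w₀ : u ⁻¹ · w₀ ≈ₚ w ⁻¹ · w₀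
    u⁻¹w₀≈w⁻¹w₀ x = ⟨$⟩ʳ-injective w (trans (sym (u≈w _)) (trans (inverseʳ u) (sym (inverseʳ w))))

  T▷𝒴 : ∀ {w i} → Descent w i → T i ▷ 𝒴 w ≈ᴹ 𝒴 (w · s i)
  T▷𝒴 {w} {i} d = begin
    T i ▷ 𝒴 w                           ≈⟨ ▷.*ₗ-congˡ (𝒴-T w) ⟩
    T i ▷ T[ v ] ▷ 𝒴 w₀                 ≈⟨ ▷.*ₗ-assoc _ _ _ ⟨
    (T i ⊗ T[ v ]) ▷ 𝒴 w₀               ≈⟨ ▷.*ₗ-congʳ (T-s· i v ℓsv) ⟨
    T[ s i · v ] ▷ 𝒴 w₀                 ≈⟨ ▷.*ₗ-congʳ (T-cong {s i · v} {(w · s i) ⁻¹ · w₀} λ x → sym (s⁻¹ {n} i (v ⟨$⟩ʳ x))) ⟩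
    T[ (w · s i) ⁻¹ · w₀ ] ▷ 𝒴 w₀       ≈⟨ 𝒴-T (w · s i) ⟨
    𝒴 (w · s i)                         ∎
    where
    v = w ⁻¹ · w₀
    -- v⁻¹ is w followed by the reversal w₀ of the values, so the descent i of w is an ascent of
    -- v⁻¹.
    ℓsv : ℓ (s i · v) ≡ suc (ℓ v)
    ℓsv = trans (ℓ-s· v i) (trans (ℓ-ascent (v ⁻¹) i (opposite-antitone-< d)) (cong suc (ℓ-⁻¹ v)))

  T̅▷𝒴-descent : ∀ {w i} → Descent w i → T̅ i ▷ 𝒴 w ≈ᴹ 𝒴 (w · s i) +ᴹ φ (p 𝒜ħ.- q) *ₗ 𝒴 w
  T̅▷𝒴-descent {w} {i} d = V.≈ᴹ-trans (▷.*ₗ-distribʳ _ _ _) (V.+ᴹ-cong (T▷𝒴 d) (▷-scalar _ _))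

  T̅▷𝒴-ascent : ∀ {w i} → Ascent w i → T̅ i ▷ 𝒴 w ≈ᴹ φ (p 𝒜ħ.* q) *ₗ 𝒴 (w · s i)
  T̅▷𝒴-ascent {w} {i} a = begin
    T̅ i ▷ 𝒴 w                  ≈⟨ ▷.*ₗ-congˡ (𝒴-cong {(w · s i) · s i} {w} (·s·s {n} i w)) ⟨
    T̅ i ▷ 𝒴 (w · s i · s i)    ≈⟨ ▷.*ₗ-congˡ (T▷𝒴 (ascent⇒descent-·s w i a)) ⟨
    T̅ i ▷ T i ▷ 𝒴 (w · s i)    ≈⟨ ▷.*ₗ-assoc _ _ _ ⟨
    (T̅ i ⊗ T i) ▷ 𝒴 (w · s i)  ≈⟨ ▷.*ₗ-congʳ (T̅⊗T i) ⟩
    con (p 𝒜ħ.* q) ▷ 𝒴 (w · s i) ≈⟨ ▷-scalar _ _ ⟩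
    φ (p 𝒜ħ.* q) *ₗ 𝒴 (w · s i) ∎

  -- `ev-nonzero` only excludes that the value is apart from 0; tightness of the apartness turns
  -- this into equality.
  ev-𝒴≉id : ∀ w → ¬ w ≈ₚ id → ev (𝒴 w) 𝔽.≈ 𝔽.0#
  ev-𝒴≉id w w≉id = proj₁ (𝔽.tight _ _) λ ev#0 → w≉id (Equivalence.to (ev-nonzero w) ev#0)

  record Dual (h : Term) (x : Permutation′ n) : Set ℓ₁ where
    field
      at  : ∀ w → w ≈ₚ x → ev (h ▷ 𝒴 w) 𝔽.≈ ev (𝒴 id)
      off : ∀ w → ¬ w ≈ₚ x → ev (h ▷ 𝒴 w) 𝔽.≈ 𝔽.0#

  private
    module ≈ = SetoidReasoning K.setoid

  -- If i is a descent of w, then w is not x, so h annihilates the diagonal term (p-q) 𝒴_w under ev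
  -- and only 𝒴_{wsᵢ} counts. If i is an ascent of w, then T̅ᵢ 𝒴_w is a multiple of 𝒴_{wsᵢ}, and wsᵢ
  -- is not x because it has the descent i.
  dual-T̅ : ∀ {h x i} → Ascent x i → Dual h x → Dual (h ⊗ T̅ i) (x · s i)
  dual-T̅ {h} {x} {i} asc dual = record { at = at′ ; off = off′ }
    where
    open Dual dual
    ≉x : ∀ w → Descent w i → ¬ w ≈ₚ x
    ≉x w d = descent∧ascent⇒≉ {u = w} {x} d asc
    ev-descent : ∀ w → Descent w i → ev ((h ⊗ T̅ i) ▷ 𝒴 w) 𝔽.≈ ev (h ▷ 𝒴 (w · s i))
    ev-descent w d = ≈.begin
      ev ((h ⊗ T̅ i) ▷ 𝒴 w) ≈.≈⟨ ev.⟦⟧-cong (begin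
        (h ⊗ T̅ i) ▷ 𝒴 w                                ≈⟨ ▷.*ₗ-assoc _ _ _ ⟩
        h ▷ T̅ i ▷ 𝒴 w                                  ≈⟨ ▷.*ₗ-congˡ (T̅▷𝒴-descent d) ⟩
        h ▷ (𝒴 (w · s i) +ᴹ φ (p 𝒜ħ.- q) *ₗ 𝒴 w)       ≈⟨ ▷.*ₗ-distribˡ _ _ _ ⟩
        h ▷ 𝒴 (w · s i) +ᴹ h ▷ (φ (p 𝒜ħ.- q) *ₗ 𝒴 w)   ≈⟨ V.+ᴹ-congˡ (▷-linear _ _ _) ⟩
        h ▷ 𝒴 (w · s i) +ᴹ φ (p 𝒜ħ.- q) *ₗ (h ▷ 𝒴 w)   ∎) ⟩
      ev (h ▷ 𝒴 (w · s i) +ᴹ φ (p 𝒜ħ.- q) *ₗ (h ▷ 𝒴 w)) ≈.≈⟨ ev.+ᴹ-homo _ _ ⟩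
      ev (h ▷ 𝒴 (w · s i)) K.+ ev (φ (p 𝒜ħ.- q) *ₗ (h ▷ 𝒴 w)) ≈.≈⟨ K.+-congˡ (ev.*ₗ-homo _ _) ⟩
      ev (h ▷ 𝒴 (w · s i)) K.+ φ (p 𝒜ħ.- q) K.* ev (h ▷ 𝒴 w) ≈.≈⟨ K.+-congˡ (K.trans (K.*-congˡ (off w (≉x w d))) (K.zeroʳ _)) ⟩
      ev (h ▷ 𝒴 (w · s i)) K.+ K.0# ≈.≈⟨ K.+-identityʳ _ ⟩
      ev (h ▷ 𝒴 (w · s i)) ≈.∎
    at′ : ∀ w → w ≈ₚ x · s i → ev ((h ⊗ T̅ i) ▷ 𝒴 w) 𝔽.≈ ev (𝒴 id)
    at′ w w≈xs = K.trans
      (ev-descent w (Descent-resp-≈ {u = x · s i} {w} (≈ₚ-sym {u = w} {x · s i} w≈xs) (ascent⇒descent-·s x i asc)))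
      (at (w · s i) λ y → trans (w≈xs _) (·s·s {n} i x y))
    off′ : ∀ w → ¬ w ≈ₚ x · s i → ev ((h ⊗ T̅ i) ▷ 𝒴 w) 𝔽.≈ 𝔽.0#
    off′ w w≉xs with ascent-or-descent w i
    ... | inj₂ d = K.trans (ev-descent w d) (off (w · s i) λ ws≈x → w≉xs (·s-transpose {n} i {w} {x} ws≈x))
    ... | inj₁ a = ≈.begin
      ev ((h ⊗ T̅ i) ▷ 𝒴 w) ≈.≈⟨ ev.⟦⟧-cong (begin
        (h ⊗ T̅ i) ▷ 𝒴 w                     ≈⟨ ▷.*ₗ-assoc _ _ _ ⟩
        h ▷ T̅ i ▷ 𝒴 w                       ≈⟨ ▷.*ₗ-congˡ (T̅▷𝒴-ascent a) ⟩
        h ▷ (φ (p 𝒜ħ.* q) *ₗ 𝒴 (w · s i))   ≈⟨ ▷-linear _ _ _ ⟩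
        φ (p 𝒜ħ.* q) *ₗ (h ▷ 𝒴 (w · s i))   ∎) ⟩
      ev (φ (p 𝒜ħ.* q) *ₗ (h ▷ 𝒴 (w · s i))) ≈.≈⟨ ev.*ₗ-homo _ _ ⟩
      φ (p 𝒜ħ.* q) K.* ev (h ▷ 𝒴 (w · s i)) ≈.≈⟨ K.*-congˡ (off (w · s i) (≉x (w · s i) (ascent⇒descent-·s w i a))) ⟩
      φ (p 𝒜ħ.* q) K.* K.0# ≈.≈⟨ K.zeroʳ _ ⟩
      K.0# ≈.∎

  dual-cong : ∀ {h h′ x x′} → h H.≈ h′ → x ≈ₚ x′ → Dual h x → Dual h′ x′
  dual-cong {x = x} {x′} h≈h′ x≈x′ dual = record
    { at  = λ w w≈x′ → K.trans (ev.⟦⟧-cong (▷.*ₗ-congʳ (H.sym h≈h′))) (at w λ y → trans (w≈x′ y) (sym (x≈x′ y)))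
    ; off = λ w w≉x′ → K.trans (ev.⟦⟧-cong (▷.*ₗ-congʳ (H.sym h≈h′))) (off w λ w≈x → w≉x′ λ y → trans (w≈x y) (x≈x′ y))
    }
    where open Dual dual

  T̅-dual : ∀ x → Dual T̅[ x ] x
  T̅-dual x = go (ℓ x) x refl
    where
    go : ∀ l x → ℓ x ≡ l → Dual T̅[ x ] x
    go zero x ℓ≡0 = dual-cong {x = id} {x} (H.reflexive (sym (T̅-ℓ≡0 x ℓ≡0))) (mono⇒id x (ℓ≡0⇒mono x ℓ≡0)) record
      { at  = λ w w≈id → ev.⟦⟧-cong (V.≈ᴹ-trans (▷.*ₗ-identityˡ _) (𝒴-cong {w} {id} w≈id))
      ; off = λ w w≉id → K.trans (ev.⟦⟧-cong (▷.*ₗ-identityˡ _)) (ev-𝒴≉id w w≉id)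
      }
    go (suc l) x ℓ≡ with T̅-some-descent x (λ ℓ≡0 → contradiction (trans (sym ℓ≡) ℓ≡0) λ ())
    ... | i , d , eq = dual-cong {x = x · s i · s i} {x} (H.sym eq) (·s·s {n} i x)
      (dual-T̅ {x = x · s i} (descent⇒ascent-·s x i d) (go l (x · s i) (ℕ.suc-injective (trans (sym (ℓ-descent x i d)) ℓ≡))))

-- Blocks, Young subgroups and Grassmannian permutations

module _ {k m : ℕ} where

  ↑-elim : ∀ {a} {P : Fin (k + m) → Set a} → (∀ i → P (i ↑ˡ m)) → (∀ j → P (k ↑ʳ j)) → ∀ x → P x
  ↑-elim {P = P} left right x = subst P (Fin.join-splitAt k m x) (on (splitAt k x))
    where
    on : ∀ y → P (Fin.join k m y)
    on (inj₁ i) = left i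
    on (inj₂ j) = right j

  ↑ˡ≢↑ʳ : ∀ {i j} → i ↑ˡ m ≢ k ↑ʳ j
  ↑ˡ≢↑ʳ {i} {j} eq = ℕ.<-irrefl (cong toℕ eq) (↑ˡ<↑ʳ i j)

  data BlockView (j : Fin (pred (k + m))) : Set where
    left     : ∀ (i : Fin (pred k)) → lo {k} i ↑ˡ m ≡ lo j → hi {k} i ↑ˡ m ≡ hi j → BlockView j
    right    : ∀ (i : Fin (pred m)) → k ↑ʳ lo i ≡ lo j → k ↑ʳ hi i ≡ hi j → BlockView j
    boundary : ∀ {a : Fin k} {b : Fin m} → a ↑ˡ m ≡ lo j → k ↑ʳ b ≡ hi j → BlockView j

  blockView : ∀ j → BlockView j
  blockView j = classify (splitAt k (lo {k + m} j)) (splitAt k (hi {k + m} j))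
    (Fin.join-splitAt k m (lo {k + m} j)) (Fin.join-splitAt k m (hi {k + m} j))
    where
    classify : ∀ x y → Fin.join k m x ≡ lo j → Fin.join k m y ≡ hi j → BlockView j
    classify (inj₁ a) (inj₁ b) a≡ b≡ with adjacent⇒lo-hi a b (trans (sym (Fin.toℕ-↑ˡ b m))
      (trans (cong toℕ b≡) (trans (toℕ-hi {k + m} j) (cong suc (trans (cong toℕ (sym a≡)) (Fin.toℕ-↑ˡ a m))))))
    ... | i , refl , refl = left i a≡ b≡
    classify (inj₁ a) (inj₂ b) a≡ b≡ = boundary {a = a} {b} a≡ b≡
    classify (inj₂ a) (inj₁ b) a≡ b≡ = contradiction (↑ˡ<↑ʳ b a)
      (ℕ.<-asym (subst₂ Fin._<_ (sym a≡) (sym b≡) (ℕ.≤-reflexive (sym (toℕ-hi {k + m} j)))))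
    classify (inj₂ a) (inj₂ b) a≡ b≡ with adjacent⇒lo-hi a b (ℕ.+-cancelˡ-≡ k _ _ (trans (sym (Fin.toℕ-↑ʳ k b))
      (trans (cong toℕ b≡) (trans (toℕ-hi {k + m} j) (trans (cong suc (trans (cong toℕ (sym a≡)) (Fin.toℕ-↑ʳ k a))) (sym (ℕ.+-suc k _)))))))
    ... | i , refl , refl = right i a≡ b≡

  ⊞-cong : ∀ {u u′ : Permutation′ k} {v v′ : Permutation′ m} → u ≈ₚ u′ → v ≈ₚ v′ → (u ⊞ v) ≈ₚ (u′ ⊞ v′)
  ⊞-cong {u} {u′} {v} {v′} u≈u′ v≈v′ = ↑-elim
    (λ i → trans (⊞-↑ˡ u v i) (trans (cong (_↑ˡ m) (u≈u′ i)) (sym (⊞-↑ˡ u′ v′ i))))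
    (λ j → trans (⊞-↑ʳ u v j) (trans (cong (k ↑ʳ_) (v≈v′ j)) (sym (⊞-↑ʳ u′ v′ j))))

  id⊞id : (id {k} ⊞ id {m}) ≈ₚ id
  id⊞id = ↑-elim (⊞-↑ˡ id id) (⊞-↑ʳ id id)

  module _ {i : Fin (pred k)} {j : Fin (pred (k + m))} (lo≡ : lo {k} i ↑ˡ m ≡ lo j) (hi≡ : hi {k} i ↑ˡ m ≡ hi j) where

    s-↑ˡ-left : ∀ a → s {k + m} j ⟨$⟩ʳ (a ↑ˡ m) ≡ (s {k} i ⟨$⟩ʳ a) ↑ˡ m
    s-↑ˡ-left a = on (view (lo {k} i) (hi i) a)
      where
      on : ∀ {b} → View (lo {k} i) (hi i) a b → s {k + m} j ⟨$⟩ʳ (a ↑ˡ m) ≡ b ↑ˡ m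
      on (isFst refl) = trans (cong (s {k + m} j ⟨$⟩ʳ_) lo≡) (trans (s-lo {k + m} j) (sym hi≡))
      on (isSnd refl) = trans (cong (s {k + m} j ⟨$⟩ʳ_) hi≡) (trans (s-hi {k + m} j) (sym lo≡))
      on (other ≢lo ≢hi) = s-fix {k + m} j (λ eq → ≢lo (Fin.↑ˡ-injective m _ _ (trans eq (sym lo≡))))
                                            (λ eq → ≢hi (Fin.↑ˡ-injective m _ _ (trans eq (sym hi≡))))

    s-↑ʳ-left : ∀ b → s {k + m} j ⟨$⟩ʳ (k ↑ʳ b) ≡ k ↑ʳ b
    s-↑ʳ-left b = s-fix {k + m} j (λ eq → ↑ˡ≢↑ʳ (trans lo≡ (sym eq))) (λ eq → ↑ˡ≢↑ʳ (trans hi≡ (sym eq)))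

    ⊞-·s-left : ∀ u v → (u ⊞ v) · s j ≈ₚ ((u · s i) ⊞ v)
    ⊞-·s-left u v = ↑-elim
      (λ a → trans (cong ((u ⊞ v) ⟨$⟩ʳ_) (s-↑ˡ-left a)) (trans (⊞-↑ˡ u v _) (sym (⊞-↑ˡ (u · s i) v a))))
      (λ b → trans (cong ((u ⊞ v) ⟨$⟩ʳ_) (s-↑ʳ-left b)) (trans (⊞-↑ʳ u v _) (sym (⊞-↑ʳ (u · s i) v b))))

  module _ {i : Fin (pred m)} {j : Fin (pred (k + m))} (lo≡ : k ↑ʳ lo i ≡ lo j) (hi≡ : k ↑ʳ hi i ≡ hi j) where

    s-↑ʳ-right : ∀ b → s {k + m} j ⟨$⟩ʳ (k ↑ʳ b) ≡ k ↑ʳ (s {m} i ⟨$⟩ʳ b)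
    s-↑ʳ-right b = on (view (lo {m} i) (hi i) b)
      where
      on : ∀ {c} → View (lo {m} i) (hi i) b c → s {k + m} j ⟨$⟩ʳ (k ↑ʳ b) ≡ k ↑ʳ c
      on (isFst refl) = trans (cong (s {k + m} j ⟨$⟩ʳ_) lo≡) (trans (s-lo {k + m} j) (sym hi≡))
      on (isSnd refl) = trans (cong (s {k + m} j ⟨$⟩ʳ_) hi≡) (trans (s-hi {k + m} j) (sym lo≡))
      on (other ≢lo ≢hi) = s-fix {k + m} j (λ eq → ≢lo (Fin.↑ʳ-injective k _ _ (trans eq (sym lo≡))))
                                            (λ eq → ≢hi (Fin.↑ʳ-injective k _ _ (trans eq (sym hi≡))))

    s-↑ˡ-right : ∀ a → s {k + m} j ⟨$⟩ʳ (a ↑ˡ m) ≡ a ↑ˡ m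
    s-↑ˡ-right a = s-fix {k + m} j (λ eq → ↑ˡ≢↑ʳ (trans eq (sym lo≡))) (λ eq → ↑ˡ≢↑ʳ (trans eq (sym hi≡)))

    ⊞-·s-right : ∀ u v → (u ⊞ v) · s j ≈ₚ (u ⊞ (v · s i))
    ⊞-·s-right u v = ↑-elim
      (λ a → trans (cong ((u ⊞ v) ⟨$⟩ʳ_) (s-↑ˡ-right a)) (trans (⊞-↑ˡ u v _) (sym (⊞-↑ˡ u (v · s i) a))))
      (λ b → trans (cong ((u ⊞ v) ⟨$⟩ʳ_) (s-↑ʳ-right b)) (trans (⊞-↑ʳ u v _) (sym (⊞-↑ʳ u (v · s i) b))))

  -- This characterizes the shortest element of the coset g (S_k × S_m).
  BlockIncreasing : Permutation′ (k + m) → Set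
  BlockIncreasing g = (∀ {a b} → a Fin.< b → g ⟨$⟩ʳ (a ↑ˡ m) Fin.< g ⟨$⟩ʳ (b ↑ˡ m)) ×
                      (∀ {a b} → a Fin.< b → g ⟨$⟩ʳ (k ↑ʳ a) Fin.< g ⟨$⟩ʳ (k ↑ʳ b))

  module _ (κ : Partition k m) where
    open IsGrassmannian (grassmannian-isGrassmannian κ)
    private module κ = Grassmannian κ

    grassmannian-first : ∀ a → toℕ (grassmannian κ ⟨$⟩ʳ (a ↑ˡ m)) ≡ κ.fst a
    grassmannian-first a = trans (cong (λ b → toℕ (grassmannian κ ⟨$⟩ʳ (b ↑ˡ m))) (sym (Fin.opposite-involutive a)))
      (trans (on-first (opposite a)) (cong (λ b → part κ (opposite a) + toℕ b) (Fin.opposite-involutive a)))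

    grassmannian-increasing : BlockIncreasing (grassmannian κ)
    grassmannian-increasing =
      (λ {a} {b} a<b → subst₂ _<_ (sym (grassmannian-first a)) (sym (grassmannian-first b)) (κ.fst-mono a<b)) ,
      increasing-on-last

  module _ {g : Permutation′ (k + m)} {w : Permutation′ (k + m)} (g↑ : BlockIncreasing g) where

    -- On the first block g ∘ u is increasing like w, and g reflects the order there; so u is
    -- monotone.
    cancel-left : ∀ u v → w ≈ₚ g · (u ⊞ v) →
      (∀ {a b} → a Fin.< b → w ⟨$⟩ʳ (a ↑ˡ m) Fin.< w ⟨$⟩ʳ (b ↑ˡ m)) → u ≈ₚ id
    cancel-left u v w≈ w↑ = ≈ₚ-sym {u = id} {u} (mono⇒id u λ {a} {b} a<b → reflect (subst₂ Fin._<_ (at a) (at b) (w↑ a<b)))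
      where
      at : ∀ a → w ⟨$⟩ʳ (a ↑ˡ m) ≡ g ⟨$⟩ʳ ((u ⟨$⟩ʳ a) ↑ˡ m)
      at a = trans (w≈ (a ↑ˡ m)) (cong (g ⟨$⟩ʳ_) (⊞-↑ˡ u v a))
      reflect : ∀ {a b} → g ⟨$⟩ʳ (a ↑ˡ m) Fin.< g ⟨$⟩ʳ (b ↑ˡ m) → a Fin.< b
      reflect {a} {b} lt with Fin.<-cmp a b
      ... | tri< a<b _ _ = a<b
      ... | tri≈ _ refl _ = contradiction lt (ℕ.<-irrefl refl)
      ... | tri> _ _ b<a = contradiction (proj₁ g↑ b<a) (ℕ.<-asym lt)

part-injective : ∀ {k m} (μ ν : Partition k m) → (∀ i → part μ i ≡ part ν i) → μ ≡ ν
part-injective []      []      _  = refl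
part-injective (a ∷ μ) (b ∷ ν) eq with Fin.toℕ-injective (eq zero)
... | refl = cong (a ∷_) (part-injective μ ν (eq ∘ suc))

-- The values on the first block determine the partition, so it is enough to cancel u.
grassmannian-injective : ∀ {k m} (μ ν : Partition k m) {u v} → grassmannian μ ≈ₚ grassmannian ν · (u ⊞ v) → μ ≡ ν
grassmannian-injective {k} {m} μ ν {u} {v} eq = part-injective μ ν λ i →
  ℕ.+-cancelʳ-≡ (toℕ (opposite i)) _ _ (trans (sym (on-first μ i)) (trans (cong toℕ (at i)) (on-first ν i)))
  where
  open module G κ = IsGrassmannian (grassmannian-isGrassmannian {k} {m} κ)
  u≈id : u ≈ₚ id
  u≈id = cancel-left {g = grassmannian ν} {grassmannian μ} (grassmannian-increasing ν) u v eq (proj₁ (grassmannian-increasing μ))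
  at : ∀ i → grassmannian μ ⟨$⟩ʳ (opposite i ↑ˡ m) ≡ grassmannian ν ⟨$⟩ʳ (opposite i ↑ˡ m)
  at i = trans (eq _) (cong (grassmannian ν ⟨$⟩ʳ_) (trans (⊞-↑ˡ u v (opposite i)) (cong (_↑ˡ m) (u≈id (opposite i)))))

-- Weighted sums over a symmetric group as eigenvectors

module Eigen {n : ℕ} {c ℓ₁ ℓ₂ m ℓm : Level} (V : SchubertRepresentation n c ℓ₁ ℓ₂ m ℓm) where
  open SchubertRepresentation V
  open Ĥ n hiding (∑)
  open Action V
  open ListSum V.+ᴹ-commutativeMonoid
  open SetoidReasoning V.≈ᴹ-setoid

  *ₗ-∑ : ∀ {a} {A : Set a} x (as : List A) f → x *ₗ ∑ as f ≈ᴹ ∑ as (λ a → x *ₗ f a)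
  *ₗ-∑ x = ∑-homo V.+ᴹ-commutativeMonoid V.+ᴹ-commutativeMonoid (x *ₗ_) (V.*ₗ-zeroʳ x) (V.*ₗ-distribˡ x)

  ▷-∑ : ∀ {a} {A : Set a} h (as : List A) f → h ▷ ∑ as f ≈ᴹ ∑ as (λ a → h ▷ f a)
  ▷-∑ h = ∑-homo V.+ᴹ-commutativeMonoid V.+ᴹ-commutativeMonoid (h ▷_) (▷.*ₗ-zeroʳ h) (▷.*ₗ-distribˡ h)

  -- T̅ⱼ (p^ℓ(u) 𝒴_{ι u}) = a(u) 𝒴_{ι u} + b(usᵢ) 𝒴_{ι(usᵢ)}, and after reindexing
  -- the second part by u ↦ usᵢ the coefficients add up to p · p^ℓ(u).
  module _ {r : ℕ} (i : Fin (pred r)) (j : Fin (pred n)) (ι : Permutation′ r → Permutation′ n)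
    (ι-cong : ∀ {u w} → u ≈ₚ w → ι u ≈ₚ ι w)
    (ι-·s : ∀ u → ι (u · s i) ≈ₚ ι u · s j)
    (ι-ascent : ∀ u → Ascent u i → Ascent (ι u) j)
    (ι-descent : ∀ u → Descent u i → Descent (ι u) j)
    where
    private
      -- `a u` is the diagonal contribution and `b u` what 𝒴 (ι u) receives from its partner usᵢ. If
      -- i is a descent of u, the partner is shorter and contributes pq · p^(ℓ(u)-1) = q · p^ℓ(u);
      -- otherwise it is longer and contributes p^(ℓ(u)+1).
      a b : Permutation′ r → 𝒜ħ.Carrier
      a u = if does (u ⟨$⟩ʳ hi i Fin.<? u ⟨$⟩ʳ lo i) then (p 𝒜ħ.- q) 𝒜ħ.* p 𝒜ħ.^ ℓ u else 𝒜ħ.0#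
      b u = (if does (u ⟨$⟩ʳ hi i Fin.<? u ⟨$⟩ʳ lo i) then q else p) 𝒜ħ.* p 𝒜ħ.^ ℓ u

      b-cong : ∀ {u w} → u ≈ₚ w → b u ≡ b w
      b-cong {u} {w} u≈w = cong₂ 𝒜ħ._*_
        (cong₂ (λ x y → if does (x Fin.<? y) then q else p) (u≈w (hi i)) (u≈w (lo i)))
        (cong (p 𝒜ħ.^_) (ℓ-cong {u = u} {w} u≈w))

      a-descent : ∀ u → Descent u i → a u ≡ (p 𝒜ħ.- q) 𝒜ħ.* p 𝒜ħ.^ ℓ u
      a-descent u d = cong (if_then (p 𝒜ħ.- q) 𝒜ħ.* p 𝒜ħ.^ ℓ u else 𝒜ħ.0#) (does-yes (u ⟨$⟩ʳ hi i Fin.<? u ⟨$⟩ʳ lo i) d)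

      a-ascent : ∀ u → Ascent u i → a u ≡ 𝒜ħ.0#
      a-ascent u asc = cong (if_then (p 𝒜ħ.- q) 𝒜ħ.* p 𝒜ħ.^ ℓ u else 𝒜ħ.0#) (does-no (u ⟨$⟩ʳ hi i Fin.<? u ⟨$⟩ʳ lo i) (ℕ.<-asym asc))

      b-descent : ∀ u → Descent u i → b u ≡ q 𝒜ħ.* p 𝒜ħ.^ ℓ u
      b-descent u d = cong (λ x → (if x then q else p) 𝒜ħ.* p 𝒜ħ.^ ℓ u) (does-yes (u ⟨$⟩ʳ hi i Fin.<? u ⟨$⟩ʳ lo i) d)

      b-ascent : ∀ u → Ascent u i → b u ≡ p 𝒜ħ.* p 𝒜ħ.^ ℓ u
      b-ascent u asc = cong (λ x → (if x then q else p) 𝒜ħ.* p 𝒜ħ.^ ℓ u) (does-no (u ⟨$⟩ʳ hi i Fin.<? u ⟨$⟩ʳ lo i) (ℕ.<-asym asc))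

      term : (Permutation′ r → 𝒜ħ.Carrier) → Permutation′ r → Carrierᴹ
      term f u = φ (f u) *ₗ 𝒴 (ι u)

      split : ∀ u → T̅ j ▷ term (λ u → p 𝒜ħ.^ ℓ u) u ≈ᴹ term a u +ᴹ term b (u · s i)
      split u with ascent-or-descent u i
      ... | inj₁ asc = begin
        T̅ j ▷ (φ P *ₗ 𝒴 (ι u))                     ≈⟨ ▷-linear _ _ _ ⟩
        φ P *ₗ (T̅ j ▷ 𝒴 (ι u))                     ≈⟨ V.*ₗ-congˡ (T̅▷𝒴-ascent (ι-ascent u asc)) ⟩
        φ P *ₗ (φ (p 𝒜ħ.* q) *ₗ 𝒴 (ι u · s j))     ≈⟨ φ-*ₗ-* _ _ _ ⟨
        φ (P 𝒜ħ.* (p 𝒜ħ.* q)) *ₗ 𝒴 (ι u · s j)     ≈⟨ V.*ₗ-cong (φ.⟦⟧-cong P[pq]≈b) (𝒴-cong {ι (u · s i)} {ι u · s j} (ι-·s u)) ⟨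
        term b (u · s i)                           ≈⟨ V.+ᴹ-identityˡ _ ⟨
        0ᴹ +ᴹ term b (u · s i)                     ≈⟨ V.+ᴹ-congʳ a≈0 ⟨
        term a u +ᴹ term b (u · s i)               ∎
        where
        P = p 𝒜ħ.^ ℓ u
        P[pq]≈b : b (u · s i) 𝒜ħ.≈ P 𝒜ħ.* (p 𝒜ħ.* q)
        P[pq]≈b = 𝒜ħ.trans (𝒜ħ.reflexive (trans (b-descent (u · s i) (ascent⇒descent-·s u i asc)) (cong (λ l → q 𝒜ħ.* p 𝒜ħ.^ l) (ℓ-ascent u i asc))))
          (𝒜ħ.trans (𝒜ħ.*-comm q (p 𝒜ħ.* P)) (𝒜ħ.trans (𝒜ħ.*-congʳ (𝒜ħ.*-comm p P)) (𝒜ħ.*-assoc P p q)))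
        a≈0 : term a u ≈ᴹ 0ᴹ
        a≈0 = V.≈ᴹ-trans (V.*ₗ-congʳ (K.trans (K.reflexive (cong φ (a-ascent u asc))) φ.0#-homo)) (V.*ₗ-zeroˡ _)
      ... | inj₂ d = begin
        T̅ j ▷ (φ P *ₗ 𝒴 (ι u))                                     ≈⟨ ▷-linear _ _ _ ⟩
        φ P *ₗ (T̅ j ▷ 𝒴 (ι u))                                     ≈⟨ V.*ₗ-congˡ (T̅▷𝒴-descent (ι-descent u d)) ⟩
        φ P *ₗ (𝒴 (ι u · s j) +ᴹ φ (p 𝒜ħ.- q) *ₗ 𝒴 (ι u))          ≈⟨ V.*ₗ-distribˡ _ _ _ ⟩
        φ P *ₗ 𝒴 (ι u · s j) +ᴹ φ P *ₗ (φ (p 𝒜ħ.- q) *ₗ 𝒴 (ι u))   ≈⟨ V.+ᴹ-comm _ _ ⟩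
        φ P *ₗ (φ (p 𝒜ħ.- q) *ₗ 𝒴 (ι u)) +ᴹ φ P *ₗ 𝒴 (ι u · s j)   ≈⟨ V.+ᴹ-cong
          (V.≈ᴹ-trans (V.≈ᴹ-sym (φ-*ₗ-* _ _ _)) (φ-*ₗ-cong _ (𝒜ħ.trans (𝒜ħ.*-comm _ _) (𝒜ħ.reflexive (sym (a-descent u d))))))
          (V.*ₗ-cong (φ.⟦⟧-cong (𝒜ħ.reflexive P≡b)) (V.≈ᴹ-sym (𝒴-cong {ι (u · s i)} {ι u · s j} (ι-·s u)))) ⟩
        term a u +ᴹ term b (u · s i)                               ∎
        where
        P = p 𝒜ħ.^ ℓ u
        P≡b : P ≡ b (u · s i)
        P≡b = trans (cong (p 𝒜ħ.^_) (ℓ-descent u i d)) (sym (b-ascent (u · s i) (descent⇒ascent-·s u i d)))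

      a+b : ∀ u → a u 𝒜ħ.+ b u 𝒜ħ.≈ p 𝒜ħ.* p 𝒜ħ.^ ℓ u
      a+b u with ascent-or-descent u i
      ... | inj₁ asc = 𝒜ħ.trans (𝒜ħ.reflexive (cong₂ 𝒜ħ._+_ (a-ascent u asc) (b-ascent u asc))) (𝒜ħ.+-identityˡ _)
      ... | inj₂ d = 𝒜ħ.trans (𝒜ħ.reflexive (cong₂ 𝒜ħ._+_ (a-descent u d) (b-descent u d)))
        (𝒜ħ.trans (𝒜ħ.sym (𝒜ħ.distribʳ _ (p 𝒜ħ.- q) q)) (𝒜ħ.*-congʳ
          (𝒜ħ.trans (𝒜ħ.+-assoc p (𝒜ħ.- q) q) (𝒜ħ.trans (𝒜ħ.+-congˡ (𝒜ħ.-‿inverseˡ q)) (𝒜ħ.+-identityʳ p)))))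

    eigenvector : let y = ∑ (permutations r) (λ u → φ (p 𝒜ħ.^ ℓ u) *ₗ 𝒴 (ι u)) in T̅ j ▷ y ≈ᴹ φ p *ₗ y
    eigenvector = begin
      T̅ j ▷ ∑ (permutations r) (term λ u → p 𝒜ħ.^ ℓ u)                         ≈⟨ ▷-∑ (T̅ j) (permutations r) _ ⟩
      ∑ (permutations r) (λ u → T̅ j ▷ term (λ u → p 𝒜ħ.^ ℓ u) u)               ≈⟨ ∑-cong (permutations r) split ⟩
      ∑ (permutations r) (λ u → term a u +ᴹ term b (u · s i))                  ≈⟨ ∑-∙ (permutations r) (term a) _ ⟩
      ∑ (permutations r) (term a) +ᴹ ∑ (permutations r) (λ u → term b (u · s i)) ≈⟨ V.+ᴹ-congˡ reindex ⟩
      ∑ (permutations r) (term a) +ᴹ ∑ (permutations r) (term b)               ≈⟨ ∑-∙ (permutations r) (term a) _ ⟨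
      ∑ (permutations r) (λ u → term a u +ᴹ term b u)
        ≈⟨ ∑-cong (permutations r) (λ u → V.≈ᴹ-trans (V.≈ᴹ-sym (φ-*ₗ-+ _ _ _)) (V.≈ᴹ-trans (φ-*ₗ-cong _ (a+b u)) (φ-*ₗ-* _ _ _))) ⟩
      ∑ (permutations r) (λ u → φ p *ₗ term (λ u → p 𝒜ħ.^ ℓ u) u)              ≈⟨ *ₗ-∑ (φ p) (permutations r) _ ⟨
      φ p *ₗ ∑ (permutations r) (term λ u → p 𝒜ħ.^ ℓ u)                        ∎
      where
      reindex : ∑ (permutations r) (λ u → term b (u · s i)) ≈ᴹ ∑ (permutations r) (term b)
      reindex = ∑-involution (permutationSetoid r) ≈ₚ-dec (permutations-unique r) permutations-complete
        (_· s i) (λ u≈w x → u≈w (s {r} i ⟨$⟩ʳ x)) (·s·s {r} i) (term b)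
        (λ {u} {w} u≈w → V.*ₗ-cong (K.reflexive (cong φ (b-cong {u} {w} u≈w))) (𝒴-cong {ι u} {ι w} (ι-cong {u} {w} u≈w)))

-- Eigenvalues on 𝒴_λ, duality and expansion

module Parabolic (k m : ℕ) {c ℓ₁ ℓ₂ v ℓv : Level} (V : SchubertRepresentation (k + m) c ℓ₁ ℓ₂ v ℓv)
  ([k]![m]!-unit : SchubertRepresentation.𝔽.Unit V (SchubertRepresentation.φ V ([ k ]! 𝒜ħ.* [ m ]!)))
  where
  open SchubertRepresentation V
  open ParabolicSchubert k m V [k]![m]!-unit
  open Ĥ (k + m) hiding (∑)
  open Action V
  open Eigen V
  open ListSum V.+ᴹ-commutativeMonoid
  open SetoidReasoning V.≈ᴹ-setoid
  private
    module 𝒜∑ = ListSum 𝒜ħ.+-commutativeMonoid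
    module K∑ = ListSum K.+-commutativeMonoid
    d = k C 2 + m C 2

  eigenvector-∑ : ∀ {a} {A : Set a} {h e} (as : List A) (x : A → 𝔽.Carrier) (y : A → Carrierᴹ) →
                  (∀ a → h ▷ y a ≈ᴹ e *ₗ y a) → h ▷ ∑ as (λ a → x a *ₗ y a) ≈ᴹ e *ₗ ∑ as (λ a → x a *ₗ y a)
  eigenvector-∑ {h = h} {e} as x y eigen = begin
    h ▷ ∑ as (λ a → x a *ₗ y a)   ≈⟨ ▷-∑ h as _ ⟩
    ∑ as (λ a → h ▷ (x a *ₗ y a)) ≈⟨ ∑-cong as (λ a → V.≈ᴹ-trans (▷-linear h (x a) (y a)) (V.≈ᴹ-trans (V.*ₗ-congˡ (eigen a)) (*ₗ-comm _ _ _))) ⟩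
    ∑ as (λ a → e *ₗ (x a *ₗ y a)) ≈⟨ *ₗ-∑ e as _ ⟨
    e *ₗ ∑ as (λ a → x a *ₗ y a)  ∎

  module _ (y : Carrierᴹ)
    (y-left : ∀ {i j} → lo {k} i ↑ˡ m ≡ lo j → hi {k} i ↑ˡ m ≡ hi j → T̅ j ▷ y ≈ᴹ φ p *ₗ y)
    (y-right : ∀ {i j} → k ↑ʳ lo {m} i ≡ lo j → k ↑ʳ hi {m} i ≡ hi j → T̅ j ▷ y ≈ᴹ φ p *ₗ y)
    where
    -- Every factor of the word of u ⊞ v acts by p: the descents that are stripped lie inside a
    -- block, and stripping one leaves a block sum.
    T̅-⊞-eigenvector : ∀ (u : Permutation′ k) (v : Permutation′ m) → T̅[ u ⊞ v ] ▷ y ≈ᴹ φ (p 𝒜ħ.^ ℓ (u ⊞ v)) *ₗ y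
    T̅-⊞-eigenvector u v = go (ℓ (u ⊞ v)) (u ⊞ v) u v refl (λ _ → refl)
      where
      -- After stripping, w · sⱼ is a block sum only up to `_≈ₚ_`, so the induction carries w apart
      -- from u ⊞ v.
      go : ∀ l w (u : Permutation′ k) (v : Permutation′ m) → ℓ w ≡ l → w ≈ₚ (u ⊞ v) → T̅[ w ] ▷ y ≈ᴹ φ (p 𝒜ħ.^ ℓ w) *ₗ y
      go zero w u v ℓ≡0 _ = begin
        T̅[ w ] ▷ y             ≡⟨ cong (_▷ y) (T̅-ℓ≡0 w ℓ≡0) ⟩
        con 𝒜ħ.1# ▷ y          ≈⟨ ▷-scalar _ _ ⟩
        φ (p 𝒜ħ.^ 0) *ₗ y      ≡⟨ cong (λ l → φ (p 𝒜ħ.^ l) *ₗ y) ℓ≡0 ⟨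
        φ (p 𝒜ħ.^ ℓ w) *ₗ y             ∎
      go (suc l) w u v ℓ≡ w≈ =
        let j , des , eq = T̅-some-descent w (λ ℓ≡0 → contradiction (trans (sym ℓ≡) ℓ≡0) λ ())
        in on j des eq (blockView {k} {m} j)
        where
        step : ∀ j → Descent w j → T̅[ w ] H.≈ T̅[ w · s j ] ⊗ T̅ j → ∀ (u′ : Permutation′ k) (v′ : Permutation′ m) → (w · s j) ≈ₚ (u′ ⊞ v′) → T̅ j ▷ y ≈ᴹ φ p *ₗ y → T̅[ w ] ▷ y ≈ᴹ φ (p 𝒜ħ.^ ℓ w) *ₗ y
        step j des eq u′ v′ ws≈ eigen = begin
          T̅[ w ] ▷ y                         ≈⟨ ▷.*ₗ-congʳ eq ⟩
          (T̅[ w · s j ] ⊗ T̅ j) ▷ y           ≈⟨ ▷.*ₗ-assoc _ _ _ ⟩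
          T̅[ w · s j ] ▷ T̅ j ▷ y             ≈⟨ ▷.*ₗ-congˡ eigen ⟩
          T̅[ w · s j ] ▷ (φ p *ₗ y)          ≈⟨ ▷-linear _ _ _ ⟩
          φ p *ₗ (T̅[ w · s j ] ▷ y)
            ≈⟨ V.*ₗ-congˡ (go l (w · s j) u′ v′ (ℕ.suc-injective (trans (sym (ℓ-descent w j des)) ℓ≡)) ws≈) ⟩
          φ p *ₗ (φ (p 𝒜ħ.^ ℓ (w · s j)) *ₗ y)        ≈⟨ φ-*ₗ-* _ _ _ ⟨
          φ (p 𝒜ħ.^ suc (ℓ (w · s j))) *ₗ y  ≡⟨ cong (λ l → φ (p 𝒜ħ.^ l) *ₗ y) (ℓ-descent w j des) ⟨
          φ (p 𝒜ħ.^ ℓ w) *ₗ y                         ∎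
        on : ∀ j → Descent w j → T̅[ w ] H.≈ T̅[ w · s j ] ⊗ T̅ j → BlockView {k} {m} j → T̅[ w ] ▷ y ≈ᴹ φ (p 𝒜ħ.^ ℓ w) *ₗ y
        on j des eq (left i lo≡ hi≡) = step j des eq (u · s i) v (λ x → trans (w≈ _) (⊞-·s-left lo≡ hi≡ u v x)) (y-left lo≡ hi≡)
        on j des eq (right i lo≡ hi≡) = step j des eq u (v · s i) (λ x → trans (w≈ _) (⊞-·s-right lo≡ hi≡ u v x)) (y-right lo≡ hi≡)
        -- A block sum keeps all values of the first block below those of the second, so it has no
        -- descent across the boundary.
        on j des eq (boundary {a} {b} lo≡ hi≡) = contradiction
          (subst₂ Fin._<_
            (trans (cong (w ⟨$⟩ʳ_) (sym hi≡)) (trans (w≈ _) (⊞-↑ʳ u v b)))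
            (trans (cong (w ⟨$⟩ʳ_) (sym lo≡)) (trans (w≈ _) (⊞-↑ˡ u v a))) des)
          (ℕ.<-asym (↑ˡ<↑ʳ (u ⟨$⟩ʳ a) (v ⟨$⟩ʳ b)))

  module _ (κ : Partition k m) where
    private
      g = grassmannian κ
      g↑ = grassmannian-increasing κ

      𝒴⊞ : Permutation′ k → Permutation′ m → Carrierᴹ
      𝒴⊞ u v = 𝒴 (g · (u ⊞ v))

      p^ℓ : ∀ {n} → Permutation′ n → 𝔽.Carrier
      p^ℓ u = φ (p 𝒜ħ.^ ℓ u)

      p^ℓ-⊞ : ∀ (u : Permutation′ k) (v : Permutation′ m) y → p^ℓ (u ⊞ v) *ₗ y ≈ᴹ p^ℓ u *ₗ (p^ℓ v *ₗ y)
      p^ℓ-⊞ u v y = V.≈ᴹ-trans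
        (φ-*ₗ-cong y (𝒜ħ.trans (𝒜ħ.reflexive (cong (p 𝒜ħ.^_) (ℓ-⊞ u v))) (Exp.^-homo-* 𝒜ħ.semiring p (ℓ u) (ℓ v))))
        (φ-*ₗ-* _ _ y)

    -- For a transposition of the second block, `eigenvector` applies to the inner sum with u
    -- frozen; `𝒴ₚ-left` nests the sums the other way round for the first block.
    𝒴ₚ-right : 𝒴ₚ κ ≈ᴹ ∑ (permutations k) λ u → p^ℓ u *ₗ ∑ (permutations m) λ v → p^ℓ v *ₗ 𝒴⊞ u v
    𝒴ₚ-right = begin
      𝒴ₚ κ ≈⟨ ∑-cartesianProductWith _⊞_ (permutations k) (permutations m) _ ⟩
      ∑ (permutations k) (λ u → ∑ (permutations m) λ v → p^ℓ (u ⊞ v) *ₗ 𝒴⊞ u v)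
        ≈⟨ ∑-cong (permutations k) (λ u → V.≈ᴹ-trans (∑-cong (permutations m) λ v → p^ℓ-⊞ u v _) (V.≈ᴹ-sym (*ₗ-∑ (p^ℓ u) (permutations m) _))) ⟩
      ∑ (permutations k) (λ u → p^ℓ u *ₗ ∑ (permutations m) λ v → p^ℓ v *ₗ 𝒴⊞ u v) ∎

    𝒴ₚ-left : 𝒴ₚ κ ≈ᴹ ∑ (permutations m) λ v → p^ℓ v *ₗ ∑ (permutations k) λ u → p^ℓ u *ₗ 𝒴⊞ u v
    𝒴ₚ-left = begin
      𝒴ₚ κ ≈⟨ ∑-cartesianProductWith _⊞_ (permutations k) (permutations m) _ ⟩
      ∑ (permutations k) (λ u → ∑ (permutations m) λ v → p^ℓ (u ⊞ v) *ₗ 𝒴⊞ u v) ≈⟨ ∑-swap (permutations k) (permutations m) _ ⟩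
      ∑ (permutations m) (λ v → ∑ (permutations k) λ u → p^ℓ (u ⊞ v) *ₗ 𝒴⊞ u v)
        ≈⟨ ∑-cong (permutations m) (λ v → V.≈ᴹ-trans (∑-cong (permutations k) λ u → V.≈ᴹ-trans (p^ℓ-⊞ u v _) (*ₗ-comm _ _ _)) (V.≈ᴹ-sym (*ₗ-∑ (p^ℓ v) (permutations k) _))) ⟩
      ∑ (permutations m) (λ v → p^ℓ v *ₗ ∑ (permutations k) λ u → p^ℓ u *ₗ 𝒴⊞ u v) ∎

    T̅▷𝒴ₚ-left : ∀ {i j} → lo {k} i ↑ˡ m ≡ lo j → hi {k} i ↑ˡ m ≡ hi j → T̅ j ▷ 𝒴ₚ κ ≈ᴹ φ p *ₗ 𝒴ₚ κ
    T̅▷𝒴ₚ-left {i} {j} lo≡ hi≡ = begin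
      T̅ j ▷ 𝒴ₚ κ      ≈⟨ ▷.*ₗ-congˡ 𝒴ₚ-left ⟩
      T̅ j ▷ _         ≈⟨ eigenvector-∑ (permutations m) p^ℓ _ (λ v → eigenvector {k} i j (λ u → g · (u ⊞ v))
                           (λ {u} {u′} u≈u′ x → cong (g ⟨$⟩ʳ_) (⊞-cong {u = u} {u′} {v} {v} u≈u′ (λ _ → refl) x))
                           (λ u x → cong (g ⟨$⟩ʳ_) (sym (⊞-·s-left lo≡ hi≡ u v x)))
                           (λ u asc → subst₂ Fin._<_ (at u v (lo i) lo≡) (at u v (hi i) hi≡) (proj₁ g↑ asc))
                           (λ u des → subst₂ Fin._<_ (at u v (hi i) hi≡) (at u v (lo i) lo≡) (proj₁ g↑ des))) ⟩
      φ p *ₗ _        ≈⟨ V.*ₗ-congˡ 𝒴ₚ-left ⟨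
      φ p *ₗ 𝒴ₚ κ     ∎
      where
      at : ∀ u v a {x} → a ↑ˡ m ≡ x → g ⟨$⟩ʳ ((u ⟨$⟩ʳ a) ↑ˡ m) ≡ g · (u ⊞ v) ⟨$⟩ʳ x
      at u v a refl = cong (g ⟨$⟩ʳ_) (sym (⊞-↑ˡ u v a))

    T̅▷𝒴ₚ-right : ∀ {i j} → k ↑ʳ lo {m} i ≡ lo j → k ↑ʳ hi {m} i ≡ hi j → T̅ j ▷ 𝒴ₚ κ ≈ᴹ φ p *ₗ 𝒴ₚ κ
    T̅▷𝒴ₚ-right {i} {j} lo≡ hi≡ = begin
      T̅ j ▷ 𝒴ₚ κ      ≈⟨ ▷.*ₗ-congˡ 𝒴ₚ-right ⟩
      T̅ j ▷ _         ≈⟨ eigenvector-∑ (permutations k) p^ℓ _ (λ u → eigenvector {m} i j (λ v → g · (u ⊞ v))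
                           (λ {v} {v′} v≈v′ x → cong (g ⟨$⟩ʳ_) (⊞-cong {u = u} {u} {v} {v′} (λ _ → refl) v≈v′ x))
                           (λ v x → cong (g ⟨$⟩ʳ_) (sym (⊞-·s-right lo≡ hi≡ u v x)))
                           (λ v asc → subst₂ Fin._<_ (at u v (lo i) lo≡) (at u v (hi i) hi≡) (proj₂ g↑ asc))
                           (λ v des → subst₂ Fin._<_ (at u v (hi i) hi≡) (at u v (lo i) lo≡) (proj₂ g↑ des))) ⟩
      φ p *ₗ _        ≈⟨ V.*ₗ-congˡ 𝒴ₚ-right ⟨
      φ p *ₗ 𝒴ₚ κ     ∎
      where
      at : ∀ u v b {x} → k ↑ʳ b ≡ x → g ⟨$⟩ʳ (k ↑ʳ (v ⟨$⟩ʳ b)) ≡ g · (u ⊞ v) ⟨$⟩ʳ x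
      at u v b refl = cong (g ⟨$⟩ʳ_) (sym (⊞-↑ʳ u v b))

    T̅-⊞▷𝒴ₚ : ∀ (u : Permutation′ k) (v : Permutation′ m) → T̅[ u ⊞ v ] ▷ 𝒴ₚ κ ≈ᴹ p^ℓ (u ⊞ v) *ₗ 𝒴ₚ κ
    T̅-⊞▷𝒴ₚ = T̅-⊞-eigenvector (𝒴ₚ κ) T̅▷𝒴ₚ-left T̅▷𝒴ₚ-right

    Σ-numerator▷𝒴ₚ : Σ-numerator k m ▷ 𝒴ₚ κ ≈ᴹ φ ([ k ]! 𝒜ħ.* [ m ]!) *ₗ 𝒴ₚ κ
    Σ-numerator▷𝒴ₚ = begin
      Σ-numerator k m ▷ 𝒴ₚ κ
        ≈⟨ ∑-homo H.+-commutativeMonoid V.+ᴹ-commutativeMonoid (_▷ 𝒴ₚ κ) (▷.*ₗ-zeroˡ _) (▷.*ₗ-distribʳ _) (youngSubgroup k m) _ ⟩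
      ∑ (youngSubgroup k m) (λ w → (con (q 𝒜ħ.^ (d ∸ ℓ w)) ⊗ T̅[ w ]) ▷ 𝒴ₚ κ)
        -- The sum is taken over pairs (u, v) because `∑-cong` compares the summands at all indices,
        -- whereas the eigenvalue is known for block sums.
        ≈⟨ ∑-cartesianProductWith _⊞_ (permutations k) (permutations m) _ ⟩
      ∑ (permutations k) (λ u → ∑ (permutations m) λ v → (con (q 𝒜ħ.^ (d ∸ ℓ (u ⊞ v))) ⊗ T̅[ u ⊞ v ]) ▷ 𝒴ₚ κ)
        ≈⟨ ∑-cong (permutations k) (λ u → ∑-cong (permutations m) λ v → term u v) ⟩
      ∑ (permutations k) (λ u → ∑ (permutations m) λ v → φ (Poincaré.weight d (ℓ (u ⊞ v))) *ₗ 𝒴ₚ κ)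
        ≈⟨ ∑-cartesianProductWith _⊞_ (permutations k) (permutations m) _ ⟨
      ∑ (youngSubgroup k m) (λ w → φ (Poincaré.weight d (ℓ w)) *ₗ 𝒴ₚ κ)
        ≈⟨ ∑-homo 𝒜ħ.+-commutativeMonoid V.+ᴹ-commutativeMonoid (λ a → φ a *ₗ 𝒴ₚ κ)
             (V.≈ᴹ-trans (V.*ₗ-congʳ φ.0#-homo) (V.*ₗ-zeroˡ _)) (λ a b → φ-*ₗ-+ a b _) (youngSubgroup k m) _ ⟨
      φ (𝒜∑.∑ (youngSubgroup k m) (λ w → Poincaré.weight d (ℓ w))) *ₗ 𝒴ₚ κ
        ≈⟨ φ-*ₗ-cong _ (Poincaré.young-poincaré k m) ⟩
      φ ([ k ]! 𝒜ħ.* [ m ]!) *ₗ 𝒴ₚ κ ∎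
      where
      term : ∀ (u : Permutation′ k) (v : Permutation′ m) → (con (q 𝒜ħ.^ (d ∸ ℓ (u ⊞ v))) ⊗ T̅[ u ⊞ v ]) ▷ 𝒴ₚ κ ≈ᴹ φ (Poincaré.weight d (ℓ (u ⊞ v))) *ₗ 𝒴ₚ κ
      term u v = begin
        (con (q 𝒜ħ.^ (d ∸ ℓ (u ⊞ v))) ⊗ T̅[ u ⊞ v ]) ▷ 𝒴ₚ κ      ≈⟨ ▷.*ₗ-assoc _ _ _ ⟩
        con (q 𝒜ħ.^ (d ∸ ℓ (u ⊞ v))) ▷ T̅[ u ⊞ v ] ▷ 𝒴ₚ κ        ≈⟨ ▷-scalar _ _ ⟩
        φ (q 𝒜ħ.^ (d ∸ ℓ (u ⊞ v))) *ₗ (T̅[ u ⊞ v ] ▷ 𝒴ₚ κ)       ≈⟨ V.*ₗ-congˡ (T̅-⊞▷𝒴ₚ u v) ⟩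
        φ (q 𝒜ħ.^ (d ∸ ℓ (u ⊞ v))) *ₗ (p^ℓ (u ⊞ v) *ₗ 𝒴ₚ κ)     ≈⟨ φ-*ₗ-* _ _ _ ⟨
        φ (Poincaré.weight d (ℓ (u ⊞ v))) *ₗ 𝒴ₚ κ               ∎

    Σ▷𝒴ₚ : Σ▷ 𝒴ₚ κ ≈ᴹ 𝒴ₚ κ
    Σ▷𝒴ₚ = begin
      𝔽.1/ [k]![m]!-unit *ₗ (Σ-numerator k m ▷ 𝒴ₚ κ)  ≈⟨ V.*ₗ-congˡ Σ-numerator▷𝒴ₚ ⟩
      𝔽.1/ [k]![m]!-unit *ₗ (φ ([ k ]! 𝒜ħ.* [ m ]!) *ₗ 𝒴ₚ κ)  ≈⟨ V.*ₗ-assoc _ _ _ ⟨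
      (𝔽.1/ [k]![m]!-unit K.* φ ([ k ]! 𝒜ħ.* [ m ]!)) *ₗ 𝒴ₚ κ ≈⟨ V.*ₗ-congʳ (proj₁ (proj₂ [k]![m]!-unit)) ⟩
      K.1# *ₗ 𝒴ₚ κ                                    ≈⟨ V.*ₗ-identityˡ _ ⟩
      𝒴ₚ κ                                            ∎

  ev-∑ : ∀ {a} {A : Set a} (as : List A) f → ev (∑ as f) 𝔽.≈ K∑.∑ as (ev ∘ f)
  ev-∑ = ∑-homo V.+ᴹ-commutativeMonoid K.+-commutativeMonoid ev ev.0ᴹ-homo ev.+ᴹ-homo

  private
    module ≈ = SetoidReasoning K.setoid

    term : Partition k m → Partition k m → Permutation′ k → Permutation′ m → 𝔽.Carrier
    term μ ν u v = φ (p 𝒜ħ.^ ℓ (u ⊞ v)) K.* ev (T̅[ grassmannian μ ] ▷ 𝒴 (grassmannian ν · (u ⊞ v)))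

  ev-T̅ₚ : ∀ μ ν → ev (T̅ₚ[ μ ]▷ 𝒴ₚ ν) 𝔽.≈ K∑.∑ (permutations k) (λ u → K∑.∑ (permutations m) (term μ ν u))
  ev-T̅ₚ μ ν = ≈.begin
    ev (T̅[ grassmannian μ ] ▷ (Σ▷ 𝒴ₚ ν))  ≈.≈⟨ ev.⟦⟧-cong (▷.*ₗ-congˡ (Σ▷𝒴ₚ ν)) ⟩
    ev (T̅[ grassmannian μ ] ▷ 𝒴ₚ ν)       ≈.≈⟨ ev.⟦⟧-cong (▷-∑ _ (youngSubgroup k m) _) ⟩
    ev (∑ (youngSubgroup k m) λ w → T̅[ grassmannian μ ] ▷ (φ (p 𝒜ħ.^ ℓ w) *ₗ 𝒴 (grassmannian ν · w)))
      ≈.≈⟨ ev-∑ (youngSubgroup k m) _ ⟩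
    K∑.∑ (youngSubgroup k m) (λ w → ev (T̅[ grassmannian μ ] ▷ (φ (p 𝒜ħ.^ ℓ w) *ₗ 𝒴 (grassmannian ν · w))))
      ≈.≈⟨ K∑.∑-cong (youngSubgroup k m) (λ w → K.trans (ev.⟦⟧-cong (▷-linear _ _ _)) (ev.*ₗ-homo _ _)) ⟩
    K∑.∑ (youngSubgroup k m) (λ w → φ (p 𝒜ħ.^ ℓ w) K.* ev (T̅[ grassmannian μ ] ▷ 𝒴 (grassmannian ν · w)))
      ≈.≈⟨ K∑.∑-cartesianProductWith _⊞_ (permutations k) (permutations m) _ ⟩
    K∑.∑ (permutations k) (λ u → K∑.∑ (permutations m) (term μ ν u)) ≈.∎

  private
    term≈0 : ∀ μ ν u v → ¬ grassmannian ν · (u ⊞ v) ≈ₚ grassmannian μ → term μ ν u v 𝔽.≈ 𝔽.0#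
    term≈0 μ ν u v ≉ = K.trans (K.*-congˡ (Dual.off (T̅-dual (grassmannian μ)) _ ≉)) (K.zeroʳ _)

  ev-T̅ₚ-≡ : ∀ μ → ev (T̅ₚ[ μ ]▷ 𝒴ₚ μ) 𝔽.≈ ev (𝒴 id)
  ev-T̅ₚ-≡ μ = K.trans (ev-T̅ₚ μ μ)
    (K∑.∑-support (permutationSetoid k) {x = id} {ev (𝒴 id)} (permutations-unique k) (permutations-complete id) _
      (λ u u≈id → K∑.∑-support (permutationSetoid m) {x = id} {ev (𝒴 id)} (permutations-unique m) (permutations-complete id) _
        (λ v v≈id → at u v u≈id v≈id)
        (λ v v≉id → term≈0 μ μ u v λ eq → v≉id (right-id u v eq)))
      (λ u u≉id → K.trans (K∑.∑-cong (permutations m) λ v → term≈0 μ μ u v λ eq → u≉id (left-id u v eq)) (K∑.∑-ε (permutations m))))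
    where
    g = grassmannian μ
    ⊞≈id : ∀ u v → g · (u ⊞ v) ≈ₚ g → (u ⊞ v) ≈ₚ id
    ⊞≈id u v eq = ·-cancelˡ g {u ⊞ v} {id} eq
    left-id : ∀ u v → g · (u ⊞ v) ≈ₚ g → u ≈ₚ id
    left-id u v eq a = Fin.↑ˡ-injective m _ _ (trans (sym (⊞-↑ˡ u v a)) (⊞≈id u v eq (a ↑ˡ m)))
    right-id : ∀ u v → g · (u ⊞ v) ≈ₚ g → v ≈ₚ id
    right-id u v eq b = Fin.↑ʳ-injective k _ _ (trans (sym (⊞-↑ʳ u v b)) (⊞≈id u v eq (k ↑ʳ b)))
    at : ∀ u v → u ≈ₚ id → v ≈ₚ id → term μ μ u v 𝔽.≈ ev (𝒴 id)
    at u v u≈id v≈id = ≈.begin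
      term μ μ u v ≈.≈⟨ K.*-cong (K.trans (K.reflexive (cong (λ l → φ (p 𝒜ħ.^ l)) ℓ≡0)) φ.1#-homo)
                         (Dual.at (T̅-dual g) _ λ x → cong (g ⟨$⟩ʳ_) (w≈id x)) ⟩
      K.1# K.* ev (𝒴 id) ≈.≈⟨ K.*-identityˡ _ ⟩
      ev (𝒴 id) ≈.∎
      where
      w≈id : (u ⊞ v) ≈ₚ id
      w≈id x = trans (⊞-cong {u = u} {id} {v} {id} u≈id v≈id x) (id⊞id {k} {m} x)
      ℓ≡0 : ℓ (u ⊞ v) ≡ 0
      ℓ≡0 = trans (ℓ-cong {u = u ⊞ v} {id} w≈id) (sum-zero λ i → sum-zero (mono⇒inversion≡0 (id {k + m}) (λ i<j → i<j) i))

  ev-T̅ₚ-≢ : ∀ μ ν → μ ≢ ν → ev (T̅ₚ[ μ ]▷ 𝒴ₚ ν) 𝔽.≈ 𝔽.0#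
  ev-T̅ₚ-≢ μ ν μ≢ν = K.trans (ev-T̅ₚ μ ν) (K.trans
    (K∑.∑-cong (permutations k) λ u → K.trans
      (K∑.∑-cong (permutations m) λ v → term≈0 μ ν u v λ eq →
        μ≢ν (grassmannian-injective μ ν {u} {v} (≈ₚ-sym {u = grassmannian ν · (u ⊞ v)} {grassmannian μ} eq)))
      (K∑.∑-ε (permutations m)))
    (K∑.∑-ε (permutations k)))

  T̅ₚ-cong : ∀ κ {f g} → f ≈ᴹ g → T̅ₚ[ κ ]▷ f ≈ᴹ T̅ₚ[ κ ]▷ g
  T̅ₚ-cong κ f≈g = ▷.*ₗ-congˡ (V.*ₗ-congˡ (▷.*ₗ-congˡ f≈g))

  -- The scalar a lies in the field and need not be the image of an element of `𝒜ħ`, so it passes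
  -- through the Hecke action by `▷-linear`.
  T̅ₚ-*ₗ : ∀ κ a f → T̅ₚ[ κ ]▷ (a *ₗ f) ≈ᴹ a *ₗ (T̅ₚ[ κ ]▷ f)
  T̅ₚ-*ₗ κ a f = begin
    T̅[ grassmannian κ ] ▷ (Σ▷ (a *ₗ f))        ≈⟨ ▷.*ₗ-congˡ (V.*ₗ-congˡ (▷-linear _ _ _)) ⟩
    T̅[ grassmannian κ ] ▷ (_ *ₗ (a *ₗ (Σ-numerator k m ▷ f))) ≈⟨ ▷.*ₗ-congˡ (*ₗ-comm _ _ _) ⟩
    T̅[ grassmannian κ ] ▷ (a *ₗ (Σ▷ f))        ≈⟨ ▷-linear _ _ _ ⟩
    a *ₗ (T̅ₚ[ κ ]▷ f)                          ∎

  T̅ₚ-∑ : ∀ κ {a} {A : Set a} (as : List A) f → T̅ₚ[ κ ]▷ ∑ as f ≈ᴹ ∑ as (λ a → T̅ₚ[ κ ]▷ f a)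
  T̅ₚ-∑ κ = ∑-homo V.+ᴹ-commutativeMonoid V.+ᴹ-commutativeMonoid (T̅ₚ[ κ ]▷_)
    (V.≈ᴹ-trans (▷.*ₗ-congˡ (V.≈ᴹ-trans (V.*ₗ-congˡ (▷.*ₗ-zeroʳ _)) (V.*ₗ-zeroʳ _))) (▷.*ₗ-zeroʳ _))
    (λ f g → V.≈ᴹ-trans (▷.*ₗ-congˡ (V.≈ᴹ-trans (V.*ₗ-congˡ (▷.*ₗ-distribˡ _ _ _)) (V.*ₗ-distribˡ _ _ _))) (▷.*ₗ-distribˡ _ _ _))

  coefficient : ∀ (a : Partition k m → 𝔽.Carrier) {f} → f ≈ᴹ ∑ (partitions k m) (λ κ → a κ *ₗ 𝒴ₚ κ) →
                ∀ κ → ev (T̅ₚ[ κ ]▷ f) 𝔽.≈ ev (𝒴 id) K.* a κ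
  coefficient a {f} f≈ κ = ≈.begin
    ev (T̅ₚ[ κ ]▷ f)                                        ≈.≈⟨ ev.⟦⟧-cong (V.≈ᴹ-trans (T̅ₚ-cong κ f≈) (T̅ₚ-∑ κ (partitions k m) _)) ⟩
    ev (∑ (partitions k m) λ ν → T̅ₚ[ κ ]▷ (a ν *ₗ 𝒴ₚ ν))   ≈.≈⟨ ev-∑ (partitions k m) _ ⟩
    K∑.∑ (partitions k m) (λ ν → ev (T̅ₚ[ κ ]▷ (a ν *ₗ 𝒴ₚ ν)))
      ≈.≈⟨ K∑.∑-cong (partitions k m) (λ ν → K.trans (ev.⟦⟧-cong (T̅ₚ-*ₗ κ (a ν) (𝒴ₚ ν))) (ev.*ₗ-homo _ _)) ⟩
    K∑.∑ (partitions k m) (λ ν → a ν K.* ev (T̅ₚ[ κ ]▷ 𝒴ₚ ν))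
      ≈.≈⟨ K∑.∑-support (≡.setoid _) (PartitionFacts.partitions-unique k m) (PartitionFacts.partitions-complete κ) _
             (λ { ν refl → K.trans (K.*-congˡ (ev-T̅ₚ-≡ κ)) (K.*-comm _ _) })
             (λ ν ν≢κ → K.trans (K.*-congˡ (ev-T̅ₚ-≢ κ ν (ν≢κ ∘ sym))) (K.zeroʳ _)) ⟩
    ev (𝒴 id) K.* a κ ≈.∎

  -- Membership in the span supplies coefficients, and duality recovers each of them up to the
  -- factor ev(𝒴_id), which is invertible.
  expansion : ∀ f → InSpan f → f ≈ᴹ 𝔽.1/ ev𝒴id-unit *ₗ ∑ (partitions k m) (λ κ → ev (T̅ₚ[ κ ]▷ f) *ₗ 𝒴ₚ κ)
  expansion f (a , f≈) = begin
    f ≈⟨ f≈ ⟩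
    ∑ (partitions k m) (λ κ → a κ *ₗ 𝒴ₚ κ) ≈⟨ ∑-cong (partitions k m) (λ κ → V.≈ᴹ-trans (V.*ₗ-congʳ (scalar κ)) (V.*ₗ-assoc _ _ _)) ⟩
    ∑ (partitions k m) (λ κ → 𝔽.1/ ev𝒴id-unit *ₗ (ev (T̅ₚ[ κ ]▷ f) *ₗ 𝒴ₚ κ)) ≈⟨ *ₗ-∑ _ (partitions k m) _ ⟨
    𝔽.1/ ev𝒴id-unit *ₗ ∑ (partitions k m) (λ κ → ev (T̅ₚ[ κ ]▷ f) *ₗ 𝒴ₚ κ) ∎
    where
    scalar : ∀ κ → a κ 𝔽.≈ 𝔽.1/ ev𝒴id-unit K.* ev (T̅ₚ[ κ ]▷ f)
    scalar κ = ≈.begin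
      a κ                                         ≈.≈⟨ K.*-identityˡ _ ⟨
      K.1# K.* a κ                                ≈.≈⟨ K.*-congʳ (proj₁ (proj₂ ev𝒴id-unit)) ⟨
      𝔽.1/ ev𝒴id-unit K.* ev (𝒴 id) K.* a κ       ≈.≈⟨ K.*-assoc _ _ _ ⟩
      𝔽.1/ ev𝒴id-unit K.* (ev (𝒴 id) K.* a κ)     ≈.≈⟨ K.*-congˡ (coefficient a f≈ κ) ⟨
      𝔽.1/ ev𝒴id-unit K.* ev (T̅ₚ[ κ ]▷ f)         ≈.∎

theorem4p10 : ∀ {c ℓ₁ ℓ₂ v ℓv : Level} (k m : ℕ) (V : SchubertRepresentation (k + m) c ℓ₁ ℓ₂ v ℓv) →
    let open SchubertRepresentation V in
    ([k]![m]!-unit : 𝔽.Unit (φ ([ k ]! 𝒜ħ.* [ m ]!))) →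
    let open ParabolicSchubert k m V [k]![m]!-unit in
    (∀ (μ ν : Partition k m) →
    (μ ≡ ν → ev (T̅ₚ[ μ ]▷ 𝒴ₚ ν) 𝔽.≈ ev (𝒴 id)) ×
    (μ ≢ ν → ev (T̅ₚ[ μ ]▷ 𝒴ₚ ν) 𝔽.≈ 𝔽.0#))
    ×
    (∀ f → InSpan f →
    f ≈ᴹ 𝔽.1/ ev𝒴id-unit *ₗ ∑ᴹ (partitions k m) λ κ → ev (T̅ₚ[ κ ]▷ f) *ₗ 𝒴ₚ κ)
theorem4p10 k m V [k]![m]!-unit = (λ μ ν → (λ { refl → ev-T̅ₚ-≡ μ }) , ev-T̅ₚ-≢ μ ν) , expansion
  where open Parabolic k m V [k]![m]!-unit
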